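{- For all $p,\delta\in(0,1)$ and all $\bar d\ge1$, there exist $K,c_0\in\mathbb{N}$ such that for every $c\ge c_0$ there exist $\rho>0$ and $n_0\in\mathbb{N}$ such that for every $n\ge n_0$ and every degree sequence $\mathcal{D}=(d_1,\dots,d_n)$ with average degree at most $\bar d$ that does not satisfy $A_1(K,c)$ or does not satisfy $A_2(K,0,c)$, we have $\mathbb{P}[L_1(G^{\mathcal{D}}_p)>\rho n]\ge 1-\delta$.
   Context: A degree sequence on $[n]=\{1,\dots,n\}$ is a vector $\mathcal{D}=(d_1,\dots,d_n)$ of positive integers with $d_1\le\dots\le d_n$ which is feasible (realised by some simple graph on $[n]$ with vertex $i$ of degree $d_i$); its average degree is $\frac1n\sum_i d_i$. $G^{\mathcal{D}}$ is a uniformly random simple graph on $[n]$ with degree sequence $\mathcal{D}$; $G_p$ is obtained from $G$ by retaining each edge independently with probability $p$, and $G^{\mathcal{D}}_p$ means percolating $G^{\mathcal{D}}$. $L_1(G)$ is the number of vertices in a largest component. $W(c,\mathcal{D})=\{i:d_i\ge c\}$ (so $W(0,\mathcal{D})=[n]$). $\mathcal{D}$ satisfies $A_1(x,c)$ if $\sum_{i\in W(c,\mathcal{D})}d_i\le \frac{x}{c}n$, and $A_2(x,c_1,c_2)$ if $\sum_{i\in W(c_1,\mathcal{D})\setminus W(c_2,\mathcal{D})}d_i^2\le\frac{x}{4}n$.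
   Formalization: The parameters p, δ and the bound d̄ on the average degree are rational instead of real (ρ is found rational); the case of real p follows by monotone coupling with a smaller rational p, and real δ, d̄ by rounding. -}

module Defs where

open import Data.Bool using (Bool; true; false; _∧_; _∨_; not; if_then_else_)
open import Data.Nat as ℕ using (ℕ; zero; suc; _≤ᵇ_; _≡ᵇ_)
open import Data.Fin as Fin using (Fin)
open import Data.Fin.Properties using () renaming (_≟_ to _≟ᶠ_)
open import Data.List using (List; []; _∷_; map; concatMap; filter; length; foldr; allFin)
open import Data.Nat.ListAction using (sum)
open import Data.Bool.ListAction using (any; all)
open import Data.Bool.Properties using (T?)
open import Data.Vec using (Vec; []; _∷_)
open import Data.Product using (_×_; _,_; ∃-syntax)
open import Data.Integer using (+_)
open import Data.Rational as ℚ using (ℚ; 0ℚ; 1ℚ; _/_)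
open import Data.Rational.Properties using () renaming (_<?_ to _<ℚ?_)
open import Relation.Nullary using (does)
open import Relation.Binary.PropositionalEquality using (_≡_)

ℕ→ℚ : ℕ → ℚ
ℕ→ℚ k = + k / 1

ΣV : (n : ℕ) → (Fin n → ℕ) → ℕ
ΣV n f = sum (map f (allFin n))

countV : (n : ℕ) → (Fin n → Bool) → ℕ
countV n P = ΣV n (λ i → if P i then 1 else 0)

maxV : (n : ℕ) → (Fin n → ℕ) → ℕ
maxV n f = foldr ℕ._⊔_ 0 (map f (allFin n))

-- Simple graphs on [n]: an indicator for each unordered pair {i,j}, i<j.

slots : (n : ℕ) → List (Fin n × Fin n)
slots n = concatMap (λ i → concatMap (λ j → if Fin.toℕ i ℕ.<ᵇ Fin.toℕ j then (i , j) ∷ [] else []) (allFin n)) (allFin n)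

nSlots : ℕ → ℕ
nSlots n = length (slots n)

Graph : ℕ → Set
Graph n = Vec Bool (nSlots n)

allVecs : (m : ℕ) → List (Vec Bool m)
allVecs zero = [] ∷ []
allVecs (suc m) = concatMap (λ v → (false ∷ v) ∷ (true ∷ v) ∷ []) (allVecs m)

allGraphs : (n : ℕ) → List (Graph n)
allGraphs n = allVecs (nSlots n)

edgesWith : {A : Set} → (l : List A) → Vec Bool (length l) → List (A × Bool)
edgesWith [] [] = []
edgesWith (a ∷ l) (b ∷ v) = (a , b) ∷ edgesWith l v

eqᶠ : {n : ℕ} → Fin n → Fin n → Bool
eqᶠ i j = does (i ≟ᶠ j)

adj : {n : ℕ} → Graph n → Fin n → Fin n → Bool
adj {n} G i j = any (λ { ((a , b) , e) → e ∧ ((eqᶠ a i ∧ eqᶠ b j) ∨ (eqᶠ a j ∧ eqᶠ b i)) }) (edgesWith (slots n) G)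

deg : {n : ℕ} → Graph n → Fin n → ℕ
deg {n} G i = countV n (adj G i)

reach : {n : ℕ} → ℕ → Graph n → Fin n → Fin n → Bool
reach zero G i j = eqᶠ i j
reach {n} (suc k) G i j = reach k G i j ∨ any (λ l → reach k G i l ∧ adj G l j) (allFin n)

-- size of the connected component of i (walks of length ≤ n suffice)
compSize : {n : ℕ} → Graph n → Fin n → ℕ
compSize {n} G i = countV n (reach n G i)

L₁ : {n : ℕ} → Graph n → ℕ
L₁ {n} G = maxV n (compSize G)

hasDegrees : {n : ℕ} → (Fin n → ℕ) → Graph n → Bool
hasDegrees {n} D G = all (λ i → deg G i ≡ᵇ D i) (allFin n)

IsDegSeq : (n : ℕ) → (Fin n → ℕ) → Set
IsDegSeq n D =
  ((i : Fin n) → 1 ℕ.≤ D i) ×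
  ((i j : Fin n) → i Fin.≤ j → D i ℕ.≤ D j) ×
  (∃[ G ] ((i : Fin n) → deg G i ≡ D i))

AvgDegAtMost : (n : ℕ) → (Fin n → ℕ) → ℚ → Set
AvgDegAtMost n D d̄ = ℕ→ℚ (ΣV n D) ℚ.≤ d̄ ℚ.* ℕ→ℚ n

-- A₁(x,c):  Σ_{i ∈ W(c)} dᵢ ≤ (x/c) n , written multiplied out as c · Σ ≤ x · n
A₁ : (n : ℕ) → ℕ → ℕ → (Fin n → ℕ) → Set
A₁ n x c D = c ℕ.* ΣV n (λ i → if c ≤ᵇ D i then D i else 0) ℕ.≤ x ℕ.* n

-- A₂(x,c₁,c₂):  Σ_{i ∈ W(c₁) ∖ W(c₂)} dᵢ² ≤ (x/4) n , written as 4 · Σ ≤ x · n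
A₂ : (n : ℕ) → ℕ → ℕ → ℕ → (Fin n → ℕ) → Set
A₂ n x c₁ c₂ D =
  4 ℕ.* ΣV n (λ i → if (c₁ ≤ᵇ D i) ∧ not (c₂ ≤ᵇ D i) then D i ℕ.* D i else 0) ℕ.≤ x ℕ.* n

percWeight : ℚ → {m : ℕ} → Vec Bool m → Vec Bool m → ℚ
percWeight p [] [] = 1ℚ
percWeight p (true ∷ g) (true ∷ h) = p ℚ.* percWeight p g h
percWeight p (true ∷ g) (false ∷ h) = (1ℚ ℚ.- p) ℚ.* percWeight p g h
percWeight p (false ∷ g) (false ∷ h) = percWeight p g h
percWeight p (false ∷ g) (true ∷ h) = 0ℚ

sumℚ : List ℚ → ℚ
sumℚ = foldr ℚ._+_ 0ℚ

indicator : Bool → ℚ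
indicator b = if b then 1ℚ else 0ℚ

percProb : {n : ℕ} → ℚ → Graph n → (Graph n → Bool) → ℚ
percProb {n} p G E = sumℚ (map (λ H → percWeight p G H ℚ.* indicator (E H)) (allGraphs n))

-- uniform average over a finite list (0 on the empty list)
uniformAvg : {A : Set} → List A → (A → ℚ) → ℚ
uniformAvg S f with length S
... | zero = 0ℚ
... | suc k = sumℚ (map f S) ℚ.* (+ 1 / suc k)

probGDp : (n : ℕ) → (Fin n → ℕ) → ℚ → (Graph n → Bool) → ℚ
probGDp n D p E = uniformAvg (filter (λ G → T? (hasDegrees D G)) (allGraphs n)) (λ G → percProb {n} p G E)

bigComponent : (n : ℕ) → ℚ → Graph n → Bool
bigComponent n ρ H = does (ρ ℚ.* ℕ→ℚ n <ℚ? ℕ→ℚ (L₁ {n} H))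

{-# OPTIONS --safe #-}

-- Everything is a first-moment double count over pairs (graph, percolation), weighted by integers
-- proportional to the percolation probabilities. Resetting the status of boundedly many pairs of vertices
-- distorts the total weight of a family of configurations by a bounded factor only, so configurations with
-- many moves out of them are rare if every configuration has few moves into it. The moves are changes of
-- the status of one edge and the degree-preserving switchings {ab, cd} → {ac, bd}.
--
-- Suppose all components are small. Then a switching usually creates a bridge, and N disjoint connected
-- classes span fewer than N bridges. If A₁ fails, let the hubs be the vertices of degree at least c and s
-- the sum of their degrees, so that s > (K/c) n. Weight a pair of hubs by its smaller degree: the bridges
-- between hubs have total weight at most s, while about s² switchings of pairs of hub half-edges, of weight
-- at least c and each undone in O(n) ways, create one; since c s² / n > K s this is rare for large K.
--
-- If A₂ fails, we may assume that A₁ holds at a much larger scale. Start from εn seeds and explore along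
-- open edges of the first round between vertices of degree in [2, c). Switching an edge at the boundary of
-- the explored set to a fresh vertex shows that the boundary grows by a factor of order K, whence after a
-- number of steps depending only on c it is linear in n with a constant η such that η² is much larger than
-- ε, since otherwise the expected boundary would exceed its maximum. Finally second-round edges between
-- the εn explored classes form few bridges, whereas order η²n² switchings would create one.
module Submission where

open import Defs
open import Data.Nat using (ℕ; _≤_)
open import Data.Fin using (Fin)
open import Data.Product using (_×_; ∃-syntax)
open import Data.Sum using (_⊎_)
open import Relation.Nullary using (¬_)
open import Data.Rational using (ℚ; 0ℚ; 1ℚ; _-_) renaming (_<_ to _<ℚ_; _≤_ to _≤ℚ_)
open import Data.Bool using (Bool; true; false; if_then_else_; T; _∧_; _∨_; not)
open import Data.Bool.ListAction using (any)
open import Data.Bool.Properties using (T?; T-∧; T-∨; ∨-comm)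
open import Data.Fin as Fin using (zero; suc; toℕ)
import Data.Fin.Properties as Fin
import Data.Integer as ℤ
import Data.Integer.Properties as ℤ
open import Data.Integer using (-[1+_]) renaming (+_ to int)
open import Data.List as List using (List; []; _∷_; length; concatMap; allFin; tabulate)
open import Data.List.Membership.Propositional using (_∈_; lose; find)
open import Data.List.Membership.Propositional.Properties using (∈-allFin; ∈-concatMap⁺; ∈-filter⁺)
import Data.List.Properties as List
open import Data.List.Relation.Unary.All as All using (All; []; _∷_)
import Data.List.Relation.Unary.All.Properties as All
open import Data.List.Relation.Unary.AllPairs as AllPairs using (AllPairs; []; _∷_)
import Data.List.Relation.Unary.AllPairs.Properties as AllPairs
open import Data.List.Relation.Unary.Any as Any using (Any; here; there)
import Data.List.Relation.Unary.Any.Properties as Any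
open import Data.List.Relation.Unary.Unique.Propositional using (Unique)
open import Data.List.Relation.Unary.Unique.Propositional.Properties using (allFin⁺; concat⁺)
open import Data.Maybe as Maybe using (Maybe; just; nothing; fromMaybe)
open import Data.Nat hiding (_/_)
open import Data.Nat.DivMod using (_/_; m≡m%n+[m/n]*n; m%n<n; m/n*n≤m; m≥n⇒m/n>0; m*n/n≡m; /-monoˡ-≤)
import Data.Nat.ListAction as ListAction
open import Data.Nat.Properties
open import Algebra.Properties.Semiring.Sum +-*-semiring using (sum; sum-cong-≗; ∑-distrib-+; ∑-comm; *-distribˡ-sum; *-distribʳ-sum)
open import Data.Nat.Tactic.RingSolver using (solve-∀)
open import Data.Product using (Σ; _,_; proj₁; proj₂)
import Data.Rational as ℚ
import Data.Rational.Properties as ℚ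
open import Data.Rational using (mkℚ)
open import Data.Rational.Solver using (module +-*-Solver)
import Data.Rational.Unnormalised as ℚᵘ
import Data.Rational.Unnormalised.Properties as ℚᵘ
open import Data.Rational.Unnormalised using (mkℚᵘ; *≡*; *≤*; *<*)
open import Data.Sum using (inj₁; inj₂; [_,_]′)
open import Data.Unit using (tt)
open import Data.Vec as Vec using (Vec; []; _∷_)
open import Function using (_∘_; id; Equivalence)
open import Relation.Binary using (tri<; tri≈; tri>)
open import Relation.Binary.Construct.Closure.ReflexiveTransitive as Star using (Star; ε; _◅_; _◅◅_)
open import Relation.Binary.PropositionalEquality
open import Relation.Nullary using (Dec; yes; no; does; contradiction)
open import Relation.Nullary.Decidable using (_×-dec_; _⊎-dec_; ¬?; dec-true; dec-false; map′; decidable-stable; toSum)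

-- Finite sums and indicators

-- The random graph is uniform on simple graphs, so there is no independence between edges to
-- exploit; every bad event is bounded by comparing moves out of it with moves into its image. `K`
-- is fixed before `c`. The gain of a move must therefore beat a quantity built from `Q`, `d` and
-- `k` alone, and whatever depends on `c` goes into `ρ` and `n₀`. Hub half-edges are switched along
-- edges from hubs to low vertices, because a low end leaves few switchings blocked. That such edges
-- abound is itself shown by switching hub-hub against low-low edges. The two rounds separate
-- discovery from joining: explored classes are defined by `open₁`, so an `open₂` edge between them
-- changes neither the explored set nor its classes, and the number of seeds bounds the joining
-- bridges. The constants for A₂ are not circular. The target size n/h depends on `c`, the number
-- n/B of seeds on `h`, the number `ℓ` of doublings on `B`; only then come the scale `c*` and the
-- component bound n/r. A doubling triples the component bound, and `r` absorbs the factor 3^ℓ.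

opaque
  ∑ : ∀ {n} → (Fin n → ℕ) → ℕ
  ∑ = sum

  ∑-mono : ∀ {n} {f g : Fin n → ℕ} → (∀ i → f i ≤ g i) → ∑ f ≤ ∑ g
  ∑-mono {zero} h = z≤n
  ∑-mono {suc n} h = +-mono-≤ (h zero) (∑-mono (h ∘ suc))

  ∑-cong : ∀ {n} {f g : Fin n → ℕ} → (∀ i → f i ≡ g i) → ∑ f ≡ ∑ g
  ∑-cong = sum-cong-≗

  ∑-+ : ∀ {n} (f g : Fin n → ℕ) → ∑ (λ i → f i + g i) ≡ ∑ f + ∑ g
  ∑-+ = ∑-distrib-+

  ∑-swap : ∀ {m n} (f : Fin m → Fin n → ℕ) → ∑ (λ i → ∑ (λ j → f i j)) ≡ ∑ (λ j → ∑ (λ i → f i j))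
  ∑-swap = ∑-comm

  ∑-*ˡ : ∀ {n} m (f : Fin n → ℕ) → ∑ (λ i → m * f i) ≡ m * ∑ f
  ∑-*ˡ m f = sym (*-distribˡ-sum m f)

  ∑-*ʳ : ∀ {n} m (f : Fin n → ℕ) → ∑ (λ i → f i * m) ≡ ∑ f * m
  ∑-*ʳ m f = sym (*-distribʳ-sum m f)

  ∑-const : ∀ n m → ∑ {n} (λ _ → m) ≡ n * m
  ∑-const zero m = refl
  ∑-const (suc n) m = cong (m +_) (∑-const n m)

  ∑-mono-*ˡ : ∀ {n} m {f g : Fin n → ℕ} → (∀ i → f i ≤ m * g i) → ∑ f ≤ m * ∑ g
  ∑-mono-*ˡ m {g = g} h = ≤-trans (∑-mono h) (≤-reflexive (∑-*ˡ m g))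

  ∑-mono-*ʳ : ∀ {n} m {f g : Fin n → ℕ} → (∀ i → f i ≤ g i * m) → ∑ f ≤ ∑ g * m
  ∑-mono-*ʳ m {g = g} h = ≤-trans (∑-mono h) (≤-reflexive (∑-*ʳ m g))

  ∑-mono-+ : ∀ {n} {f g h : Fin n → ℕ} → (∀ i → f i ≤ g i + h i) → ∑ f ≤ ∑ g + ∑ h
  ∑-mono-+ {g = g} {h} p = ≤-trans (∑-mono p) (≤-reflexive (∑-+ g h))

  ∑-lookup : ∀ {n} (f : Fin n → ℕ) i → f i ≤ ∑ f
  ∑-lookup f zero = m≤m+n _ _
  ∑-lookup f (suc i) = ≤-trans (∑-lookup (f ∘ suc) i) (m≤n+m _ _)

  ∑-zero : ∀ {n} (f : Fin n → ℕ) → (∀ i → f i ≡ 0) → ∑ f ≡ 0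
  ∑-zero {zero} f h = refl
  ∑-zero {suc n} f h = cong₂ _+_ (h zero) (∑-zero (f ∘ suc) (h ∘ suc))

  ∑-positive : ∀ {n} (f : Fin n → ℕ) → 1 ≤ ∑ f → ∃[ i ] 1 ≤ f i
  ∑-positive {suc n} f h with f zero in eq
  ... | suc m = zero , subst (1 ≤_) (sym eq) (s≤s z≤n)
  ... | zero with ∑-positive (f ∘ suc) h
  ... | i , p = suc i , p

  ∑-atMostOne : ∀ {n} (f : Fin n → ℕ) → (∀ i → f i ≤ 1) →
    (∀ i j → 1 ≤ f i → 1 ≤ f j → i ≡ j) → ∑ f ≤ 1
  ∑-atMostOne {zero} f b u = z≤n
  ∑-atMostOne {suc n} f b u with f zero in eq
  ... | zero = ∑-atMostOne (f ∘ suc) (b ∘ suc) (λ i j p q → Fin.suc-injective (u _ _ p q))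
  ... | suc m = subst (_≤ 1) (sym (trans (cong (suc m +_) (∑-zero (f ∘ suc) rest)) (+-identityʳ _)))
      (subst (_≤ 1) eq (b zero))
    where
    rest : ∀ i → f (suc i) ≡ 0
    rest i with f (suc i) in e
    ... | zero = refl
    ... | suc _ with () ← u zero (suc i) (subst (1 ≤_) (sym eq) (s≤s z≤n)) (subst (1 ≤_) (sym e) (s≤s z≤n))

opaque
  ι : ∀ {P : Set} → Dec P → ℕ
  ι d = if does d then 1 else 0

  ι≤1 : ∀ {P : Set} (d : Dec P) → ι d ≤ 1
  ι≤1 (yes _) = ≤-refl
  ι≤1 (no _) = z≤n

  ι-yes : ∀ {P : Set} (d : Dec P) → P → ι d ≡ 1
  ι-yes (yes _) p = refl
  ι-yes (no ¬p) p = contradiction p ¬p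

  ι-no : ∀ {P : Set} (d : Dec P) → ¬ P → ι d ≡ 0
  ι-no (yes p) ¬p = contradiction p ¬p
  ι-no (no _) ¬p = refl

  ι-elim : ∀ {P : Set} (d : Dec P) → 1 ≤ ι d → P
  ι-elim (yes p) _ = p

  ι-guard : ∀ {P : Set} (d : Dec P) {m n : ℕ} → (P → m ≤ n) → ι d * m ≤ n
  ι-guard (yes p) {m} h = subst (_≤ _) (sym (+-identityʳ m)) (h p)
  ι-guard (no _) h = z≤n

  ι-guard₁ : ∀ {P : Set} (d : Dec P) {n : ℕ} → (P → 1 ≤ n) → ι d ≤ n
  ι-guard₁ (yes p) h = h p
  ι-guard₁ (no _) h = z≤n

ι-mono : ∀ {P Q : Set} (d : Dec P) (e : Dec Q) → (P → Q) → ι d ≤ ι e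
ι-mono d e h = ι-guard₁ d (λ p → ≤-reflexive (sym (ι-yes e (h p))))

ι-cong : ∀ {P Q : Set} (d : Dec P) (e : Dec Q) → (P → Q) → (Q → P) → ι d ≡ ι e
ι-cong d e f g = ≤-antisym (ι-mono d e f) (ι-mono e d g)

opaque
  unfolding ι

  ι-× : ∀ {P Q : Set} (d : Dec P) (e : Dec Q) → ι (d ×-dec e) ≡ ι d * ι e
  ι-× (yes _) (yes _) = refl
  ι-× (yes _) (no _) = refl
  ι-× (no _) e = refl

  ι-⊎ : ∀ {P Q : Set} (d : Dec P) (e : Dec Q) → ι (d ⊎-dec e) ≤ ι d + ι e
  ι-⊎ (yes _) e = s≤s z≤n
  ι-⊎ (no _) (yes _) = ≤-refl
  ι-⊎ (no _) (no _) = z≤n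
  ι-disjoint : ∀ {P Q : Set} (d : Dec P) (e : Dec Q) → (P → ¬ Q) → ι d + ι e ≤ ι (d ⊎-dec e)
  ι-disjoint (yes p) (yes q) h = contradiction q (h p)
  ι-disjoint (yes p) (no _) h = ≤-refl
  ι-disjoint (no _) (yes _) h = ≤-refl
  ι-disjoint (no _) (no _) h = ≤-refl

-- Summed over all candidates, this yields the lower bounds on numbers of moves: each candidate is
-- an admissible move or meets one of a few obstructions, which are counted separately.
ι-cover : ∀ {P Q R : Set} (d : Dec P) (e : Dec Q) (f : Dec R) → (P → Q ⊎ R) → ι d ≤ ι e + ι f
ι-cover d e f h = ≤-trans (ι-mono d (e ⊎-dec f) h) (ι-⊎ e f)

ι-cover₃ : ∀ {P Q R S : Set} (d : Dec P) (e : Dec Q) (f : Dec R) (g : Dec S) → (P → Q ⊎ R ⊎ S) →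
  ι d ≤ ι e + (ι f + ι g)
ι-cover₃ d e f g h = ≤-trans (ι-cover d e (f ⊎-dec g) h) (+-monoʳ-≤ (ι e) (ι-⊎ f g))

ι-cover₄ : ∀ {P Q R S U : Set} (d : Dec P) (e : Dec Q) (f : Dec R) (g : Dec S) (h : Dec U) →
  (P → Q ⊎ R ⊎ S ⊎ U) → ι d ≤ ι e + (ι f + (ι g + ι h))
ι-cover₄ d e f g h p = ≤-trans (ι-cover d e (f ⊎-dec (g ⊎-dec h)) p)
  (+-monoʳ-≤ (ι e) (≤-trans (ι-⊎ f (g ⊎-dec h)) (+-monoʳ-≤ (ι f) (ι-⊎ g h))))

ι-×₃ : ∀ {P Q R : Set} (d : Dec P) (e : Dec Q) (f : Dec R) → ι (d ×-dec (e ×-dec f)) ≡ ι d * (ι e * ι f)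
ι-×₃ d e f = trans (ι-× d (e ×-dec f)) (cong (ι d *_) (ι-× e f))

ι-unique : ∀ {n} {P : Fin n → Set} (P? : ∀ i → Dec (P i)) →
  (∀ i j → P i → P j → i ≡ j) → ∑ (λ i → ι (P? i)) ≤ 1
ι-unique P? u = ∑-atMostOne _ (ι≤1 ∘ P?) (λ i j p q → u i j (ι-elim (P? i) p) (ι-elim (P? j) q))

ι-unique₂ : ∀ {m n} {P : Fin m → Fin n → Set} (P? : ∀ i j → Dec (P i j)) →
  (∀ i j i′ j′ → P i j → P i′ j′ → i ≡ i′ × j ≡ j′) → ∑ (λ i → ∑ (λ j → ι (P? i j))) ≤ 1
ι-unique₂ P? u = ∑-atMostOne _
  (λ i → ι-unique (P? i) (λ j j′ p q → proj₂ (u i j i j′ p q)))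
  λ i i′ p q → let (j , a) = ∑-positive _ p ; (j′ , b) = ∑-positive _ q
               in proj₁ (u i j i′ j′ (ι-elim (P? i j) a) (ι-elim (P? i′ j′) b))

1≤* : ∀ {x y} → 1 ≤ x → 1 ≤ y → 1 ≤ x * y
1≤* {x} p q = *-mono-≤ {1} {x} {1} p q

-- Inequalities are proved by exhibiting the difference of the two sides as a combination of
-- hypotheses, so that only a semiring identity remains.
by-slack : ∀ {l r a b} t → a ≤ b → l + t + b ≡ r + a → l ≤ r
by-slack {l} {r} {a} {b} t a≤b e = +-cancelʳ-≤ a l r (begin
  l + a      ≤⟨ +-monoʳ-≤ l a≤b ⟩
  l + b      ≤⟨ +-monoˡ-≤ b (m≤m+n l t) ⟩
  l + t + b  ≡⟨ e ⟩
  r + a      ∎)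
  where open ≤-Reasoning

-- Slots, states and switchings

opaque
  unfolding ∑

  ΣV≡∑ : ∀ n (f : Fin n → ℕ) → ΣV n f ≡ ∑ f
  ΣV≡∑ n f = trans (cong ListAction.sum (List.map-tabulate id f)) (go f)
    where
    go : ∀ {m} (g : Fin m → ℕ) → ListAction.sum (tabulate g) ≡ ∑ g
    go {zero} g = refl
    go {suc m} g = cong (g zero +_) (go (g ∘ suc))

does-true : ∀ {P : Set} (d : Dec P) → does d ≡ true → P
does-true (yes p) _ = p

Same : ∀ {n} → (a b i j : Fin n) → Set
Same a b i j = (a ≡ i × b ≡ j) ⊎ (a ≡ j × b ≡ i)

Same? : ∀ {n} (a b i j : Fin n) → Dec (Same a b i j)
Same? a b i j = ((a Fin.≟ i) ×-dec (b Fin.≟ j)) ⊎-dec ((a Fin.≟ j) ×-dec (b Fin.≟ i))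

Same-refl : ∀ {n} {a b : Fin n} → Same a b a b
Same-refl = inj₁ (refl , refl)

Same-swap : ∀ {n} {a b i j : Fin n} → Same a b i j → Same a b j i
Same-swap (inj₁ p) = inj₂ p
Same-swap (inj₂ p) = inj₁ p

Same-sym : ∀ {n} {a b i j : Fin n} → Same a b i j → Same i j a b
Same-sym (inj₁ (p , q)) = inj₁ (sym p , sym q)
Same-sym (inj₂ (p , q)) = inj₂ (sym q , sym p)

Same-trans : ∀ {n} {a b c d i j : Fin n} → Same a b c d → Same c d i j → Same a b i j
Same-trans (inj₁ (refl , refl)) q = q
Same-trans (inj₂ (refl , refl)) (inj₁ (p , q)) = inj₂ (q , p)
Same-trans (inj₂ (refl , refl)) (inj₂ (p , q)) = inj₁ (q , p)

Same-loop : ∀ {n} {a b i : Fin n} → Same a b i i → a ≡ b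
Same-loop (inj₁ (p , q)) = trans p (sym q)
Same-loop (inj₂ (p , q)) = trans p (sym q)

module _ {n : ℕ} where

  row : Fin n → List (Fin n) → List (Fin n × Fin n)
  row i = concatMap (λ j → if toℕ i <ᵇ toℕ j then (i , j) ∷ [] else [])

  row-∈ : ∀ i js → All (λ s → proj₁ s ≡ i × proj₂ s ∈ js × toℕ i < toℕ (proj₂ s)) (row i js)
  row-∈ i [] = []
  row-∈ i (j ∷ js) with toℕ i <ᵇ toℕ j in eq
  ... | true = (refl , here refl , <ᵇ⇒< _ _ (subst T (sym eq) tt)) ∷ All.map (λ (p , q , r) → p , there q , r) (row-∈ i js)
  ... | false = All.map (λ (p , q , r) → p , there q , r) (row-∈ i js)

  row-unique : ∀ i js → Unique js → Unique (row i js)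
  row-unique i [] u = []
  row-unique i (j ∷ js) (j∉ ∷ u) with toℕ i <ᵇ toℕ j
  ... | true = All.map (λ (p , q , r) e → All.lookup j∉ q (cong proj₂ e)) (row-∈ i js) ∷ row-unique i js u
  ... | false = row-unique i js u

  slots-increasing : All (λ s → toℕ (proj₁ s) < toℕ (proj₂ s)) (slots n)
  slots-increasing = All.concat⁺ (All.map⁺ (All.universal (λ i →
    All.map (λ { (refl , _ , r) → r }) (row-∈ i (allFin n))) (allFin n)))

  slots-unique : Unique (slots n)
  slots-unique = concat⁺
    (All.map⁺ (All.universal (λ i → row-unique i (allFin n) (allFin⁺ n)) (allFin n)))
    (AllPairs.map⁺ (AllPairs.map disjoint (allFin⁺ n)))
    where
    disjoint : ∀ {i j} → i ≢ j → ∀ {s} → ¬ (s ∈ row i (allFin n) × s ∈ row j (allFin n))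
    disjoint i≢j (p , q) = i≢j (trans (sym (proj₁ (All.lookup (row-∈ _ (allFin n)) p)))
                                            (proj₁ (All.lookup (row-∈ _ (allFin n)) q)))

  slot-∈ : ∀ {i j : Fin n} → toℕ i < toℕ j → (i , j) ∈ slots n
  slot-∈ {i} {j} i<j = ∈-concatMap⁺ (λ i → row i (allFin n)) (lose (∈-allFin i) (∈-concatMap⁺ _ (lose (∈-allFin j) singleton)))
    where
    singleton : (i , j) ∈ (if toℕ i <ᵇ toℕ j then (i , j) ∷ [] else [])
    singleton with toℕ i <ᵇ toℕ j in eq
    ... | true = here refl
    ... | false = contradiction (subst T eq (<⇒<ᵇ i<j)) (λ ())

  slots-complete : ∀ {i j : Fin n} → i ≢ j → Any (λ (x , y) → Same x y i j) (slots n)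
  slots-complete {i} {j} i≢j with <-cmp (toℕ i) (toℕ j)
  ... | tri< i<j _ _ = lose (slot-∈ i<j) Same-refl
  ... | tri≈ _ i≡j _ = contradiction (Fin.toℕ-injective i≡j) i≢j
  ... | tri> _ _ j<i = lose (slot-∈ j<i) (Same-swap Same-refl)

  -- Slots are increasing pairs without repetition, so an unordered pair matches at most one of
  -- them. Hence the disjunction in `adj` reads a single status.
  slots-disjoint : ∀ (i j : Fin n) → AllPairs (λ (x , y) (x′ , y′) → Same x y i j → ¬ Same x′ y′ i j) (slots n)
  slots-disjoint i j = go (slots n) slots-increasing slots-unique
    where
    clash : ∀ {x y x′ y′ : Fin n} → toℕ x < toℕ y → toℕ x′ < toℕ y′ → (x , y) ≢ (x′ , y′) →
      Same x y i j → ¬ Same x′ y′ i j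
    clash p q ne (inj₁ (refl , refl)) (inj₁ (refl , refl)) = ne refl
    clash p q ne (inj₁ (refl , refl)) (inj₂ (refl , refl)) = <-asym p q
    clash p q ne (inj₂ (refl , refl)) (inj₁ (refl , refl)) = <-asym p q
    clash p q ne (inj₂ (refl , refl)) (inj₂ (refl , refl)) = ne refl
    go : ∀ l → All (λ s → toℕ (proj₁ s) < toℕ (proj₂ s)) l → Unique l →
      AllPairs (λ (x , y) (x′ , y′) → Same x y i j → ¬ Same x′ y′ i j) l
    go [] [] [] = []
    go (s ∷ l) (p ∷ ps) (u ∷ us) = All.zipWith (λ (q , ne) → clash p q ne) (ps , u) ∷ go l ps us

-- A state records a graph together with its percolation, the open edges being split into two rounds.
data St : Set where
  none closed open₁ open₂ : St

_≟ˢ_ : (s t : St) → Dec (s ≡ t)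
none ≟ˢ none = yes refl
none ≟ˢ closed = no λ ()
none ≟ˢ open₁ = no λ ()
none ≟ˢ open₂ = no λ ()
closed ≟ˢ none = no λ ()
closed ≟ˢ closed = yes refl
closed ≟ˢ open₁ = no λ ()
closed ≟ˢ open₂ = no λ ()
open₁ ≟ˢ none = no λ ()
open₁ ≟ˢ closed = no λ ()
open₁ ≟ˢ open₁ = yes refl
open₁ ≟ˢ open₂ = no λ ()
open₂ ≟ˢ none = no λ ()
open₂ ≟ˢ closed = no λ ()
open₂ ≟ˢ open₁ = no λ ()
open₂ ≟ˢ open₂ = yes refl

isEdge isOpen : St → Bool
isEdge none = false
isEdge _ = true
isOpen open₁ = true
isOpen open₂ = true
isOpen _ = false

module _ {n : ℕ} where

  -- The default `none` is the status of a loop, which matches no slot.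
  statusIn : (l : List (Fin n × Fin n)) → Vec St (length l) → Fin n → Fin n → St
  statusIn [] [] i j = none
  statusIn ((x , y) ∷ l) (s ∷ v) i j = if does (Same? x y i j) then s else statusIn l v i j

  updateIn : (l : List (Fin n × Fin n)) → Vec St (length l) → Fin n → Fin n → St → Vec St (length l)
  updateIn [] [] i j t = []
  updateIn ((x , y) ∷ l) (s ∷ v) i j t = if does (Same? x y i j) then t ∷ v else s ∷ updateIn l v i j t

  any-absent : ∀ (f : (Fin n × Fin n) × Bool → Bool) κ i j →
    (∀ x y e → f ((x , y) , e) ≡ e ∧ does (Same? x y i j)) →
    ∀ l (v : Vec St (length l)) → All (λ (x , y) → ¬ Same x y i j) l →
    any f (edgesWith l (Vec.map κ v)) ≡ false
  any-absent f κ i j hf [] [] [] = refl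
  any-absent f κ i j hf ((x , y) ∷ l) (s ∷ v) (p ∷ ps)
    rewrite hf x y (κ s) | dec-false (Same? x y i j) p with κ s
  ... | true = any-absent f κ i j hf l v ps
  ... | false = any-absent f κ i j hf l v ps

  -- `f` stands for the anonymous function inside `adj`, known here only by its values. With `κ`
  -- general, one proof reads from a state both the graph (`isEdge`) and its percolation (`isOpen`).
  any-status : ∀ (f : (Fin n × Fin n) × Bool → Bool) κ i j →
    (∀ x y e → f ((x , y) , e) ≡ e ∧ does (Same? x y i j)) → κ none ≡ false →
    ∀ l (v : Vec St (length l)) → AllPairs (λ (x , y) (x′ , y′) → Same x y i j → ¬ Same x′ y′ i j) l →
    any f (edgesWith l (Vec.map κ v)) ≡ κ (statusIn l v i j)
  any-status f κ i j hf κ0 [] [] [] = sym κ0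
  any-status f κ i j hf κ0 ((x , y) ∷ l) (s ∷ v) (p ∷ ps) rewrite hf x y (κ s) with does (Same? x y i j) in eq
  ... | false with κ s
  ...   | true = any-status f κ i j hf κ0 l v ps
  ...   | false = any-status f κ i j hf κ0 l v ps
  any-status f κ i j hf κ0 ((x , y) ∷ l) (s ∷ v) (p ∷ ps) | true
    rewrite any-absent f κ i j hf l v (All.map (λ g → g (does-true (Same? x y i j) eq)) p) with κ s
  ... | true = refl
  ... | false = refl

  statusIn-irrefl : ∀ l (v : Vec St (length l)) i → All (λ s → toℕ (proj₁ s) < toℕ (proj₂ s)) l →
    statusIn l v i i ≡ none
  statusIn-irrefl [] [] i [] = refl
  statusIn-irrefl ((x , y) ∷ l) (s ∷ v) i (p ∷ ps) with does (Same? x y i i) in eq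
  ... | true = contradiction (cong toℕ (Same-loop (does-true (Same? x y i i) eq))) (<⇒≢ p)
  ... | false = statusIn-irrefl l v i ps

  statusIn-sym : ∀ l (v : Vec St (length l)) i j → statusIn l v i j ≡ statusIn l v j i
  statusIn-sym [] [] i j = refl
  statusIn-sym ((x , y) ∷ l) (s ∷ v) i j = cong₂ (λ b t → if b then s else t)
    (∨-comm (does (x Fin.≟ i) ∧ does (y Fin.≟ j)) _) (statusIn-sym l v i j)

  statusIn-update : ∀ l (v : Vec St (length l)) a b t → Any (λ (x , y) → Same x y a b) l →
    statusIn l (updateIn l v a b t) a b ≡ t
  statusIn-update ((x , y) ∷ l) (s ∷ v) a b t p with does (Same? x y a b) in eq
  ... | true rewrite eq = refl
  statusIn-update ((x , y) ∷ l) (s ∷ v) a b t (here same) | false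
    with () ← trans (sym eq) (dec-true (Same? x y a b) same)
  statusIn-update ((x , y) ∷ l) (s ∷ v) a b t (there p) | false
    rewrite eq = statusIn-update l v a b t p

  statusIn-other : ∀ l (v : Vec St (length l)) a b t i j → ¬ Same a b i j →
    statusIn l (updateIn l v a b t) i j ≡ statusIn l v i j
  statusIn-other [] [] a b t i j ne = refl
  statusIn-other ((x , y) ∷ l) (s ∷ v) a b t i j ne with does (Same? x y a b) in eq
  ... | true rewrite dec-false (Same? x y i j)
      (λ same → ne (Same-trans (Same-sym (does-true (Same? x y a b) eq)) same)) = refl
  ... | false with does (Same? x y i j)
  ...   | true = refl
  ...   | false = statusIn-other l v a b t i j ne

module States (n : ℕ) where

  State : Set
  State = Vec St (nSlots n)

  opaque
    st : State → Fin n → Fin n → St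
    st = statusIn (slots n)

    update : State → Fin n → Fin n → St → State
    update = updateIn (slots n)

    adj-status : ∀ κ → κ none ≡ false → ∀ (ω : State) i j → adj {n} (Vec.map κ ω) i j ≡ κ (st ω i j)
    adj-status κ κ0 ω i j = any-status _ κ i j (λ x y e → refl) κ0 (slots n) ω (slots-disjoint i j)

    st-irrefl : ∀ ω i → st ω i i ≡ none
    st-irrefl ω i = statusIn-irrefl (slots n) ω i slots-increasing

    st-sym : ∀ ω i j → st ω i j ≡ st ω j i
    st-sym = statusIn-sym (slots n)

    st-Same : ∀ ω {a b i j} → Same a b i j → st ω i j ≡ st ω a b
    st-Same ω (inj₁ (refl , refl)) = refl
    st-Same ω (inj₂ (refl , refl)) = st-sym ω _ _

    st-update : ∀ ω {a b} t {i j} → a ≢ b → Same a b i j → st (update ω a b t) i j ≡ t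
    st-update ω {a} {b} t a≢b same = trans (st-Same (update ω a b t) same)
      (statusIn-update (slots n) ω a b t (slots-complete a≢b))

    st-other : ∀ ω {a b} t {i j} → ¬ Same a b i j → st (update ω a b t) i j ≡ st ω i j
    st-other ω t ne = statusIn-other (slots n) ω _ _ t _ _ ne

module Graphs (n : ℕ) where
  open States n public

  E : State → Fin n → Fin n → Set
  E ω i j = T (isEdge (st ω i j))

  E? : ∀ ω i j → Dec (E ω i j)
  E? ω i j = T? (isEdge (st ω i j))

  O : State → Fin n → Fin n → Set
  O ω i j = T (isOpen (st ω i j))

  O? : ∀ ω i j → Dec (O ω i j)
  O? ω i j = T? (isOpen (st ω i j))

  E-sym : ∀ ω {i j} → E ω i j → E ω j i
  E-sym ω {i} {j} = subst (T ∘ isEdge) (st-sym ω i j)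

  O-sym : ∀ ω {i j} → O ω i j → O ω j i
  O-sym ω {i} {j} = subst (T ∘ isOpen) (st-sym ω i j)

  E-irrefl : ∀ ω {i j} → E ω i j → i ≢ j
  E-irrefl ω {i} e refl = subst (T ∘ isEdge) (st-irrefl ω i) e

  O⇒E : ∀ ω {i j} → O ω i j → E ω i j
  O⇒E ω {i} {j} o with st ω i j
  ... | open₁ = tt
  ... | open₂ = tt

  st≡⇒E : ∀ ω {i j s} → st ω i j ≡ s → T (isEdge s) → E ω i j
  st≡⇒E ω eq = subst (T ∘ isEdge) (sym eq)

  st≡⇒O : ∀ ω {i j s} → st ω i j ≡ s → T (isOpen s) → O ω i j
  st≡⇒O ω eq = subst (T ∘ isOpen) (sym eq)

  degree : State → Fin n → ℕ
  degree ω i = ∑ (λ j → ι (E? ω i j))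

  -- The old status is credited on the left and the new one on the right, so that insertion and
  -- deletion are one identity without truncated subtraction.
  degree-update : ∀ ω {a b} t → a ≢ b → ∀ i →
    degree (update ω a b t) i + (ι (a Fin.≟ i) + ι (b Fin.≟ i)) * ι (E? ω a b) ≡
    degree ω i + (ι (a Fin.≟ i) + ι (b Fin.≟ i)) * ι (T? (isEdge t))
  degree-update ω {a} {b} t a≢b i = begin
    degree ω′ i + δ * ι (E? ω a b)                                 ≡⟨ cong (λ x → degree ω′ i + x * ι (E? ω a b)) δ≡ ⟩
    degree ω′ i + ∑ s * ι (E? ω a b)                               ≡⟨ cong (degree ω′ i +_) (∑-*ʳ (ι (E? ω a b)) s) ⟨
    degree ω′ i + ∑ (λ j → s j * ι (E? ω a b))                     ≡⟨ ∑-+ (λ j → ι (E? ω′ i j)) _ ⟨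
    ∑ (λ j → ι (E? ω′ i j) + s j * ι (E? ω a b))                   ≡⟨ ∑-cong pointwise ⟩
    ∑ (λ j → ι (E? ω i j) + s j * ι (T? (isEdge t)))               ≡⟨ ∑-+ (λ j → ι (E? ω i j)) _ ⟩
    degree ω i + ∑ (λ j → s j * ι (T? (isEdge t)))                 ≡⟨ cong (degree ω i +_) (∑-*ʳ (ι (T? (isEdge t))) s) ⟩
    degree ω i + ∑ s * ι (T? (isEdge t))                           ≡⟨ cong (λ x → degree ω i + x * ι (T? (isEdge t))) δ≡ ⟨
    degree ω i + δ * ι (T? (isEdge t))                             ∎
    where
    open ≡-Reasoning
    ω′ = update ω a b t
    δ = ι (a Fin.≟ i) + ι (b Fin.≟ i)
    s : Fin n → ℕ
    s j = ι (Same? a b i j)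
    pointwise : ∀ j → ι (E? ω′ i j) + s j * ι (E? ω a b) ≡ ι (E? ω i j) + s j * ι (T? (isEdge t))
    pointwise j with Same? a b i j
    ... | yes same rewrite ι-yes (yes same) same | st-update ω t a≢b same | st-Same ω same =
      cross (ι (T? (isEdge t))) (ι (E? ω a b))
      where
      cross : ∀ x y → x + 1 * y ≡ y + 1 * x
      cross = solve-∀
    ... | no ¬same rewrite ι-no (no ¬same) ¬same = cong (λ x → ι (T? (isEdge x)) + 0) (st-other ω t ¬same)
    count : ∀ (c : Fin n) → ∑ (λ j → ι (c Fin.≟ j)) ≡ 1
    count c = ≤-antisym (ι-unique (c Fin.≟_) (λ i j p q → trans (sym p) q))
      (≤-trans (≤-reflexive (sym (ι-yes (c Fin.≟ c) refl))) (∑-lookup (λ j → ι (c Fin.≟ j)) c))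
    split : ∀ j → s j ≡ ι (a Fin.≟ i) * ι (b Fin.≟ j) + ι (b Fin.≟ i) * ι (a Fin.≟ j)
    split j = trans (≤-antisym (ι-⊎ _ _) (ι-disjoint _ _ λ { (refl , refl) (p , _) → a≢b p })) (cong₂ _+_ (ι-× _ _) (trans (ι-× _ _) (*-comm (ι (a Fin.≟ j)) _)))
    δ≡ : δ ≡ ∑ s
    δ≡ = sym (begin
      ∑ s                                                        ≡⟨ ∑-cong split ⟩
      ∑ (λ j → ι (a Fin.≟ i) * ι (b Fin.≟ j) + ι (b Fin.≟ i) * ι (a Fin.≟ j))
        ≡⟨ ∑-+ (λ j → ι (a Fin.≟ i) * ι (b Fin.≟ j)) _ ⟩
      ∑ (λ j → ι (a Fin.≟ i) * ι (b Fin.≟ j)) + ∑ (λ j → ι (b Fin.≟ i) * ι (a Fin.≟ j))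
        ≡⟨ cong₂ _+_ (trans (∑-*ˡ (ι (a Fin.≟ i)) _) (trans (cong (ι (a Fin.≟ i) *_) (count b)) (*-identityʳ (ι (a Fin.≟ i)))))
                     (trans (∑-*ˡ (ι (b Fin.≟ i)) _) (trans (cong (ι (b Fin.≟ i) *_) (count a)) (*-identityʳ (ι (b Fin.≟ i))))) ⟩
      δ ∎)

  Valid : (Fin n → ℕ) → State → Set
  Valid D ω = ∀ i → degree ω i ≡ D i

  Valid? : ∀ D ω → Dec (Valid D ω)
  Valid? D ω = Fin.all? (λ i → degree ω i ≟ D i)

  Valid-update : ∀ {D} ω {a b} t → E ω a b → T (isEdge t) → Valid D ω → Valid D (update ω a b t)
  Valid-update ω {a} {b} t e et v i with degree-update ω {a} {b} t (E-irrefl ω e) i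
  ... | eq rewrite ι-yes (E? ω a b) e | ι-yes (T? (isEdge t)) et = trans (+-cancelʳ-≡ _ _ _ eq) (v i)

  -- The edge `bd` is always created closed. So `ac` is the only edge that a switching can open,
  -- which is what makes it a bridge when its ends were not connected before.
  switch : State → Fin n → Fin n → Fin n → Fin n → St → State
  switch ω a b c d t = update (update (update (update ω a b none) c d none) a c t) b d closed

  -- The other coincidences exclude themselves: `a ≡ d` would make `ac` the edge `cd`, and `b ≡ c`
  -- would make it the edge `ab`. Hence the four slots touched are distinct.
  record Switchable (ω : State) (a b c d : Fin n) : Set where
    field
      ab : E ω a b
      cd : E ω c d
      ¬ac : ¬ E ω a c
      ¬bd : ¬ E ω b d
      a≢c : a ≢ c
      b≢d : b ≢ d

  module Switch {ω : State} {a b c d : Fin n} (sw : Switchable ω a b c d) where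
    open Switchable sw

    E-Same : ∀ {i j k l} → E ω i j → Same i j k l → E ω k l
    E-Same e (inj₁ (refl , refl)) = e
    E-Same e (inj₂ (refl , refl)) = E-sym ω e

    a≢b = E-irrefl ω ab
    c≢d = E-irrefl ω cd

    ab≠cd : ¬ Same a b c d
    ab≠cd (inj₁ (p , _)) = a≢c p
    ab≠cd (inj₂ (refl , refl)) = ¬ac ab

    ab≠ac : ¬ Same a b a c
    ab≠ac s = ¬ac (E-Same ab s)

    ab≠bd : ¬ Same a b b d
    ab≠bd s = ¬bd (E-Same ab s)

    cd≠ac : ¬ Same c d a c
    cd≠ac s = ¬ac (E-Same cd s)

    cd≠bd : ¬ Same c d b d
    cd≠bd s = ¬bd (E-Same cd s)

    ac≠bd : ¬ Same a c b d
    ac≠bd (inj₁ (p , _)) = a≢b p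
    ac≠bd (inj₂ (refl , refl)) = ¬ac (E-sym ω cd)

    module _ (t : St) where
      ω₁ = update ω a b none
      ω₂ = update ω₁ c d none
      ω₃ = update ω₂ a c t
      ω₄ = switch ω a b c d t

      st-bd : ∀ {i j} → Same b d i j → st ω₄ i j ≡ closed
      st-bd = st-update ω₃ closed b≢d

      st-ac : ∀ {i j} → Same a c i j → st ω₄ i j ≡ t
      st-ac s = trans (st-other ω₃ closed (λ s′ → ac≠bd (Same-trans s (Same-sym s′)))) (st-update ω₂ t a≢c s)

      st-cd : ∀ {i j} → Same c d i j → st ω₄ i j ≡ none
      st-cd s = trans (st-other ω₃ closed (λ s′ → cd≠bd (Same-trans s (Same-sym s′))))
        (trans (st-other ω₂ t (λ s′ → cd≠ac (Same-trans s (Same-sym s′)))) (st-update ω₁ none c≢d s))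

      st-ab : ∀ {i j} → Same a b i j → st ω₄ i j ≡ none
      st-ab s = trans (st-other ω₃ closed (λ s′ → ab≠bd (Same-trans s (Same-sym s′))))
        (trans (st-other ω₂ t (λ s′ → ab≠ac (Same-trans s (Same-sym s′))))
        (trans (st-other ω₁ none (λ s′ → ab≠cd (Same-trans s (Same-sym s′)))) (st-update ω none a≢b s)))

      st-rest : ∀ {i j} → ¬ Same a b i j → ¬ Same c d i j → ¬ Same a c i j → ¬ Same b d i j →
        st ω₄ i j ≡ st ω i j
      st-rest p q r s = trans (st-other ω₃ closed s) (trans (st-other ω₂ t r)
        (trans (st-other ω₁ none q) (st-other ω none p)))

      st-cases : ∀ i j → (Same a c i j × st ω₄ i j ≡ t) ⊎ (Same b d i j × st ω₄ i j ≡ closed) ⊎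
        ((Same a b i j ⊎ Same c d i j) × st ω₄ i j ≡ none) ⊎ (st ω₄ i j ≡ st ω i j)
      st-cases i j with Same? a b i j
      ... | yes s = inj₂ (inj₂ (inj₁ (inj₁ s , st-ab s)))
      ... | no p with Same? c d i j
      ...   | yes s = inj₂ (inj₂ (inj₁ (inj₂ s , st-cd s)))
      ...   | no q with Same? a c i j
      ...     | yes s = inj₁ (s , st-ac s)
      ...     | no r with Same? b d i j
      ...       | yes s = inj₂ (inj₁ (s , st-bd s))
      ...       | no s = inj₂ (inj₂ (inj₂ (st-rest p q r s)))

      -- Each of the four vertices loses one edge and gains one; the four instances of
      -- `degree-update` are added up.
      valid : ∀ {D} → T (isEdge t) → Valid D ω → Valid D ω₄
      valid {D} et v i = trans (combine (degree-update ω none a≢b i) (degree-update ω₁ none c≢d i)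
                                 (degree-update ω₂ t a≢c i) (degree-update ω₃ closed b≢d i)) (v i)
        where
        δ : Fin n → ℕ
        δ x = ι (x Fin.≟ i)
        E₁ : ι (E? ω₁ c d) ≡ 1
        E₁ = ι-yes (E? ω₁ c d) (subst (T ∘ isEdge) (sym (st-other ω none ab≠cd)) cd)
        E₂ : ι (E? ω₂ a c) ≡ 0
        E₂ = ι-no (E? ω₂ a c) (¬ac ∘ subst (T ∘ isEdge) (trans (st-other ω₁ none cd≠ac) (st-other ω none ab≠ac)))
        E₃ : ι (E? ω₃ b d) ≡ 0
        E₃ = ι-no (E? ω₃ b d) (¬bd ∘ subst (T ∘ isEdge)
          (trans (st-other ω₂ t ac≠bd) (trans (st-other ω₁ none cd≠bd) (st-other ω none ab≠bd))))
        combine :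
          degree ω₁ i + (δ a + δ b) * ι (E? ω a b) ≡ degree ω i + (δ a + δ b) * ι (T? false) →
          degree ω₂ i + (δ c + δ d) * ι (E? ω₁ c d) ≡ degree ω₁ i + (δ c + δ d) * ι (T? false) →
          degree ω₃ i + (δ a + δ c) * ι (E? ω₂ a c) ≡ degree ω₂ i + (δ a + δ c) * ι (T? (isEdge t)) →
          degree ω₄ i + (δ b + δ d) * ι (E? ω₃ b d) ≡ degree ω₃ i + (δ b + δ d) * ι (T? true) →
          degree ω₄ i ≡ degree ω i
        combine p q r s rewrite ι-no (T? false) id | ι-yes (T? true) tt | ι-yes (E? ω a b) ab | E₁ | E₂ | E₃ | ι-yes (T? (isEdge t)) et =
          +-cancelʳ-≡ (δ a + δ b + (δ c + δ d)) _ _ (begin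
            degree ω₄ i + (δ a + δ b + (δ c + δ d))
              ≡⟨ cong (_+ (δ a + δ b + (δ c + δ d))) (trans (sym (elim₀ (degree ω₄ i) (δ b + δ d))) s) ⟩
            degree ω₃ i + (δ b + δ d) * 1 + (δ a + δ b + (δ c + δ d))
              ≡⟨ cong (λ x → x + (δ b + δ d) * 1 + (δ a + δ b + (δ c + δ d))) (trans (sym (elim₀ (degree ω₃ i) (δ a + δ c))) r) ⟩
            degree ω₂ i + (δ a + δ c) * 1 + (δ b + δ d) * 1 + (δ a + δ b + (δ c + δ d))
              ≡⟨ shuffle (degree ω₂ i) (δ a) (δ b) (δ c) (δ d) ⟩
            (degree ω₂ i + (δ c + δ d) * 1) + (δ a + δ b) * 1 + (δ a + δ b + (δ c + δ d))
              ≡⟨ cong (λ x → x + (δ a + δ b) * 1 + (δ a + δ b + (δ c + δ d))) (trans q (elim₀ (degree ω₁ i) (δ c + δ d))) ⟩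
            (degree ω₁ i + (δ a + δ b) * 1) + (δ a + δ b + (δ c + δ d))
              ≡⟨ cong (_+ (δ a + δ b + (δ c + δ d))) (trans p (elim₀ (degree ω i) (δ a + δ b))) ⟩
            degree ω i + (δ a + δ b + (δ c + δ d)) ∎)
          where
          open ≡-Reasoning
          elim₀ : ∀ x y → x + y * 0 ≡ x
          elim₀ = solve-∀
          shuffle : ∀ x a b c d → x + (a + c) * 1 + (b + d) * 1 + (a + b + (c + d)) ≡
            (x + (c + d) * 1) + (a + b) * 1 + (a + b + (c + d))
          shuffle = solve-∀

-- Weighted counting of states

module Integral (w : St → ℕ) (w≥1 : ∀ s → 1 ≤ w s) where

  Q : ℕ
  Q = w none + w closed + (w open₁ + w open₂)

  Q≥1 : 1 ≤ Q
  Q≥1 = ≤-trans (w≥1 none) (≤-trans (m≤m+n (w none) (w closed)) (m≤m+n _ _))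

  -- Unnormalised: nothing is divided by `Q`, which keeps all counts in the naturals.
  average : (St → ℕ) → ℕ
  average f = w none * f none + w closed * f closed + (w open₁ * f open₁ + w open₂ * f open₂)

  average-≥ : ∀ s (f : St → ℕ) → w s * f s ≤ average f
  average-≥ none f = ≤-trans (m≤m+n (w none * f none) (w closed * f closed)) (m≤m+n _ _)
  average-≥ closed f = ≤-trans (m≤n+m (w closed * f closed) (w none * f none)) (m≤m+n _ _)
  average-≥ open₁ f = ≤-trans (m≤m+n (w open₁ * f open₁) (w open₂ * f open₂)) (m≤n+m _ (w none * f none + w closed * f closed))
  average-≥ open₂ f = ≤-trans (m≤n+m (w open₂ * f open₂) (w open₁ * f open₁)) (m≤n+m _ (w none * f none + w closed * f closed))

  average-mono : ∀ {f g : St → ℕ} → (∀ s → f s ≤ g s) → average f ≤ average g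
  average-mono h = +-mono-≤
    (+-mono-≤ (*-monoʳ-≤ (w none) (h none)) (*-monoʳ-≤ (w closed) (h closed)))
    (+-mono-≤ (*-monoʳ-≤ (w open₁) (h open₁)) (*-monoʳ-≤ (w open₂) (h open₂)))

  opaque
    ∫ : ∀ {N} → (Vec St N → ℕ) → ℕ
    ∫ {zero} F = F []
    ∫ {suc N} F = ∫ {N} (λ v → average (λ s → F (s ∷ v)))

    ∫-mono : ∀ {N} {F G : Vec St N → ℕ} → (∀ v → F v ≤ G v) → ∫ F ≤ ∫ G
    ∫-mono {zero} h = h []
    ∫-mono {suc N} {F} {G} h = ∫-mono {N} (λ v → average-mono {λ s → F (s ∷ v)} {λ s → G (s ∷ v)} (λ s → h (s ∷ v)))

  ∫-cong : ∀ {N} {F G : Vec St N → ℕ} → (∀ v → F v ≡ G v) → ∫ F ≡ ∫ G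
  ∫-cong h = ≤-antisym (∫-mono (λ v → ≤-reflexive (h v))) (∫-mono (λ v → ≤-reflexive (sym (h v))))

  opaque
    unfolding ∫

    ∫-* : ∀ {N} m (F : Vec St N → ℕ) → ∫ (λ v → m * F v) ≡ m * ∫ F
    ∫-* {zero} m F = refl
    ∫-* {suc N} m F = trans (∫-cong {N} (λ v → distrib m (w none) (w closed) (w open₁) (w open₂) (F (none ∷ v)) (F (closed ∷ v)) (F (open₁ ∷ v)) (F (open₂ ∷ v))))
      (∫-* {N} m (λ v → average (λ s → F (s ∷ v))))
      where
      distrib : ∀ m a b c d x y z t → a * (m * x) + b * (m * y) + (c * (m * z) + d * (m * t)) ≡ m * (a * x + b * y + (c * z + d * t))
      distrib = solve-∀

    ∫-+ : ∀ {N} (F G : Vec St N → ℕ) → ∫ (λ v → F v + G v) ≡ ∫ F + ∫ G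
    ∫-+ {zero} F G = refl
    ∫-+ {suc N} F G = trans (∫-cong {N} (λ v → distrib (w none) (w closed) (w open₁) (w open₂)
        (F (none ∷ v)) (F (closed ∷ v)) (F (open₁ ∷ v)) (F (open₂ ∷ v)) (G (none ∷ v)) (G (closed ∷ v)) (G (open₁ ∷ v)) (G (open₂ ∷ v))))
      (∫-+ {N} (λ v → average (λ s → F (s ∷ v))) (λ v → average (λ s → G (s ∷ v))))
      where
      distrib : ∀ a b c d x y z t x′ y′ z′ t′ → a * (x + x′) + b * (y + y′) + (c * (z + z′) + d * (t + t′)) ≡
        (a * x + b * y + (c * z + d * t)) + (a * x′ + b * y′ + (c * z′ + d * t′))
      distrib = solve-∀

  ∫-0 : ∀ {N} → ∫ {N} (λ _ → 0) ≡ 0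
  ∫-0 {N} = ∫-* {N} 0 (λ _ → 0)

  opaque
    unfolding ∑

    ∫-∑ : ∀ {N m} (F : Fin m → Vec St N → ℕ) → ∫ (λ v → ∑ (λ i → F i v)) ≡ ∑ (λ i → ∫ (F i))
    ∫-∑ {N} {zero} F = ∫-0 {N}
    ∫-∑ {N} {suc m} F = trans (∫-+ {N} (F zero) (λ v → ∑ (λ i → F (suc i) v))) (cong (∫ (F zero) +_) (∫-∑ (F ∘ suc)))

  ∫-∑-≤ : ∀ {N m} C {F G : Fin m → Vec St N → ℕ} → (∀ i → ∫ (F i) ≤ C * ∫ (G i)) →
    ∫ (λ v → ∑ (λ i → F i v)) ≤ C * ∫ (λ v → ∑ (λ i → G i v))
  ∫-∑-≤ C {F} {G} h = subst₂ (λ x y → x ≤ C * y) (sym (∫-∑ F)) (sym (∫-∑ G)) (∑-mono-*ˡ C h)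

  opaque
    unfolding ∫

    -- At the slot that is reset, the integrand no longer depends on the status, so averaging
    -- multiplies it by `Q`; and the value at `t` enters the average on the right with weight at
    -- least one. A pair without a slot is left alone, where `Q≥1` suffices.
    ∫-updateIn : ∀ {n} (l : List (Fin n × Fin n)) (Φ : Vec St (length l) → ℕ) a b t →
      ∫ (λ v → Φ (updateIn l v a b t)) ≤ Q * ∫ Φ
    ∫-updateIn [] Φ a b t = ≤-trans (≤-reflexive (sym (+-identityʳ _))) (*-monoˡ-≤ (Φ []) Q≥1)
    ∫-updateIn ((x , y) ∷ l) Φ a b t with does (Same? x y a b)
    ... | true = ≤-trans (∫-mono {length l} (λ v → ≤-trans (≤-reflexive (factor (w none) (w closed) (w open₁) (w open₂) (Φ (t ∷ v))))
            (*-monoʳ-≤ Q (≤-trans (≤-trans (≤-reflexive (sym (+-identityʳ (Φ (t ∷ v))))) (*-monoˡ-≤ (Φ (t ∷ v)) (w≥1 t)))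
              (average-≥ t (λ s → Φ (s ∷ v))))))) (≤-reflexive (∫-* {length l} Q (λ v → average (λ s → Φ (s ∷ v)))))
      where
      factor : ∀ a b c d x → a * x + b * x + (c * x + d * x) ≡ (a + b + (c + d)) * x
      factor = solve-∀
    ... | false = ∫-updateIn l (λ v → average (λ s → Φ (s ∷ v))) a b t

module Moves (n : ℕ) (w : St → ℕ) (w≥1 : ∀ s → 1 ≤ w s) where
  open Graphs n public
  open Integral w w≥1 public

  opaque
    unfolding update

    -- A move is undone at bounded cost, whatever the old status was, because the weights are positive.
    ∫-update : ∀ (Φ : State → ℕ) a b t → ∫ (λ ω → Φ (update ω a b t)) ≤ Q * ∫ Φ
    ∫-update = ∫-updateIn (slots n)

  ∫-switch : ∀ (Φ : State → ℕ) a b c d t → ∫ (λ ω → Φ (switch ω a b c d t)) ≤ Q ^ 4 * ∫ Φ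
  ∫-switch Φ a b c d t = begin
    ∫ (λ ω → Φ (switch ω a b c d t))                            ≤⟨ ∫-update (λ ω → Φ (update (update (update ω c d none) a c t) b d closed)) a b none ⟩
    Q * ∫ (λ ω → Φ (update (update (update ω c d none) a c t) b d closed))  ≤⟨ *-monoʳ-≤ Q (∫-update (λ ω → Φ (update (update ω a c t) b d closed)) c d none) ⟩
    Q * (Q * ∫ (λ ω → Φ (update (update ω a c t) b d closed)))  ≤⟨ *-monoʳ-≤ Q (*-monoʳ-≤ Q (∫-update (λ ω → Φ (update ω b d closed)) a c t)) ⟩
    Q * (Q * (Q * ∫ (λ ω → Φ (update ω b d closed))))           ≤⟨ *-monoʳ-≤ Q (*-monoʳ-≤ Q (*-monoʳ-≤ Q (∫-update Φ b d closed))) ⟩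
    Q * (Q * (Q * (Q * ∫ Φ)))                                   ≡⟨ assoc⁴ Q (∫ Φ) ⟩
    Q ^ 4 * ∫ Φ                                                 ∎
    where
    open ≤-Reasoning
    assoc⁴ : ∀ q x → q * (q * (q * (q * x))) ≡ q * (q * (q * (q * 1))) * x
    assoc⁴ = solve-∀

-- Connectivity and bridges

∑-strict : ∀ {n} {f g : Fin n → ℕ} → (∀ i → f i ≤ g i) → ∀ j → f j < g j → ∑ f < ∑ g
∑-strict {f = f} {g} f≤g j fj<gj = begin-strict
  ∑ f                                  <⟨ n<1+n (∑ f) ⟩
  1 + ∑ f                              ≤⟨ +-monoˡ-≤ (∑ f) (≤-trans (≤-reflexive (sym (ι-yes (j Fin.≟ j) refl))) (∑-lookup (λ i → ι (j Fin.≟ i)) j)) ⟩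
  ∑ (λ i → ι (j Fin.≟ i)) + ∑ f        ≡⟨ ∑-+ (λ i → ι (j Fin.≟ i)) f ⟨
  ∑ (λ i → ι (j Fin.≟ i) + f i)        ≤⟨ ∑-mono step ⟩
  ∑ g                                  ∎
  where
  open ≤-Reasoning
  step : ∀ i → ι (j Fin.≟ i) + f i ≤ g i
  step i with j Fin.≟ i
  ... | yes refl rewrite ι-yes (yes (refl {x = j})) refl = fj<gj
  ... | no ¬p rewrite ι-no (no ¬p) ¬p = f≤g i

module _ {n : ℕ} where

  -- This is `reach` with the adjacency test abstracted. Connectivity thereby becomes decidable for
  -- every decidable relation, in particular for first-round edges and for a graph with one edge
  -- deleted.
  walk : (Fin n → Fin n → Bool) → ℕ → Fin n → Fin n → Bool
  walk e zero i j = eqᶠ i j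
  walk e (suc k) i j = walk e k i j ∨ any (λ l → walk e k i l ∧ e l j) (allFin n)

  reach≡walk : ∀ k (G : Graph n) i j → reach k G i j ≡ walk (adj G) k i j
  reach≡walk zero G i j = refl
  reach≡walk (suc k) G i j = cong₂ _∨_ (reach≡walk k G i j) (any-cong (allFin n))
    where
    any-cong : ∀ ls → any (λ l → reach k G i l ∧ adj G l j) ls ≡ any (λ l → walk (adj G) k i l ∧ adj G l j) ls
    any-cong [] = refl
    any-cong (l ∷ ls) = cong₂ _∨_ (cong (_∧ adj G l j) (reach≡walk k G i l)) (any-cong ls)

  module _ (e : Fin n → Fin n → Bool) where

    private
      R : Fin n → Fin n → Set
      R i j = T (e i j)

    walk-sound : ∀ k i j → T (walk e k i j) → Star R i j
    walk-sound zero i j p with i Fin.≟ j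
    ... | yes refl = ε
    walk-sound (suc k) i j p with Equivalence.to T-∨ p
    ... | inj₁ q = walk-sound k i j q
    ... | inj₂ q with find (Any.any⁻ (λ l → walk e k i l ∧ e l j) (allFin n) q)
    ... | l , _ , r = let (u , v) = Equivalence.to T-∧ r in walk-sound k i l u ◅◅ (v ◅ ε)

    walk-suc : ∀ k {i j} → T (walk e k i j) → T (walk e (suc k) i j)
    walk-suc k p = Equivalence.from T-∨ (inj₁ p)

    walk-mono : ∀ {k m i j} → k ≤′ m → T (walk e k i j) → T (walk e m i j)
    walk-mono ≤′-refl p = p
    walk-mono (≤′-step {m} k≤m) p = walk-suc m (walk-mono k≤m p)

    walk-step : ∀ k {i l j} → T (walk e k i l) → R l j → T (walk e (suc k) i j)
    walk-step k {i} {l} {j} p q = Equivalence.from (T-∨ {walk e k i j}) (inj₂ (Any.any⁺ _ (lose (∈-allFin l) (Equivalence.from T-∧ (p , q)))))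

    walk-refl : ∀ k i → T (walk e k i i)
    walk-refl zero i with i Fin.≟ i
    ... | yes _ = tt
    ... | no ¬p = contradiction refl ¬p
    walk-refl (suc k) i = walk-suc k (walk-refl k i)

    -- A stage not yet closed under steps gains a vertex at the next stage, so `k` such stages have
    -- reached more than `k` vertices. For `k` equal to `n` this is absurd, hence walks of length at
    -- most `n` suffice.
    walk-saturates : ∀ i k → (∃[ m ] m ≤ k × (∀ j l → T (walk e m i j) → R j l → T (walk e m i l))) ⊎
      k < ∑ (λ j → ι (T? (walk e k i j)))
    walk-saturates i zero = inj₂ (≤-trans (≤-reflexive (sym (ι-yes (T? (walk e 0 i i)) (walk-refl 0 i))))
      (∑-lookup (λ j → ι (T? (walk e 0 i j))) i))
    walk-saturates i (suc k) with walk-saturates i k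
    ... | inj₁ (m , m≤k , c) = inj₁ (m , m≤n⇒m≤1+n m≤k , c)
    ... | inj₂ k<c with Fin.any? (λ j → Fin.any? (λ l → T? (walk e k i j) ×-dec T? (e j l) ×-dec ¬? (T? (walk e k i l))))
    ...   | no ∄ = inj₁ (k , n≤1+n k , λ j l p q → decidable-stable (T? (walk e k i l)) (λ ¬r → ∄ (j , l , p , q , ¬r)))
    ...   | yes (j , l , p , q , ¬r) = inj₂ (≤-trans (s≤s k<c) (∑-strict
      (λ x → ι-mono (T? (walk e k i x)) (T? (walk e (suc k) i x)) (walk-suc k)) l
      (subst₂ _<_ (sym (ι-no (T? (walk e k i l)) ¬r)) (sym (ι-yes (T? (walk e (suc k) i l)) (walk-step k p q))) (s≤s z≤n))))

    walk-complete : ∀ {i j} → Star R i j → T (walk e n i j)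
    walk-complete {i} {j} path with walk-saturates i n
    ... | inj₁ (m , m≤n , c) = walk-mono (≤⇒≤′ m≤n) (go (walk-refl m i) path)
      where
      go : ∀ {x} → T (walk e m i x) → Star R x j → T (walk e m i j)
      go p ε = p
      go p (q ◅ qs) = go (c _ _ p q) qs
    ... | inj₂ n<c = contradiction n<c (≤⇒≯ (≤-trans (∑-mono (λ j → ι≤1 (T? (walk e n i j))))
      (≤-reflexive (trans (∑-const n 1) (*-identityʳ n)))))

  maxV-≥ : ∀ (f : Fin n → ℕ) i → f i ≤ maxV n f
  maxV-≥ f i = go (allFin n) (∈-allFin i)
    where
    go : ∀ l → i ∈ l → f i ≤ List.foldr _⊔_ 0 (List.map f l)
    go (x ∷ l) (here refl) = m≤m⊔n _ _
    go (x ∷ l) (there p) = ≤-trans (go l p) (m≤n⊔m _ _)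

  opaque
    star? : ∀ {R : Fin n → Fin n → Set} → (∀ i j → Dec (R i j)) → ∀ i j → Dec (Star R i j)
    star? R? i j = map′
      (Star.map (λ {x} {y} → does-true (R? x y) ∘ T⇒≡) ∘ walk-sound e n i j)
      (λ s → walk-complete e (Star.map (λ {x} {y} r → subst T (sym (dec-true (R? x y) r)) tt) s))
      (T? (walk e n i j))
      where
      e : Fin n → Fin n → Bool
      e x y = does (R? x y)
      T⇒≡ : ∀ {b} → T b → b ≡ true
      T⇒≡ {true} _ = refl

  component≤L₁ : ∀ (G : Graph n) {R : Fin n → Fin n → Set} (R? : ∀ i j → Dec (R i j)) →
    (∀ {i j} → R i j → T (adj {n} G i j)) → ∀ i → ∑ (λ j → ι (star? R? i j)) ≤ L₁ {n} G
  component≤L₁ G R? R⇒adj i = begin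
    ∑ (λ j → ι (star? R? i j))                           ≤⟨ ∑-mono (λ j → bound j) ⟩
    ∑ (λ j → if reach n G i j then 1 else 0)             ≡⟨ ΣV≡∑ n _ ⟨
    compSize {n} G i                                         ≤⟨ maxV-≥ (compSize {n} G) i ⟩
    L₁ {n} G                                                 ∎
    where
    open ≤-Reasoning
    bound : ∀ j → ι (star? R? i j) ≤ (if reach n G i j then 1 else 0)
    bound j = ι-guard₁ (star? R? i j) (λ s → go (subst T (sym (reach≡walk n G i j)) (walk-complete (adj G) (Star.map R⇒adj s))))
      where
      go : ∀ {b} → T b → 1 ≤ (if b then 1 else 0)
      go {true} _ = ≤-refl

  _∖⟨_,_⟩ : (Fin n → Fin n → Set) → Fin n → Fin n → Fin n → Fin n → Set
  (R ∖⟨ a , b ⟩) x y = R x y × ¬ Same a b x y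

  minus? : ∀ {R : Fin n → Fin n → Set} → (∀ i j → Dec (R i j)) → ∀ a b i j → Dec ((R ∖⟨ a , b ⟩) i j)
  minus? R? a b i j = R? i j ×-dec ¬? (Same? a b i j)

  Star-sym : ∀ {R : Fin n → Fin n → Set} → (∀ {i j} → R i j → R j i) → ∀ {i j} → Star R i j → Star R j i
  Star-sym R-sym = Star.reverse R-sym

  minus-sym : ∀ {R : Fin n → Fin n → Set} {a b} → (∀ {i j} → R i j → R j i) →
    ∀ {i j} → (R ∖⟨ a , b ⟩) i j → (R ∖⟨ a , b ⟩) j i
  minus-sym R-sym (r , ne) = R-sym r , ne ∘ Same-swap

  minus-swap : ∀ {R : Fin n → Fin n → Set} {a b x y} → Star (R ∖⟨ a , b ⟩) x y → Star (R ∖⟨ b , a ⟩) x y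
  minus-swap = Star.map (λ (r , ne) → r , λ s → ne (Same-trans (inj₂ (refl , refl)) s))

  first-entry : ∀ {R : Fin n → Fin n → Set} {C : Fin n → Set} → (∀ i → Dec (C i)) → ∀ {r t} → Star R r t → C t →
    C r ⊎ (∃[ a ] ∃[ b ] R a b × ¬ C a × C b × Star (λ x y → R x y × ¬ C x × ¬ C y) r a)
  first-entry C? ε c = inj₁ c
  first-entry C? {r} (_◅_ {j = y} e p) c with C? r
  ... | yes cr = inj₁ cr
  ... | no ¬cr with first-entry C? p c
  ...   | inj₁ cy = inj₂ (r , y , e , ¬cr , cy , ε)
  ...   | inj₂ (a , b , ab , ¬ca , cb , path) with C? y
  ...     | yes cy = inj₂ (r , y , e , ¬cr , cy , ε)
  ...     | no ¬cy = inj₂ (a , b , ab , ¬ca , cb , (e , ¬cr , ¬cy) ◅ path)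

  -- A walk from r into the class C that stops on arrival uses no edge with an endpoint in C but the
  -- last one, so that edge must be any edge whose removal separates C from r.
  unique-entry : ∀ {R : Fin n → Fin n → Set} {C : Fin n → Set} → (∀ i → Dec (C i)) → ∀ {r a b a′ b′} →
    C b → C b′ → Star R r b →
    (∀ {x y} → C x → C y → Star (R ∖⟨ a , b ⟩) x y) → (∀ {x y} → C x → C y → Star (R ∖⟨ a′ , b′ ⟩) x y) →
    ¬ Star (R ∖⟨ a , b ⟩) r b → ¬ Star (R ∖⟨ a′ , b′ ⟩) r b′ → a ≡ a′ × b ≡ b′
  unique-entry {R} {C} C? {r} {a} {b} {a′} {b′} cb cb′ path conn conn′ sep sep′ with first-entry C? path cb
  ... | inj₁ cr = contradiction (conn cr cb) sep
  ... | inj₂ (x , y , xy , ¬cx , cy , p) =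
    let (u , v) = last cb conn sep ; (u′ , v′) = last cb′ conn′ sep′ in trans u (sym u′) , trans v (sym v′)
    where
    last : ∀ {a b} → C b → (∀ {x y} → C x → C y → Star (R ∖⟨ a , b ⟩) x y) → ¬ Star (R ∖⟨ a , b ⟩) r b →
      a ≡ x × b ≡ y
    last {a} {b} cb conn sep with Same? a b x y
    ... | yes (inj₁ q) = q
    ... | yes (inj₂ (_ , refl)) = contradiction cb ¬cx
    ... | no ne = contradiction
      (Star.map (λ { (r , ¬cu , ¬cv) → r , λ { (inj₁ (_ , refl)) → ¬cv cb ; (inj₂ (_ , refl)) → ¬cu cb } }) p
        ◅◅ ((xy , ne) ◅ conn cy cb)) sep

  -- The part of the walk after the last use of the added edge lies in `R` and starts at `x`, `a` or
  -- `b`. Consequently a component after the addition is covered by three old ones.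
  add-edge : ∀ {R R′ : Fin n → Fin n → Set} {a b} → (∀ {i j} → R′ i j → R i j ⊎ Same a b i j) →
    ∀ {x y} → Star R′ x y → Star R x y ⊎ Star R a y ⊎ Star R b y
  add-edge h ε = inj₁ ε
  add-edge h (e ◅ p) with add-edge h p | h e
  ... | inj₂ q | _ = inj₂ q
  ... | inj₁ q | inj₁ r = inj₁ (r ◅ q)
  ... | inj₁ q | inj₂ (inj₁ (refl , refl)) = inj₂ (inj₂ q)
  ... | inj₁ q | inj₂ (inj₂ (refl , refl)) = inj₂ (inj₁ q)

firstTrue : ∀ {n} → (Fin n → Bool) → Maybe (Fin n)
firstTrue {zero} p = nothing
firstTrue {suc n} p = if p zero then just zero else Maybe.map suc (firstTrue (p ∘ suc))

firstTrue-cong : ∀ {n} {p q : Fin n → Bool} → (∀ i → p i ≡ q i) → firstTrue p ≡ firstTrue q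
firstTrue-cong {zero} h = refl
firstTrue-cong {suc n} h = cong₂ (λ b m → if b then just zero else Maybe.map suc m) (h zero) (firstTrue-cong (h ∘ suc))

firstTrue-just : ∀ {n} (p : Fin n → Bool) i → p i ≡ true → ∃[ r ] firstTrue p ≡ just r × p r ≡ true
firstTrue-just {suc n} p i pi with p zero in eq
... | true = zero , refl , eq
firstTrue-just {suc n} p zero pi | false with () ← trans (sym eq) pi
firstTrue-just {suc n} p (suc i) pi | false with firstTrue-just (p ∘ suc) i pi
... | r , e , pr = suc r , cong (Maybe.map suc) e , pr

module _ {n : ℕ} {R : Fin n → Fin n → Set} (R? : ∀ i j → Dec (R i j)) (R-sym : ∀ {i j} → R i j → R j i) where

  -- The least vertex of the component, hence the same for connected vertices. The default is never
  -- taken, since `b` itself passes the test.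
  root : Fin n → Fin n
  root b = fromMaybe b (firstTrue (λ r → does (star? R? r b)))

  root-connected : ∀ b → Star R (root b) b
  root-connected b with firstTrue-just (λ r → does (star? R? r b)) b (dec-true (star? R? b b) ε)
  ... | r , e , pr rewrite e = does-true (star? R? r b) pr

  root-cong : ∀ {a b} → Star R a b → root a ≡ root b
  root-cong {a} {b} s with firstTrue-just (λ r → does (star? R? r b)) b (dec-true (star? R? b b) ε)
  ... | r , e , _ = trans (cong (fromMaybe a) (trans (firstTrue-cong same) e)) (sym (cong (fromMaybe b) e))
    where
    same : ∀ r → does (star? R? r a) ≡ does (star? R? r b)
    same r with star? R? r b
    ... | yes p = dec-true (star? R? r a) (p ◅◅ Star-sym R-sym s)
    ... | no ¬p = dec-false (star? R? r a) (λ q → ¬p (q ◅◅ s))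

  Bridge : Fin n → Fin n → Set
  Bridge a b = R a b × ¬ Star (R ∖⟨ a , b ⟩) a b

  Bridge? : ∀ a b → Dec (Bridge a b)
  Bridge? a b = R? a b ×-dec ¬? (star? (minus? R? a b) a b)

  -- A marked bridge is charged to a class at its end away from the root of its component; a class
  -- is charged at most once.
  bridges-≤ : ∀ {M S : Fin n → Fin n → Set} (M? : ∀ a b → Dec (M a b)) (S? : ∀ s x → Dec (S s x))
    (cost : Fin n → Fin n → ℕ) (g : Fin n → ℕ) →
    (∀ {a b} → M a b → M b a) →
    (∀ {s x y a b} → S s x → S s y → M a b → Star (R ∖⟨ a , b ⟩) x y) →
    (∀ {a b} → M a b → ∃[ s ] S s b × cost a b ≤ g s) →
    (∀ a b → cost a b ≡ cost b a) →
    ∑ (λ a → ∑ (λ b → ι (Bridge? a b ×-dec M? a b) * cost a b)) ≤ 2 * ∑ g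
  bridges-≤ {M} {S} M? S? cost g M-sym class cover cost-sym = begin
    ∑ (λ a → ∑ (λ b → ι (Bridge? a b ×-dec M? a b) * cost a b))
      ≤⟨ ∑-mono (λ a → ∑-mono (λ b → ι-guard (Bridge? a b ×-dec M? a b) (λ (br , m) → charge a b br m))) ⟩
    ∑ (λ a → ∑ (λ b → ∑ (λ s → g s * ι (child? s a b)) + ∑ (λ s → g s * ι (child? s b a))))
      ≡⟨ trans (∑-cong (λ a → ∑-+ (λ b → ∑ (λ s → g s * ι (child? s a b))) _)) (∑-+ (λ a → ∑ (λ b → ∑ (λ s → g s * ι (child? s a b)))) _) ⟩
    ∑ (λ a → ∑ (λ b → ∑ (λ s → g s * ι (child? s a b)))) + ∑ (λ a → ∑ (λ b → ∑ (λ s → g s * ι (child? s b a))))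
      ≡⟨ cong (∑ (λ a → ∑ (λ b → ∑ (λ s → g s * ι (child? s a b)))) +_) (∑-swap (λ a b → ∑ (λ s → g s * ι (child? s b a)))) ⟩
    ∑ (λ a → ∑ (λ b → ∑ (λ s → g s * ι (child? s a b)))) + ∑ (λ a → ∑ (λ b → ∑ (λ s → g s * ι (child? s a b))))
      ≤⟨ +-mono-≤ half half ⟩
    ∑ g + ∑ g
      ≡⟨ cong (∑ g +_) (+-identityʳ (∑ g)) ⟨
    2 * ∑ g ∎
    where
    open ≤-Reasoning
    Child : Fin n → Fin n → Fin n → Set
    Child s a b = R a b × M a b × S s b × ¬ Star (R ∖⟨ a , b ⟩) (root b) b
    child? : ∀ s a b → Dec (Child s a b)
    child? s a b = R? a b ×-dec M? a b ×-dec S? s b ×-dec ¬? (star? (minus? R? a b) (root b) b)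
    one : ∀ a b → R a b → M a b → ¬ Star (R ∖⟨ a , b ⟩) (root b) b →
      cost a b ≤ ∑ (λ s → g s * ι (child? s a b))
    one a b r m ¬c with cover m
    ... | s , sb , le = ≤-trans (≤-trans le (≤-reflexive (sym (trans (cong (g s *_) (ι-yes (child? s a b) (r , m , sb , ¬c))) (*-identityʳ (g s))))))
            (∑-lookup (λ s → g s * ι (child? s a b)) s)
    charge : ∀ a b → Bridge a b → M a b →
      cost a b ≤ ∑ (λ s → g s * ι (child? s a b)) + ∑ (λ s → g s * ι (child? s b a))
    charge a b (r , ¬c) m = [ away , (λ ¬d → ≤-trans (one a b r m ¬d) (m≤m+n _ _)) ]′ (toSum (star? (minus? R? a b) (root b) b))
      where
      -- If `b` stays connected to the root without the edge, then `a` does not: otherwise `a` and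
      -- `b` would be connected through the root, against the edge being a bridge. So the reversed
      -- pair is charged, at the end `a`.
      away : Star (R ∖⟨ a , b ⟩) (root b) b → cost a b ≤ ∑ (λ s → g s * ι (child? s a b)) + ∑ (λ s → g s * ι (child? s b a))
      away d = ≤-trans (≤-trans (≤-reflexive (cost-sym a b)) (one b a (R-sym r) (M-sym m) ¬d′)) (m≤n+m _ _)
        where
        ¬d′ : ¬ Star (R ∖⟨ b , a ⟩) (root a) a
        ¬d′ p = ¬c (Star-sym (minus-sym R-sym) (subst (λ z → Star (R ∖⟨ a , b ⟩) z a) (root-cong (r ◅ ε)) (minus-swap p)) ◅◅ d)
    -- Both charged ends lie in the connected class `s`, so they share a root, and a walk from this
    -- root enters the class for the first time through one edge only.
    unique : ∀ s a b a′ b′ → Child s a b → Child s a′ b′ → a ≡ a′ × b ≡ b′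
    unique s a b a′ b′ (r , m , sb , ¬c) (r′ , m′ , sb′ , ¬c′) =
      unique-entry {C = S s} (S? s) sb sb′ (root-connected b)
        (λ u v → class u v m) (λ u v → class u v m′) ¬c
        (subst (λ z → ¬ Star (R ∖⟨ a′ , b′ ⟩) z b′) (root-cong (Star.map proj₁ (class sb′ sb m))) ¬c′)
    half : ∑ (λ a → ∑ (λ b → ∑ (λ s → g s * ι (child? s a b)))) ≤ ∑ g
    half = begin
      ∑ (λ a → ∑ (λ b → ∑ (λ s → g s * ι (child? s a b))))  ≡⟨ ∑-cong (λ a → ∑-swap (λ b s → g s * ι (child? s a b))) ⟩
      ∑ (λ a → ∑ (λ s → ∑ (λ b → g s * ι (child? s a b))))  ≡⟨ ∑-swap (λ a s → ∑ (λ b → g s * ι (child? s a b))) ⟩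
      ∑ (λ s → ∑ (λ a → ∑ (λ b → g s * ι (child? s a b))))
        ≡⟨ ∑-cong (λ s → trans (∑-cong (λ a → ∑-*ˡ (g s) (λ b → ι (child? s a b)))) (∑-*ˡ (g s) (λ a → ∑ (λ b → ι (child? s a b))))) ⟩
      ∑ (λ s → g s * ∑ (λ a → ∑ (λ b → ι (child? s a b))))
        ≤⟨ ∑-mono (λ s → ≤-trans (*-monoʳ-≤ (g s) (ι-unique₂ (child? s) (unique s))) (≤-reflexive (*-identityʳ (g s)))) ⟩
      ∑ g ∎

-- Double sums, counts and selection

∑₂ : ∀ {m n} → (Fin m → Fin n → ℕ) → ℕ
∑₂ f = ∑ (λ i → ∑ (f i))

module _ {m n : ℕ} where

  ∑₂-mono : ∀ {f g : Fin m → Fin n → ℕ} → (∀ i j → f i j ≤ g i j) → ∑₂ f ≤ ∑₂ g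
  ∑₂-mono h = ∑-mono (λ i → ∑-mono (h i))

  ∑₂-cong : ∀ {f g : Fin m → Fin n → ℕ} → (∀ i j → f i j ≡ g i j) → ∑₂ f ≡ ∑₂ g
  ∑₂-cong h = ∑-cong (λ i → ∑-cong (h i))

  ∑₂-+ : ∀ (f g : Fin m → Fin n → ℕ) → ∑₂ (λ i j → f i j + g i j) ≡ ∑₂ f + ∑₂ g
  ∑₂-+ f g = trans (∑-cong (λ i → ∑-+ (f i) (g i))) (∑-+ (λ i → ∑ (f i)) (λ i → ∑ (g i)))

  ∑₂-*ˡ : ∀ k (f : Fin m → Fin n → ℕ) → ∑₂ (λ i j → k * f i j) ≡ k * ∑₂ f
  ∑₂-*ˡ k f = trans (∑-cong (λ i → ∑-*ˡ k (f i))) (∑-*ˡ k (λ i → ∑ (f i)))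

  ∑₂-*ʳ : ∀ k (f : Fin m → Fin n → ℕ) → ∑₂ (λ i j → f i j * k) ≡ ∑₂ f * k
  ∑₂-*ʳ k f = trans (∑-cong (λ i → ∑-*ʳ k (f i))) (∑-*ʳ k (λ i → ∑ (f i)))

  ∑₂-mono-+ : ∀ {f g h : Fin m → Fin n → ℕ} → (∀ i j → f i j ≤ g i j + h i j) → ∑₂ f ≤ ∑₂ g + ∑₂ h
  ∑₂-mono-+ {g = g} {h} p = ≤-trans (∑₂-mono p) (≤-reflexive (∑₂-+ g h))

  ∑₂-mono-*ˡ : ∀ k {f g : Fin m → Fin n → ℕ} → (∀ i j → f i j ≤ k * g i j) → ∑₂ f ≤ k * ∑₂ g
  ∑₂-mono-*ˡ k {g = g} p = ≤-trans (∑₂-mono p) (≤-reflexive (∑₂-*ˡ k g))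

  ∑₂-mono-*ʳ : ∀ k {f g : Fin m → Fin n → ℕ} → (∀ i j → f i j ≤ g i j * k) → ∑₂ f ≤ ∑₂ g * k
  ∑₂-mono-*ʳ k {g = g} p = ≤-trans (∑₂-mono p) (≤-reflexive (∑₂-*ʳ k g))

  ∑₂-× : ∀ (f : Fin m → ℕ) (g : Fin n → ℕ) → ∑₂ (λ i j → f i * g j) ≡ ∑ f * ∑ g
  ∑₂-× f g = trans (∑-cong (λ i → ∑-*ˡ (f i) g)) (∑-*ʳ (∑ g) f)

∑₂-swap : ∀ {m n p q} (f : Fin m → Fin n → Fin p → Fin q → ℕ) →
  ∑₂ (λ a b → ∑₂ (λ c d → f a b c d)) ≡ ∑₂ (λ c d → ∑₂ (λ a b → f a b c d))
∑₂-swap f = begin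
  ∑ (λ a → ∑ (λ b → ∑ (λ c → ∑ (λ d → f a b c d))))  ≡⟨ ∑-cong (λ a → ∑-swap (λ b c → ∑ (λ d → f a b c d))) ⟩
  ∑ (λ a → ∑ (λ c → ∑ (λ b → ∑ (λ d → f a b c d))))  ≡⟨ ∑-cong (λ a → ∑-cong (λ c → ∑-swap (λ b d → f a b c d))) ⟩
  ∑ (λ a → ∑ (λ c → ∑ (λ d → ∑ (λ b → f a b c d))))  ≡⟨ ∑-swap (λ a c → ∑ (λ d → ∑ (λ b → f a b c d))) ⟩
  ∑ (λ c → ∑ (λ a → ∑ (λ d → ∑ (λ b → f a b c d))))  ≡⟨ ∑-cong (λ c → ∑-swap (λ a d → ∑ (λ b → f a b c d))) ⟩
  ∑ (λ c → ∑ (λ d → ∑ (λ a → ∑ (λ b → f a b c d))))  ∎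
  where open ≡-Reasoning

-- Pairs of edges regrouped by one endpoint of each: the outer pair is the one that a switching will
-- join.
∑₂-exchange : ∀ {m n p q} (f : Fin m → Fin p → ℕ) (g : Fin n → Fin q → ℕ) →
  ∑₂ (λ a b → ∑₂ (λ c d → f a c * g b d)) ≡ ∑₂ f * ∑₂ g
∑₂-exchange f g = trans (∑₂-cong (λ a b → ∑₂-× (f a) (g b))) (∑₂-× (λ a → ∑ (f a)) (λ b → ∑ (g b)))

count₂ : ∀ {m n} {P : Fin m → Fin n → Set} → (∀ i j → Dec (P i j)) → ℕ
count₂ P? = ∑₂ (λ i j → ι (P? i j))

count : ∀ {m} {P : Fin m → Set} → (∀ i → Dec (P i)) → ℕ
count P? = ∑ (λ i → ι (P? i))

count-≡ : ∀ {n} (i : Fin n) → count (i Fin.≟_) ≤ 1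
count-≡ i = ι-unique (i Fin.≟_) (λ j j′ p q → trans (sym p) q)

count₂-Same : ∀ {n} (a b : Fin n) → count₂ (Same? a b) ≤ 2
count₂-Same a b = ≤-trans (∑₂-mono-+ (λ i j → ι-⊎ (a Fin.≟ i ×-dec b Fin.≟ j) (a Fin.≟ j ×-dec b Fin.≟ i)))
  (+-mono-≤ (ι-unique₂ (λ i j → a Fin.≟ i ×-dec b Fin.≟ j) (λ { _ _ _ _ (refl , refl) (refl , refl) → refl , refl }))
            (ι-unique₂ (λ i j → a Fin.≟ j ×-dec b Fin.≟ i) (λ { _ _ _ _ (refl , refl) (refl , refl) → refl , refl })))

opaque
  unfolding ι

  ι-if : ∀ {P : Set} (d : Dec P) m → (if does d then m else 0) ≡ ι d * m
  ι-if (yes _) m = sym (+-identityʳ m)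
  ι-if (no _) m = refl

ι-1 : ∀ {P : Set} (d : Dec P) → P → ∀ m → ι d * m ≡ m
ι-1 d p m = trans (cong (_* m) (ι-yes d p)) (+-identityʳ m)

swap-* : ∀ a b x → a * (b * x) ≡ b * (a * x)
swap-* = solve-∀

∑-reorder : ∀ {n} (f : Fin n → Fin n → Fin n → Fin n → Fin n → ℕ) →
  ∑₂ (λ x z → ∑ (λ v → ∑₂ (λ u y → f x z v u y))) ≡ ∑₂ (λ v u → ∑ (λ x → ∑₂ (λ y z → f x z v u y)))
∑-reorder f = begin
  ∑ (λ x → ∑ (λ z → ∑ (λ v → ∑ (λ u → ∑ (λ y → f x z v u y)))))  ≡⟨ ∑-cong (λ x → ∑-swap (λ z v → ∑ (λ u → ∑ (λ y → f x z v u y)))) ⟩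
  ∑ (λ x → ∑ (λ v → ∑ (λ z → ∑ (λ u → ∑ (λ y → f x z v u y)))))  ≡⟨ ∑-cong (λ x → ∑-cong (λ v → ∑-swap (λ z u → ∑ (λ y → f x z v u y)))) ⟩
  ∑ (λ x → ∑ (λ v → ∑ (λ u → ∑ (λ z → ∑ (λ y → f x z v u y)))))  ≡⟨ ∑-cong (λ x → ∑-cong (λ v → ∑-cong (λ u → ∑-swap (λ z y → f x z v u y)))) ⟩
  ∑ (λ x → ∑ (λ v → ∑ (λ u → ∑ (λ y → ∑ (λ z → f x z v u y)))))  ≡⟨ ∑-swap (λ x v → ∑ (λ u → ∑ (λ y → ∑ (λ z → f x z v u y)))) ⟩
  ∑ (λ v → ∑ (λ x → ∑ (λ u → ∑ (λ y → ∑ (λ z → f x z v u y)))))  ≡⟨ ∑-cong (λ v → ∑-swap (λ x u → ∑ (λ y → ∑ (λ z → f x z v u y)))) ⟩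
  ∑ (λ v → ∑ (λ u → ∑ (λ x → ∑ (λ y → ∑ (λ z → f x z v u y)))))  ∎
  where open ≡-Reasoning

n<2^n : ∀ n → n < 2 ^ n
n<2^n zero = s≤s z≤n
n<2^n (suc n) = ≤-trans (+-mono-≤ {1} {2 ^ n} (≤-trans (s≤s z≤n) (n<2^n n)) (n<2^n n)) (≤-reflexive (cong (2 ^ n +_) (sym (+-identityʳ (2 ^ n)))))

opaque
  unfolding ∑

  -- The size is exact because seeds are constrained from both sides: few enough to bound the
  -- joining bridges, many enough to start the growth.
  choose : ∀ {n} {P : Fin n → Set} (P? : ∀ i → Dec (P i)) N → N ≤ count P? →
    Σ (Fin n → Bool) (λ f → (∀ i → T (f i) → P i) × count (λ i → T? (f i)) ≡ N)
  choose {zero} P? zero _ = (λ ()) , (λ ()) , refl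
  choose {suc n} P? zero _ = (λ _ → false) , (λ _ ()) , ∑-zero {suc n} _ (λ _ → ι-no (T? false) id)
  choose {suc n} {P} P? (suc N) le with P? zero
  ... | yes p rewrite ι-yes (yes p) p with choose (λ i → P? (suc i)) N (≤-pred le)
  ...   | f , f⇒P , eq = g , g⇒P , cong₂ _+_ (ι-yes (T? true) tt) eq
    where
    g : Fin (suc n) → Bool
    g zero = true
    g (suc i) = f i
    g⇒P : ∀ i → T (g i) → P i
    g⇒P zero _ = p
    g⇒P (suc i) = f⇒P i
  choose {suc n} {P} P? (suc N) le | no ¬p rewrite ι-no (no ¬p) ¬p with choose (λ i → P? (suc i)) (suc N) le
  ... | f , f⇒P , eq = g , g⇒P , cong₂ _+_ (ι-no (T? false) id) eq
    where
    g : Fin (suc n) → Bool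
    g zero = false
    g (suc i) = f i
    g⇒P : ∀ i → T (g i) → P i
    g⇒P (suc i) = f⇒P i

-- Rounding down costs at most a factor of two, so natural quotients can stand for fixed proportions
-- of `n`.
quotient-≥ : ∀ m h .{{_ : NonZero h}} → h ≤ m → m ≤ 2 * h * (m / h)
quotient-≥ m h h≤m = begin
  m                          ≡⟨ m≡m%n+[m/n]*n m h ⟩
  m % h + m / h * h          ≤⟨ +-monoˡ-≤ _ (≤-trans (<⇒≤ (m%n<n m h)) (m≤n*m h (m / h) {{>-nonZero (m≥n⇒m/n>0 h≤m)}})) ⟩
  m / h * h + m / h * h      ≡⟨ shape (m / h) h ⟩
  2 * h * (m / h)            ∎
  where
  open ≤-Reasoning
  shape : ∀ q h → q * h + q * h ≡ 2 * h * q
  shape = solve-∀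

-- Measure of events and double counting of moves

module Model (n : ℕ) (D : Fin n → ℕ) (w : St → ℕ) (w≥1 : ∀ s → 1 ≤ w s) where
  open Moves n w w≥1 public

  Z : ℕ
  Z = ∫ (λ ω → ι (Valid? D ω))

  -- The ratio of `μ P?` to `Z` is the probability of the event, so `k * μ P? ≤ Z` says without
  -- division that it is at most 1/k.
  μ : ∀ {P : State → Set} → (∀ ω → Dec (P ω)) → ℕ
  μ P? = ∫ (λ ω → ι (Valid? D ω ×-dec P? ω))

  openGraph : State → Graph n
  openGraph = Vec.map isOpen

  L : State → ℕ
  L ω = L₁ {n} (openGraph ω)

  component≤L : ∀ ω {R : Fin n → Fin n → Set} (R? : ∀ i j → Dec (R i j)) → (∀ {i j} → R i j → O ω i j) →
    ∀ i → count (star? R? i) ≤ L ω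
  component≤L ω R? h = component≤L₁ (openGraph ω) R? (λ {i} {j} r → subst T (sym (adj-status isOpen refl ω i j)) (h r))

  conn? : ∀ ω i j → Dec (Star (O ω) i j)
  conn? ω = star? (O? ω)

  bridge? : ∀ ω a b → Dec (Bridge (O? ω) (O-sym ω) a b)
  bridge? ω = Bridge? (O? ω) (O-sym ω)

  ∫-∑₂-≤ : ∀ {N p q} C {F G : Fin p → Fin q → Vec St N → ℕ} → (∀ i j → ∫ (F i j) ≤ C * ∫ (G i j)) →
    ∫ (λ v → ∑₂ (λ i j → F i j v)) ≤ C * ∫ (λ v → ∑₂ (λ i j → G i j v))
  ∫-∑₂-≤ C h = ∫-∑-≤ C (λ i → ∫-∑-≤ C (h i))

  via-update : ∀ a b t {f g : State → ℕ} → (∀ ω → f ω ≤ g (update ω a b t)) → ∫ f ≤ Q * ∫ g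
  via-update a b t {g = g} h = ≤-trans (∫-mono h) (∫-update g a b t)

  via-switch : ∀ a b c d t {f g : State → ℕ} → (∀ ω → f ω ≤ g (switch ω a b c d t)) → ∫ f ≤ Q ^ 4 * ∫ g
  via-switch a b c d t {g = g} h = ≤-trans (∫-mono h) (∫-switch g a b c d t)

  -- `F` counts moves out of a configuration, at least m/l of them in the event; `G` counts the
  -- moves that may have led to a configuration, at most `u`; `C` is the distortion of weight by one
  -- move.
  double-count : ∀ {P : State → Set} (P? : ∀ ω → Dec (P ω)) m l u C {F G : State → ℕ} →
    ∫ F ≤ C * ∫ G →
    (∀ ω → Valid D ω → P ω → m ≤ l * F ω) → (∀ ω → G ω ≤ u * ι (Valid? D ω)) →
    m * μ P? ≤ l * (C * (u * Z))
  double-count P? m l u C {F} {G} F≤G lower upper = begin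
    m * μ P?                                        ≡⟨ ∫-* m (λ ω → ι (Valid? D ω ×-dec P? ω)) ⟨
    ∫ (λ ω → m * ι (Valid? D ω ×-dec P? ω))         ≤⟨ ∫-mono (λ ω → ≤-trans (≤-reflexive (*-comm m _))
                                                       (ι-guard (Valid? D ω ×-dec P? ω) (λ (v , p) → lower ω v p))) ⟩
    ∫ (λ ω → l * F ω)                               ≡⟨ ∫-* l F ⟩
    l * ∫ F                                         ≤⟨ *-monoʳ-≤ l F≤G ⟩
    l * (C * ∫ G)                                   ≤⟨ *-monoʳ-≤ l (*-monoʳ-≤ C (∫-mono upper)) ⟩
    l * (C * ∫ (λ ω → u * ι (Valid? D ω)))          ≡⟨ cong (λ x → l * (C * x)) (∫-* u (λ ω → ι (Valid? D ω))) ⟩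
    l * (C * (u * Z))                               ∎
    where open ≤-Reasoning

  μ-⊎ : ∀ {P P′ P″ : State → Set} (P? : ∀ ω → Dec (P ω)) (P′? : ∀ ω → Dec (P′ ω)) (P″? : ∀ ω → Dec (P″ ω)) →
    (∀ ω → Valid D ω → P ω → P′ ω ⊎ P″ ω) → μ P? ≤ μ P′? + μ P″?
  μ-⊎ P? P′? P″? h = ≤-trans (∫-mono (λ ω → ι-cover (Valid? D ω ×-dec P? ω) (Valid? D ω ×-dec P′? ω) (Valid? D ω ×-dec P″? ω)
    (λ (v , p) → [ (λ q → inj₁ (v , q)) , (λ q → inj₂ (v , q)) ]′ (h ω v p)))) (≤-reflexive (∫-+ _ _))

  μ-mono : ∀ {P P′ : State → Set} (P? : ∀ ω → Dec (P ω)) (P′? : ∀ ω → Dec (P′ ω)) →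
    (∀ ω → Valid D ω → P ω → P′ ω) → μ P? ≤ μ P′?
  μ-mono P? P′? h = ∫-mono (λ ω → ι-mono (Valid? D ω ×-dec P? ω) (Valid? D ω ×-dec P′? ω) (λ (v , p) → v , h ω v p))

  degree-count′ : ∀ {ω} → Valid D ω → ∀ i → count (λ j → E? ω j i) ≡ D i
  degree-count′ {ω} v i = trans (∑-cong (λ j → ι-cong (E? ω j i) (E? ω i j) (E-sym ω) (E-sym ω))) (v i)

  marked : ∀ {P : Fin n → Fin n → Set} → (∀ i j → Dec (P i j)) → (St → Bool) → State → ℕ
  marked P? κ ω = count₂ (λ i j → P? i j ×-dec T? (κ (st ω i j)))

  -- One slot carries two ordered pairs, hence the 2; a switching resets four slots, hence the 8
  -- below.
  marked-update : ∀ {P : Fin n → Fin n → Set} (P? : ∀ i j → Dec (P i j)) κ ω a b t →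
    marked P? κ (update ω a b t) ≤ marked P? κ ω + 2
  marked-update P? κ ω a b t = ≤-trans (∑₂-mono-+ (λ i j →
      ι-cover (P? i j ×-dec T? (κ (st (update ω a b t) i j))) (P? i j ×-dec T? (κ (st ω i j))) (Same? a b i j) (step i j)))
    (+-monoʳ-≤ (marked P? κ ω) (count₂-Same a b))
    where
    step : ∀ i j → _ × T (κ (st (update ω a b t) i j)) → (_ × T (κ (st ω i j))) ⊎ Same a b i j
    step i j (p , q) with Same? a b i j
    ... | yes s = inj₂ s
    ... | no ¬s = inj₁ (p , subst (T ∘ κ) (st-other ω t ¬s) q)

  marked-switch : ∀ {P : Fin n → Fin n → Set} (P? : ∀ i j → Dec (P i j)) κ ω a b c d t →
    marked P? κ (switch ω a b c d t) ≤ marked P? κ ω + 8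
  marked-switch P? κ ω a b c d t = begin
    marked P? κ (switch ω a b c d t)   ≤⟨ marked-update P? κ ω₃ b d closed ⟩
    marked P? κ ω₃ + 2                 ≤⟨ +-monoˡ-≤ 2 (marked-update P? κ ω₂ a c t) ⟩
    marked P? κ ω₂ + 2 + 2             ≤⟨ +-monoˡ-≤ 2 (+-monoˡ-≤ 2 (marked-update P? κ ω₁ c d none)) ⟩
    marked P? κ ω₁ + 2 + 2 + 2         ≤⟨ +-monoˡ-≤ 2 (+-monoˡ-≤ 2 (+-monoˡ-≤ 2 (marked-update P? κ ω a b none))) ⟩
    marked P? κ ω + 2 + 2 + 2 + 2      ≡⟨ shape (marked P? κ ω) ⟩
    marked P? κ ω + 8                  ∎
    where
    open ≤-Reasoning
    ω₁ = update ω a b none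
    ω₂ = update ω₁ c d none
    ω₃ = update ω₂ a c t
    shape : ∀ x → x + 2 + 2 + 2 + 2 ≡ x + 8
    shape = solve-∀

  -- Opening a closed edge leads to configurations in which only few edges could have been the opened one.
  few-open : ∀ {P : Fin n → Fin n → Set} (P? : ∀ i j → Dec (P i j)) B k m → 1 ≤ B → 1 ≤ m →
    2 * (B + 2 * B * Q * k) ≤ m →
    k * μ (λ ω → ((B + 2 * B * Q * k) * marked P? isOpen ω ≤? m) ×-dec (m <? B * marked P? isEdge ω)) ≤ Z
  few-open {P} P? B k m B≥1 m≥1 small = *-cancelˡ-≤ (2 * B * Q * m) {{>-nonZero pos}} (begin
    2 * B * Q * m * (k * μ ev?)      ≡⟨ shape₁ B Q m k (μ ev?) ⟩
    (2 * B * Q * k * m) * μ ev?      ≤⟨ double-count′ ⟩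
    B * (Q * (2 * m * Z))            ≡⟨ shape₂ B Q m Z ⟩
    2 * B * Q * m * Z                ∎)
    where
    open ≤-Reasoning
    -- In the event there are at least m/B - m/A closed marked edges to open, and after opening one
    -- at most 2m/A open ones to choose from. The excess of `A` over `B` makes the former equal to
    -- `Q * k` times the latter.
    A = B + 2 * B * Q * k
    cE cO : State → ℕ
    cE = marked P? isEdge
    cO = marked P? isOpen
    Ev : State → Set
    Ev ω = A * cO ω ≤ m × m < B * cE ω
    ev? : ∀ ω → Dec (Ev ω)
    ev? ω = (A * cO ω ≤? m) ×-dec (m <? B * cE ω)
    shape₁ : ∀ B Q m k x → 2 * B * Q * m * (k * x) ≡ (2 * B * Q * k * m) * x
    shape₁ = solve-∀
    shape₂ : ∀ B Q m Z → B * (Q * (2 * m * Z)) ≡ 2 * B * Q * m * Z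
    shape₂ = solve-∀
    pos : 0 < 2 * B * Q * m
    pos = 1≤* {2 * B * Q} (1≤* {2 * B} (1≤* {2} (s≤s z≤n) B≥1) Q≥1) m≥1
    before : ∀ i j ω → Dec (Valid D ω × Ev ω × P i j × E ω i j × ¬ O ω i j)
    before i j ω = Valid? D ω ×-dec ev? ω ×-dec P? i j ×-dec E? ω i j ×-dec ¬? (O? ω i j)
    after : ∀ i j ω → Dec (Valid D ω × A * cO ω ≤ 2 * m × P i j × O ω i j)
    after i j ω = Valid? D ω ×-dec (A * cO ω ≤? 2 * m) ×-dec P? i j ×-dec O? ω i j
    F G : State → ℕ
    F ω = ∑₂ (λ i j → ι (before i j ω))
    G ω = ∑₂ (λ i j → ι (after i j ω))
    step : ∀ i j ω → ι (before i j ω) ≤ ι (after i j (update ω i j open₁))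
    step i j ω = ι-mono (before i j ω) (after i j (update ω i j open₁)) λ (v , (few , _) , p , e , _) →
      Valid-update ω open₁ e tt v ,
      (begin
        A * cO (update ω i j open₁)  ≤⟨ *-monoʳ-≤ A (marked-update P? isOpen ω i j open₁) ⟩
        A * (cO ω + 2)               ≡⟨ *-distribˡ-+ A (cO ω) 2 ⟩
        A * cO ω + A * 2             ≤⟨ +-mono-≤ few (≤-trans (≤-reflexive (*-comm A 2)) small) ⟩
        m + m                        ≡⟨ cong (m +_) (+-identityʳ m) ⟨
        2 * m                        ∎) ,
      p , st≡⇒O (update ω i j open₁) (st-update ω open₁ (E-irrefl ω e) Same-refl) tt
    lower : ∀ ω → Valid D ω → Ev ω → 2 * B * Q * k * m ≤ (A * B) * F ω
    lower ω v (few , many) = by-slack 0 (+-mono-≤ (*-monoʳ-≤ A (<⇒≤ many)) (+-mono-≤ (*-monoʳ-≤ B few) (*-monoʳ-≤ (A * B) total)))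
        (shape B Q k m (F ω) (cO ω) (cE ω))
      where
      total : cE ω ≤ F ω + cO ω
      total = ∑₂-mono-+ (λ i j → ι-cover (P? i j ×-dec E? ω i j) (before i j ω) (P? i j ×-dec O? ω i j) (λ (p , e) → cases i j p e))
        where
        cases : ∀ i j → P i j → E ω i j → (Valid D ω × Ev ω × P i j × E ω i j × ¬ O ω i j) ⊎ (P i j × O ω i j)
        cases i j p e with O? ω i j
        ... | yes o = inj₂ (p , o)
        ... | no ¬o = inj₁ (v , (few , many) , p , e , ¬o)
      shape : ∀ B Q k m f o e → 2 * B * Q * k * m + 0 + ((B + 2 * B * Q * k) * (B * e) + (B * m + (B + 2 * B * Q * k) * B * (f + o))) ≡
        (B + 2 * B * Q * k) * B * f + ((B + 2 * B * Q * k) * m + (B * ((B + 2 * B * Q * k) * o) + (B + 2 * B * Q * k) * B * e))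
      shape = solve-∀
    upper : ∀ ω → A * G ω ≤ 2 * m * ι (Valid? D ω)
    upper ω = ≤-trans (≤-reflexive (cong (A *_) (trans (∑₂-cong (λ i j → factor i j)) (∑₂-*ˡ (ι (Valid? D ω ×-dec (A * cO ω ≤? 2 * m))) _))))
      (≤-trans (≤-reflexive (shape A (ι (Valid? D ω ×-dec (A * cO ω ≤? 2 * m))) (cO ω)))
      (ι-guard (Valid? D ω ×-dec (A * cO ω ≤? 2 * m)) (λ (v , le) →
        ≤-trans le (≤-reflexive (sym (trans (cong (2 * m *_) (ι-yes (Valid? D ω) v)) (*-identityʳ (2 * m))))))))
      where
      shape : ∀ a x c → a * (x * c) ≡ x * (a * c)
      shape = solve-∀
      factor : ∀ i j → ι (after i j ω) ≡ ι (Valid? D ω ×-dec (A * cO ω ≤? 2 * m)) * ι (P? i j ×-dec O? ω i j)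
      factor i j = trans (ι-cong (after i j ω) ((Valid? D ω ×-dec (A * cO ω ≤? 2 * m)) ×-dec (P? i j ×-dec O? ω i j))
        (λ (a , b , c , d) → (a , b) , c , d) (λ ((a , b) , c , d) → a , b , c , d)) (ι-× (Valid? D ω ×-dec (A * cO ω ≤? 2 * m)) _)
    F≤G : ∫ F ≤ Q * ∫ G
    F≤G = ∫-∑₂-≤ Q (λ i j → via-update i j open₁ (step i j))
    double-count′ : (2 * B * Q * k * m) * μ ev? ≤ B * (Q * (2 * m * Z))
    double-count′ = ≤-trans (double-count ev? (2 * B * Q * k * m) B (2 * m) Q {λ ω → A * F ω} {λ ω → A * G ω}
      (≤-trans (≤-reflexive (∫-* A F)) (≤-trans (*-monoʳ-≤ A F≤G) (≤-reflexive (trans (shape A Q (∫ G)) (cong (Q *_) (sym (∫-* A G)))))))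
      (λ ω v e → ≤-trans (lower ω v e) (≤-reflexive (shape′ A B (F ω)))) upper) ≤-refl
      where
      shape : ∀ a q x → a * (q * x) ≡ q * (a * x)
      shape = solve-∀
      shape′ : ∀ a b x → a * b * x ≡ b * (a * x)
      shape′ = solve-∀

-- Failure of A₁

module Constants (w : St → ℕ) (w≥1 : ∀ s → 1 ≤ w s) (d k : ℕ) where
  open Integral w w≥1 using (Q)

  -- None of these involves `c`. Typically at least s/G edges join a hub to a low vertex and at
  -- least s/G′ of these are open, `G′` being the constant that `few-open` attaches to `G`. In `K₂`
  -- the leading 4 is that of A₂, and `4 * d` pays for dropping vertices of degree one.
  G G′ K₁ K₂ : ℕ
  G = 16 * Q ^ 4 * d * k
  G′ = G + 2 * G * Q * k
  K₁ = 4 * G′ * G′ * Q ^ 4 * (d + 1) * k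
  K₂ = 4 * (2 * (Q ^ 4 * Q) * d + d + 4) + 4 * d

  -- Degrees above n/R are treated separately. In `r₁` the first two summands are the constant that
  -- `few-open` attaches to `R c`, and the last makes the component bound small against the number
  -- `M` of open hub-low edges.
  R r₁ n₁ : ℕ → ℕ
  R c = 16 * c
  r₁ c = R c + 2 * R c * Q * k + 8 * c * c * G′
  n₁ c = 4 * c * (1 + c) * (c * G′) + (2 * (R c + 2 * R c * Q * k) + c * (8 * G + 2 * G′))

module HighDegrees (n : ℕ) (D : Fin n → ℕ) (w : St → ℕ) (w≥1 : ∀ s → 1 ≤ w s)
  (d k c : ℕ) (D≥1 : ∀ i → 1 ≤ D i) (∑D≤ : ∑ D ≤ d * n) (d≥1 : 1 ≤ d) (k≥1 : 1 ≤ k) (8d≤c : 8 * d ≤ c)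
  (n≥1 : 1 ≤ n) where
  open Model n D w w≥1
  open Constants w w≥1 d k

  Hub : Fin n → Set
  Hub i = c ≤ D i

  hub? : ∀ i → Dec (Hub i)
  hub? i = c ≤? D i

  low⇒D≤c : ∀ {i} → ¬ Hub i → D i ≤ c
  low⇒D≤c p = <⇒≤ (≰⇒> p)

  c≥1 : 1 ≤ c
  c≥1 = ≤-trans d≥1 (≤-trans (m≤m+n d _) 8d≤c)

  s : ℕ
  s = ∑ (λ i → ι (hub? i) * D i)

  hubLow? : ∀ i j → Dec (Hub i × ¬ Hub j)
  hubLow? i j = hub? i ×-dec ¬? (hub? j)

  HL M : State → ℕ
  HL = marked hubLow? isEdge
  M = marked hubLow? isOpen

  HLE? : ∀ ω i j → Dec ((Hub i × ¬ Hub j) × E ω i j)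
  HLE? ω i j = hubLow? i j ×-dec E? ω i j

  hubHub? lowLow? : ∀ ω i j → Dec _
  hubHub? ω i j = (hub? i ×-dec hub? j) ×-dec E? ω i j
  lowLow? ω i j = (¬? (hub? i) ×-dec ¬? (hub? j)) ×-dec E? ω i j

  HH LL : State → ℕ
  HH ω = count₂ (hubHub? ω)
  LL ω = count₂ (lowLow? ω)

  s≤dn : s ≤ d * n
  s≤dn = ≤-trans (∑-mono (λ i → ι-guard (hub? i) (λ _ → ≤-refl))) ∑D≤

  s≤HH+HL : ∀ {ω} → Valid D ω → s ≤ HH ω + HL ω
  s≤HH+HL {ω} v = ≤-trans (≤-reflexive (∑-cong (λ i → trans (cong (ι (hub? i) *_) (sym (v i))) (sym (∑-*ˡ (ι (hub? i)) (λ j → ι (E? ω i j)))))))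
    (∑₂-mono-+ (λ i j → ≤-trans (≤-reflexive (sym (ι-× (hub? i) (E? ω i j))))
      (ι-cover (hub? i ×-dec E? ω i j) (hubHub? ω i j) (HLE? ω i j) (λ (h , e) → cases h e))))
    where
    cases : ∀ {i j} → Hub i → E ω i j → ((Hub i × Hub j) × E ω i j) ⊎ ((Hub i × ¬ Hub j) × E ω i j)
    cases {j = j} h e with hub? j
    ... | yes h′ = inj₁ ((h , h′) , e)
    ... | no ¬h′ = inj₂ ((h , ¬h′) , e)

  -- Because `8 * d ≤ c`, at most n/8 vertices are hubs, and every other vertex has degree at least
  -- one.
  low-count : 7 * n ≤ 8 * ∑ (λ i → ι (¬? (hub? i)) * D i)
  low-count = by-slack 0 (+-mono-≤ (*-monoʳ-≤ 8 total) few) (shape n (count hub?) (∑ (λ i → ι (¬? (hub? i)) * D i)))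
    where
    few : 8 * count hub? ≤ n
    few = *-cancelˡ-≤ d {{>-nonZero d≥1}} (begin
      d * (8 * count hub?)   ≡⟨ swap d (count hub?) ⟩
      (8 * d) * count hub?   ≤⟨ *-monoˡ-≤ (count hub?) 8d≤c ⟩
      c * count hub?         ≡⟨ ∑-*ˡ c (λ i → ι (hub? i)) ⟨
      ∑ (λ i → c * ι (hub? i)) ≤⟨ ∑-mono (λ i → ≤-trans (≤-reflexive (*-comm c _)) (ι-guard (hub? i) id)) ⟩
      ∑ D                    ≤⟨ ∑D≤ ⟩
      d * n                  ∎)
      where
      open ≤-Reasoning
      swap : ∀ d x → d * (8 * x) ≡ (8 * d) * x
      swap = solve-∀
    total : n ≤ count hub? + ∑ (λ i → ι (¬? (hub? i)) * D i)
    total = ≤-trans (≤-reflexive (trans (sym (*-identityʳ n)) (sym (∑-const n 1)))) (∑-mono-+ one)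
      where
      one : ∀ i → 1 ≤ ι (hub? i) + ι (¬? (hub? i)) * D i
      one i with hub? i
      ... | yes h rewrite ι-yes (yes h) h = s≤s z≤n
      ... | no ¬h rewrite ι-no (no ¬h) ¬h | ι-yes (¬? (no ¬h)) ¬h = ≤-trans (D≥1 i) (m≤m+n _ _)
    shape : ∀ n h x → 7 * n + 0 + (8 * (h + x) + n) ≡ 8 * x + (8 * n + 8 * h)
    shape = solve-∀

  low≤HL+LL : ∀ {ω} → Valid D ω → ∑ (λ i → ι (¬? (hub? i)) * D i) ≤ HL ω + LL ω
  low≤HL+LL {ω} v = ≤-trans (≤-reflexive (∑-cong (λ i → trans (cong (ι (¬? (hub? i)) *_) (sym (degree-count′ v i))) (sym (∑-*ˡ (ι (¬? (hub? i))) (λ j → ι (E? ω j i)))))))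
    (≤-trans (≤-reflexive (∑-swap (λ i j → ι (¬? (hub? i)) * ι (E? ω j i))))
    (∑₂-mono-+ (λ i j → ≤-trans (≤-reflexive (sym (ι-× (¬? (hub? j)) (E? ω i j))))
      (ι-cover (¬? (hub? j) ×-dec E? ω i j) (HLE? ω i j) (lowLow? ω i j) (λ (h , e) → cases h e)))))
    where
    cases : ∀ {i j} → ¬ Hub j → E ω i j → ((Hub i × ¬ Hub j) × E ω i j) ⊎ ((¬ Hub i × ¬ Hub j) × E ω i j)
    cases {i} h e with hub? i
    ... | yes h′ = inj₁ ((h′ , h) , e)
    ... | no ¬h′ = inj₂ ((¬h′ , h) , e)

  Q⁴≥1 : 1 ≤ Q ^ 4
  Q⁴≥1 = m^n>0 Q {{>-nonZero Q≥1}} 4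

  16d≤G : 16 * d ≤ G
  16d≤G = begin
    16 * d                 ≡⟨ shape d ⟩
    16 * 1 * d * 1         ≤⟨ *-mono-≤ (*-monoˡ-≤ d (*-monoʳ-≤ 16 Q⁴≥1)) k≥1 ⟩
    16 * Q ^ 4 * d * k     ∎
    where
    open ≤-Reasoning
    shape : ∀ d → 16 * d ≡ 16 * 1 * d * 1
    shape = solve-∀

  G≥1 : 1 ≤ G
  G≥1 = ≤-trans (≤-trans d≥1 (m≤m+n d _)) 16d≤G

  G′≥1 : 1 ≤ G′
  G′≥1 = ≤-trans G≥1 (m≤m+n G _)

  -- With few hub-low edges, most hub half-edges lie in hub-hub edges and there are order n low-low
  -- edges. Switching one of each kind creates two hub-low edges: order s n moves lead out, while a
  -- target has at most order (s/G)² sources, and s is at most d n.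
  few-hub-low : (∀ i → R c * D i ≤ n) → 8 * G ≤ s → k * μ (λ ω → G * HL ω ≤? s) ≤ Z
  few-hub-low maxdeg 8G≤s = *-cancelˡ-≤ (16 * Q ^ 4 * d * (s * n)) {{>-nonZero pos}} (begin
    16 * Q ^ 4 * d * (s * n) * (k * μ ev?)    ≡⟨ shape₁ (Q ^ 4) d k (s * n) (μ ev?) ⟩
    G * (s * n * μ ev?)                       ≤⟨ m≤n*m (G * (s * n * μ ev?)) G {{>-nonZero G≥1}} ⟩
    G * (G * (s * n * μ ev?))                 ≡⟨ shape₂ G (s * n) (μ ev?) ⟩
    (G * G * (s * n)) * μ ev?                 ≤⟨ double-count ev? (G * G * (s * n)) 4 (4 * s * s) (Q ^ 4) F≤G lower upper ⟩
    4 * (Q ^ 4 * (4 * s * s * Z))             ≡⟨ shape₃ (Q ^ 4) s Z ⟩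
    16 * Q ^ 4 * (s * s) * Z                  ≤⟨ *-monoˡ-≤ Z (*-monoʳ-≤ (16 * Q ^ 4) (*-monoʳ-≤ s s≤dn)) ⟩
    16 * Q ^ 4 * (s * (d * n)) * Z            ≡⟨ shape₄ (Q ^ 4) s d n Z ⟩
    16 * Q ^ 4 * d * (s * n) * Z              ∎)
    where
    open ≤-Reasoning
    shape₁ : ∀ q d k x y → 16 * q * d * x * (k * y) ≡ 16 * q * d * k * (x * y)
    shape₁ = solve-∀
    shape₂ : ∀ g x y → g * (g * (x * y)) ≡ g * g * x * y
    shape₂ = solve-∀
    shape₃ : ∀ q s z → 4 * (q * (4 * s * s * z)) ≡ 16 * q * (s * s) * z
    shape₃ = solve-∀
    shape₄ : ∀ q s d n z → 16 * q * (s * (d * n)) * z ≡ 16 * q * d * (s * n) * z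
    shape₄ = solve-∀
    s≥1 : 1 ≤ s
    s≥1 = ≤-trans G≥1 (≤-trans (m≤m+n G _) 8G≤s)
    pos : 0 < 16 * Q ^ 4 * d * (s * n)
    pos = 1≤* {16 * Q ^ 4 * d} (1≤* {16 * Q ^ 4} (1≤* {16} (s≤s z≤n) Q⁴≥1) d≥1) (1≤* {s} s≥1 n≥1)
    ev? : ∀ ω → Dec (G * HL ω ≤ s)
    ev? ω = G * HL ω ≤? s
    after-ev? : ∀ ω → Dec (Valid D ω × G * HL ω ≤ 2 * s)
    after-ev? ω = Valid? D ω ×-dec (G * HL ω ≤? 2 * s)
    Good : State → (a x b y : Fin n) → Set
    Good ω a x b y = ((Hub a × Hub b) × E ω a b) × ((¬ Hub x × ¬ Hub y) × E ω x y) × ¬ E ω a x × ¬ E ω b y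
    good? : ∀ ω a x b y → Dec (Good ω a x b y)
    good? ω a x b y = hubHub? ω a b ×-dec lowLow? ω x y ×-dec ¬? (E? ω a x) ×-dec ¬? (E? ω b y)
    before : ∀ a x b y ω → Dec ((Valid D ω × G * HL ω ≤ s) × Good ω a x b y)
    before a x b y ω = (Valid? D ω ×-dec ev? ω) ×-dec good? ω a x b y
    after : ∀ a x b y ω → Dec ((Valid D ω × G * HL ω ≤ 2 * s) × (((Hub a × ¬ Hub x) × E ω a x) × ((Hub b × ¬ Hub y) × E ω b y)))
    after a x b y ω = after-ev? ω ×-dec (HLE? ω a x ×-dec HLE? ω b y)
    F F′ : State → ℕ
    F ω = ∑₂ (λ a x → ∑₂ (λ b y → ι (before a x b y ω)))
    F′ ω = ∑₂ (λ a x → ∑₂ (λ b y → ι (after a x b y ω)))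
    step : ∀ a x b y ω → ι (before a x b y ω) ≤ ι (after a x b y (switch ω a b x y closed))
    step a x b y ω = ι-mono (before a x b y ω) (after a x b y (switch ω a b x y closed))
      λ ((v , few) , ((ha , hb) , ab) , ((lx , ly) , xy) , ¬ax , ¬by) →
        let sw = record { ab = ab ; cd = xy ; ¬ac = ¬ax ; ¬bd = ¬by
                        ; a≢c = λ { refl → lx ha } ; b≢d = λ { refl → ly hb } }
            ω′ = switch ω a b x y closed
        in (Switch.valid sw closed tt v , (begin
             G * HL ω′           ≤⟨ *-monoʳ-≤ G (marked-switch hubLow? isEdge ω a b x y closed) ⟩
             G * (HL ω + 8)      ≡⟨ *-distribˡ-+ G (HL ω) 8 ⟩
             G * HL ω + G * 8    ≤⟨ +-mono-≤ few (≤-trans (≤-reflexive (*-comm G 8)) 8G≤s) ⟩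
             s + s               ≡⟨ cong (s +_) (+-identityʳ s) ⟨
             2 * s               ∎)) ,
           ((ha , lx) , st≡⇒E ω′ (Switch.st-ac sw closed Same-refl) tt) ,
           ((hb , ly) , st≡⇒E ω′ (Switch.st-bd sw closed Same-refl) tt)
    F≤G : ∫ (λ ω → G * G * F ω) ≤ Q ^ 4 * ∫ (λ ω → G * G * F′ ω)
    F≤G = subst₂ (λ x y → x ≤ Q ^ 4 * y) (sym (∫-* (G * G) F)) (sym (∫-* (G * G) F′))
      (≤-trans (*-monoʳ-≤ (G * G) (∫-∑₂-≤ (Q ^ 4) (λ a x → ∫-∑₂-≤ (Q ^ 4) (λ b y → via-switch a b x y closed (step a x b y)))))
        (≤-reflexive (swap (G * G) (Q ^ 4) (∫ F′))))
      where
      swap : ∀ a b x → a * (b * x) ≡ b * (a * x)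
      swap = solve-∀
    upper : ∀ ω → G * G * F′ ω ≤ 4 * s * s * ι (Valid? D ω)
    upper ω = begin
      G * G * F′ ω
        ≡⟨ cong (G * G *_) (trans (∑₂-cong (λ a x → trans (∑₂-cong (λ b y → trans (ι-× (after-ev? ω) (HLE? ω a x ×-dec HLE? ω b y))
             (cong (ι (after-ev? ω) *_) (ι-× (HLE? ω a x) (HLE? ω b y))))) (trans (∑₂-*ˡ (ι (after-ev? ω)) _) (cong (ι (after-ev? ω) *_) (∑₂-*ˡ (ι (HLE? ω a x)) _)))))
             (trans (∑₂-*ˡ (ι (after-ev? ω)) _) (cong (ι (after-ev? ω) *_) (∑₂-*ʳ (HL ω) _)))) ⟩
      G * G * (ι (after-ev? ω) * (HL ω * HL ω))
        ≡⟨ shape G (ι (after-ev? ω)) (HL ω) ⟩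
      ι (after-ev? ω) * (G * HL ω * (G * HL ω))
        ≤⟨ ι-guard (after-ev? ω) (λ (v , le) → ≤-trans (*-mono-≤ le le)
             (≤-reflexive (trans (shape′ s) (sym (trans (cong (4 * s * s *_) (ι-yes (Valid? D ω) v)) (*-identityʳ _)))))) ⟩
      4 * s * s * ι (Valid? D ω) ∎
      where
      shape : ∀ g i h → g * g * (i * (h * h)) ≡ i * (g * h * (g * h))
      shape = solve-∀
      shape′ : ∀ s → 2 * s * (2 * s) ≡ 4 * s * s
      shape′ = solve-∀
    lower : ∀ ω → Valid D ω → G * HL ω ≤ s → G * G * (s * n) ≤ 4 * (G * G * F ω)
    lower ω v few = ≤-trans (*-monoʳ-≤ (G * G) core) (≤-reflexive (swap (G * G) 4 (F ω)))
      where
      swap : ∀ a b x → a * (b * x) ≡ b * (a * x)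
      swap = solve-∀
      X : (Fin n → Fin n → Fin n → Fin n → ℕ)
      X a x b y = ι (E? ω a b) * ι (E? ω x y)
      bad₁ bad₂ : ℕ
      bad₁ = ∑₂ (λ a x → ∑₂ (λ b y → ι (HLE? ω a x) * X a x b y))
      bad₂ = ∑₂ (λ a x → ∑₂ (λ b y → ι (HLE? ω b y) * X a x b y))
      split : HH ω * LL ω ≤ F ω + (bad₁ + bad₂)
      split = begin
        HH ω * LL ω
          ≡⟨ ∑₂-exchange (λ a b → ι (hubHub? ω a b)) (λ x y → ι (lowLow? ω x y)) ⟨
        ∑₂ (λ a x → ∑₂ (λ b y → ι (hubHub? ω a b) * ι (lowLow? ω x y)))
          ≤⟨ ∑₂-mono (λ a x → ∑₂-mono (λ b y → pointwise a x b y)) ⟩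
        ∑₂ (λ a x → ∑₂ (λ b y → ι (before a x b y ω) + (ι (HLE? ω a x) * X a x b y + ι (HLE? ω b y) * X a x b y)))
          ≡⟨ trans (∑₂-cong (λ a x → trans (∑₂-+ (λ b y → ι (before a x b y ω)) _) (cong (∑₂ (λ b y → ι (before a x b y ω)) +_) (∑₂-+ (λ b y → ι (HLE? ω a x) * X a x b y) _))))
             (trans (∑₂-+ (λ a x → ∑₂ (λ b y → ι (before a x b y ω))) _) (cong (F ω +_) (∑₂-+ (λ a x → ∑₂ (λ b y → ι (HLE? ω a x) * X a x b y)) _))) ⟩
        F ω + (bad₁ + bad₂) ∎
        where
        pointwise : ∀ a x b y → ι (hubHub? ω a b) * ι (lowLow? ω x y) ≤
          ι (before a x b y ω) + (ι (HLE? ω a x) * X a x b y + ι (HLE? ω b y) * X a x b y)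
        pointwise a x b y = subst₂ _≤_ (ι-× (hubHub? ω a b) (lowLow? ω x y))
          (cong (ι (before a x b y ω) +_) (cong₂ _+_ (ι-×₃ (HLE? ω a x) (E? ω a b) (E? ω x y)) (ι-×₃ (HLE? ω b y) (E? ω a b) (E? ω x y))))
          (ι-cover₃ (hubHub? ω a b ×-dec lowLow? ω x y) (before a x b y ω)
            (HLE? ω a x ×-dec (E? ω a b ×-dec E? ω x y)) (HLE? ω b y ×-dec (E? ω a b ×-dec E? ω x y)) cases)
          where
          cases : ((Hub a × Hub b) × E ω a b) × ((¬ Hub x × ¬ Hub y) × E ω x y) →
            ((Valid D ω × G * HL ω ≤ s) × Good ω a x b y) ⊎
            (((Hub a × ¬ Hub x) × E ω a x) × (E ω a b × E ω x y)) ⊎ (((Hub b × ¬ Hub y) × E ω b y) × (E ω a b × E ω x y))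
          cases ((hab@(ha , hb) , ab) , (lxy@(lx , ly) , xy)) with E? ω a x | E? ω b y
          ... | yes ax | _ = inj₂ (inj₁ (((ha , lx) , ax) , ab , xy))
          ... | no _ | yes by = inj₂ (inj₂ (((hb , ly) , by) , ab , xy))
          ... | no ¬ax | no ¬by = inj₁ ((v , few) , (hab , ab) , (lxy , xy) , ¬ax , ¬by)
      -- An existing hub-low edge `ax` spoils at most `D a * D x` switchings, where `D x` is at most
      -- c and `D a` at most n/(16c). With two kinds of spoiling this loses n/8 per hub-low edge;
      -- hence the 16 in `R`.
      hl≤ : R c * ∑₂ (λ a x → ι (HLE? ω a x) * (D a * D x)) ≤ HL ω * (n * c)
      hl≤ = ≤-trans (≤-reflexive (sym (∑₂-*ˡ (R c) (λ a x → ι (HLE? ω a x) * (D a * D x)))))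
        (∑₂-mono-*ʳ (n * c) (λ a x → ≤-trans (≤-reflexive (shape (R c) (ι (HLE? ω a x)) (D a) (D x)))
          (≤-trans (ι-guard (HLE? ω a x) {n = ι (HLE? ω a x) * (n * c)} (λ p → ≤-trans (*-mono-≤ (maxdeg a) (low⇒D≤c (proj₂ (proj₁ p))))
            (≤-reflexive (sym (trans (cong (_* (n * c)) (ι-yes (HLE? ω a x) p)) (+-identityʳ _)))))) ≤-refl)))
        where
        shape : ∀ r i a x → r * (i * (a * x)) ≡ i * (r * a * x)
        shape = solve-∀
      bad₁≡ : bad₁ ≡ ∑₂ (λ a x → ι (HLE? ω a x) * (D a * D x))
      bad₁≡ = ∑₂-cong (λ a x → trans (∑₂-*ˡ (ι (HLE? ω a x)) _) (cong (ι (HLE? ω a x) *_)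
        (trans (∑₂-× (λ b → ι (E? ω a b)) (λ y → ι (E? ω x y))) (cong₂ _*_ (v a) (v x)))))
      bad₂≡ : bad₂ ≡ ∑₂ (λ a x → ι (HLE? ω a x) * (D a * D x))
      bad₂≡ = trans (∑₂-swap (λ a x b y → ι (HLE? ω b y) * X a x b y)) (∑₂-cong (λ b y → trans (∑₂-*ˡ (ι (HLE? ω b y)) _) (cong (ι (HLE? ω b y) *_)
        (trans (∑₂-× (λ a → ι (E? ω a b)) (λ x → ι (E? ω x y))) (cong₂ _*_ (degree-count′ v b) (degree-count′ v y))))))
      8bad≤ : 8 * (bad₁ + bad₂) ≤ s * n
      8bad≤ = *-cancelˡ-≤ c {{>-nonZero c≥1}} (begin
        c * (8 * (bad₁ + bad₂))       ≡⟨ cong (λ x → c * (8 * x)) (cong₂ _+_ bad₁≡ bad₂≡) ⟩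
        c * (8 * (B + B))             ≡⟨ shape c B ⟩
        R c * B                         ≤⟨ hl≤ ⟩
        HL ω * (n * c)                ≤⟨ *-monoˡ-≤ (n * c) (≤-trans (m≤n*m (HL ω) G {{>-nonZero G≥1}}) few) ⟩
        s * (n * c)                   ≡⟨ shape′ s n c ⟩
        c * (s * n)                   ∎)
        where
        B = ∑₂ (λ a x → ι (HLE? ω a x) * (D a * D x))
        shape : ∀ c b → c * (8 * (b + b)) ≡ 16 * c * b
        shape = solve-∀
        shape′ : ∀ s n c → s * (n * c) ≡ c * (s * n)
        shape′ = solve-∀
      2HL≤s : 2 * HL ω ≤ s
      2HL≤s = ≤-trans (*-monoˡ-≤ (HL ω) (≤-trans (*-mono-≤ {2} {16} {1} (s≤s (s≤s z≤n)) d≥1) 16d≤G)) few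
      8HL≤n : 8 * HL ω ≤ n
      8HL≤n = *-cancelˡ-≤ d {{>-nonZero d≥1}} (begin
        d * (8 * HL ω)    ≤⟨ by-slack (8 * d * HL ω) (≤-refl {0}) (shape d (HL ω)) ⟩
        16 * d * HL ω     ≤⟨ *-monoˡ-≤ (HL ω) 16d≤G ⟩
        G * HL ω          ≤⟨ ≤-trans few s≤dn ⟩
        d * n             ∎)
        where
        shape : ∀ d x → d * (8 * x) + 8 * d * x + 0 ≡ 16 * d * x + 0
        shape = solve-∀
      2HH≥s : s ≤ 2 * HH ω
      2HH≥s = by-slack 0 (+-mono-≤ (*-monoʳ-≤ 2 (s≤HH+HL v)) 2HL≤s) (shape s (HH ω) (HL ω))
        where
        shape : ∀ s h l → s + 0 + (2 * (h + l) + s) ≡ 2 * h + (2 * s + 2 * l)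
        shape = solve-∀
      8LL≥6n : 6 * n ≤ 8 * LL ω
      8LL≥6n = by-slack 0 (+-mono-≤ low-count (+-mono-≤ (*-monoʳ-≤ 8 (low≤HL+LL v)) 8HL≤n)) (shape n (∑ (λ i → ι (¬? (hub? i)) * D i)) (HL ω) (LL ω))
        where
        shape : ∀ n x h l → 6 * n + 0 + (8 * x + (8 * (h + l) + n)) ≡ 8 * l + (7 * n + (8 * x + 8 * h))
        shape = solve-∀
      core : s * n ≤ 4 * F ω
      core = *-cancelˡ-≤ 4 (by-slack 0 (+-mono-≤ (*-mono-≤ 2HH≥s 8LL≥6n) (+-mono-≤ (*-monoʳ-≤ 16 split) (*-monoʳ-≤ 2 8bad≤)))
        (shape (s * n) s n (HH ω) (LL ω) (F ω) (bad₁ + bad₂) refl))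
        where
        shape : ∀ sn s n h l f b → sn ≡ s * n → 4 * sn + 0 + (2 * h * (8 * l) + (16 * (f + b) + 2 * sn)) ≡ 4 * (4 * f) + (s * (6 * n) + (16 * (h * l) + 2 * (8 * b)))
        shape sn s n h l f b refl = go s n h l f b
          where
          go : ∀ s n h l f b → 4 * (s * n) + 0 + (2 * h * (8 * l) + (16 * (f + b) + 2 * (s * n))) ≡ 4 * (4 * f) + (s * (6 * n) + (16 * (h * l) + 2 * (8 * b)))
          go = solve-∀

  hubs? : ∀ a b → Dec (Hub a × Hub b)
  hubs? a b = hub? a ×-dec hub? b

  module _ (maxdeg : ∀ i → R c * D i ≤ n) (dense : K₁ * n < c * s) (large : n₁ c ≤ n) where

    K≥1 : 1 ≤ K₁
    K≥1 = 1≤* {4 * G′ * G′ * Q ^ 4 * (d + 1)} (1≤* {4 * G′ * G′ * Q ^ 4} (1≤* {4 * G′ * G′}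
      (1≤* {4 * G′} (1≤* {4} (s≤s z≤n) G′≥1) G′≥1) Q⁴≥1) (≤-trans d≥1 (m≤m+n d 1))) k≥1

    n≤cs : n ≤ c * s
    n≤cs = <⇒≤ (≤-<-trans (m≤n*m n K₁ {{>-nonZero K≥1}}) dense)

    cn≤s : ∀ x → c * x ≤ n → x ≤ s
    cn≤s x le = *-cancelˡ-≤ c {{>-nonZero c≥1}} (≤-trans le n≤cs)

    Split : State → Set
    Split ω = r₁ c * L ω ≤ n × s < G′ * M ω

    split? : ∀ ω → Dec (Split ω)
    split? ω = (r₁ c * L ω ≤? n) ×-dec (s <? G′ * M ω)

    -- Two open hub-low edges `ax` and `by` in different components are switched to `ab` and `xy`,
    -- and the new open edge `ab` is a bridge between hubs. Weighted, about c s² moves lead out and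
    -- order s n lead in, which the density `K₁ * n < c * s` makes disproportionate.
    few-splits : k * μ split? ≤ Z
    few-splits = *-cancelˡ-≤ (4 * G′ * G′ * Q ^ 4 * (d + 1) * (n * s)) {{>-nonZero pos}} (begin
      4 * G′ * G′ * Q ^ 4 * (d + 1) * (n * s) * (k * μ split?)   ≡⟨ shape₁ (4 * G′ * G′ * Q ^ 4 * (d + 1)) n s k (μ split?) ⟩
      K₁ * n * (s * μ split?)                                     ≤⟨ *-monoˡ-≤ (s * μ split?) (<⇒≤ dense) ⟩
      c * s * (s * μ split?)                                     ≡⟨ *-assoc (c * s) s (μ split?) ⟨
      c * s * s * μ split?                                       ≤⟨ double-count split? (c * s * s) (2 * G′ * G′) (2 * s * (d * n) + n * (2 * s)) (Q ^ 4) F≤G lower upper ⟩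
      2 * G′ * G′ * (Q ^ 4 * ((2 * s * (d * n) + n * (2 * s)) * Z))  ≡⟨ shape₂ G′ (Q ^ 4) s d n Z ⟩
      4 * G′ * G′ * Q ^ 4 * (d + 1) * (n * s) * Z                ∎)
      where
      open ≤-Reasoning
      shape₁ : ∀ x n s k m → x * (n * s) * (k * m) ≡ x * k * n * (s * m)
      shape₁ = solve-∀
      shape₂ : ∀ g q s d n z → 2 * g * g * (q * ((2 * s * (d * n) + n * (2 * s)) * z)) ≡ 4 * g * g * q * (d + 1) * (n * s) * z
      shape₂ = solve-∀
      s≥1 : 1 ≤ s
      s≥1 = cn≤s 1 (≤-trans (≤-trans (*-monoʳ-≤ c (≤-trans G′≥1 (≤-trans (m≤m+n G′ _) (m≤n+m _ (8 * G)))))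
        (≤-trans (m≤n+m _ (2 * (R c + 2 * R c * Q * k))) (m≤n+m _ (4 * c * (1 + c) * (c * G′))))) large)
      pos : 0 < 4 * G′ * G′ * Q ^ 4 * (d + 1) * (n * s)
      pos = 1≤* {4 * G′ * G′ * Q ^ 4 * (d + 1)} (1≤* {4 * G′ * G′ * Q ^ 4} (1≤* {4 * G′ * G′}
        (1≤* {4 * G′} (1≤* {4} (s≤s z≤n) G′≥1) G′≥1) Q⁴≥1) (≤-trans d≥1 (m≤m+n d 1))) (1≤* {n} n≥1 s≥1)

      cost : Fin n → Fin n → ℕ
      cost a b = D a ⊓ D b

      -- If `ab` is already an edge, it cannot be created by switching. Its ends being disconnected,
      -- it is closed, and opening it makes the bridge instead.
      Toggled : State → (a b : Fin n) → Set
      Toggled ω a b = (Valid D ω × Split ω) × (Hub a × Hub b) × E ω a b × ¬ Star (O ω) a b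
      toggled? : ∀ ω a b → Dec (Toggled ω a b)
      toggled? ω a b = (Valid? D ω ×-dec split? ω) ×-dec hubs? a b ×-dec E? ω a b ×-dec ¬? (conn? ω a b)

      HLO? : ∀ ω a x → Dec ((Hub a × ¬ Hub x) × O ω a x)
      HLO? ω a x = hubLow? a x ×-dec O? ω a x

      Good : State → (a b x y : Fin n) → Set
      Good ω a b x y = (((Hub a × ¬ Hub x) × O ω a x) × ((Hub b × ¬ Hub y) × O ω b y)) ×
        ¬ Star (O ω) a b × ¬ E ω a b × x ≢ y × ¬ E ω x y
      good? : ∀ ω a b x y → Dec (Good ω a b x y)
      good? ω a b x y = (HLO? ω a x ×-dec HLO? ω b y) ×-dec ¬? (conn? ω a b) ×-dec ¬? (E? ω a b) ×-dec ¬? (x Fin.≟ y) ×-dec ¬? (E? ω x y)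
      before : ∀ ω a b x y → Dec ((Valid D ω × Split ω) × Good ω a b x y)
      before ω a b x y = (Valid? D ω ×-dec split? ω) ×-dec good? ω a b x y

      F₁ F₂ G₁ G₂ F G″ : State → ℕ
      F₁ ω = ∑₂ (λ a b → ι (toggled? ω a b) * cost a b)
      G₁ ω = ∑₂ (λ a b → ι (Valid? D ω) * (ι (bridge? ω a b ×-dec hubs? a b) * cost a b))
      F₂ ω = ∑₂ (λ a b → ∑₂ (λ x y → ι (before ω a b x y) * cost a b))
      G₂ ω = ∑₂ (λ a b → ∑₂ (λ x y → ι (Valid? D ω) * (ι (bridge? ω a b ×-dec hubs? a b) * cost a b) * ι (E? ω x y)))
      -- The factor `n` lets one opening replace all the switchings lost at an adjacent pair of
      -- hubs. It is affordable because an opening is undone in one way only, a switching in up to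
      -- `d * n` ways.
      F ω = n * F₁ ω + F₂ ω
      G″ ω = n * G₁ ω + G₂ ω

      step₁ : ∀ a b ω → ι (toggled? ω a b) * cost a b ≤
        ι (Valid? D (update ω a b open₂)) * (ι (bridge? (update ω a b open₂) a b ×-dec hubs? a b) * cost a b)
      step₁ a b ω = ι-guard (toggled? ω a b) λ ((v , _) , h , e , ¬c) →
        let ω′ = update ω a b open₂
            br : Bridge (O? ω′) (O-sym ω′) a b
            br = st≡⇒O ω′ (st-update ω open₂ (E-irrefl ω e) Same-refl) tt ,
                 λ p → ¬c (Star.map (λ (o , ne) → subst (T ∘ isOpen) (st-other ω open₂ ne) o) p)
        in ≤-reflexive (sym (trans (ι-1 (Valid? D ω′) (Valid-update ω open₂ e tt v) _) (ι-1 (bridge? ω′ a b ×-dec hubs? a b) (br , h) _)))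

      step₂ : ∀ a b x y ω → ι (before ω a b x y) * cost a b ≤
        ι (Valid? D (switch ω a x b y open₂)) * (ι (bridge? (switch ω a x b y open₂) a b ×-dec hubs? a b) * cost a b) * ι (E? (switch ω a x b y open₂) x y)
      step₂ a b x y ω = ι-guard (before ω a b x y) λ ((v , _) , (((ha , lx) , ax) , ((hb , ly) , by)) , ¬c , ¬ab , x≢y , ¬xy) →
        let sw = record { ab = O⇒E ω ax ; cd = O⇒E ω by ; ¬ac = ¬ab ; ¬bd = ¬xy ; a≢c = λ { refl → ¬c ε } ; b≢d = x≢y }
            ω′ = switch ω a x b y open₂
            br : Bridge (O? ω′) (O-sym ω′) a b
            br = st≡⇒O ω′ (Switch.st-ac sw open₂ Same-refl) tt , λ p → ¬c (Star.map (λ {i} {j} → old sw) p)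
        in ≤-reflexive (sym (trans (cong₂ _*_ (trans (ι-1 (Valid? D ω′) (Switch.valid sw open₂ tt v) _) (ι-1 (bridge? ω′ a b ×-dec hubs? a b) (br , ha , hb) _))
             (ι-yes (E? ω′ x y) (st≡⇒E ω′ (Switch.st-bd sw open₂ Same-refl) tt))) (*-identityʳ (cost a b))))
        where
        old : (sw : Switchable ω a x b y) → ∀ {i j} → (O (switch ω a x b y open₂) ∖⟨ a , b ⟩) i j → O ω i j
        old sw {i} {j} (o , ne) with Switch.st-cases sw open₂ i j
        ... | inj₁ (same , _) = contradiction same ne
        ... | inj₂ (inj₁ (_ , eq)) with () ← subst (T ∘ isOpen) eq o
        ... | inj₂ (inj₂ (inj₁ (_ , eq))) with () ← subst (T ∘ isOpen) eq o
        ... | inj₂ (inj₂ (inj₂ eq)) = subst (T ∘ isOpen) eq o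

      F≤G : ∫ F ≤ Q ^ 4 * ∫ G″
      F≤G = begin
        ∫ F                                     ≡⟨ trans (∫-+ (λ ω → n * F₁ ω) F₂) (cong (_+ ∫ F₂) (∫-* n F₁)) ⟩
        n * ∫ F₁ + ∫ F₂                         ≤⟨ +-mono-≤ (*-monoʳ-≤ n le₁) le₂ ⟩
        n * (Q ^ 4 * ∫ G₁) + Q ^ 4 * ∫ G₂       ≡⟨ cong (_+ Q ^ 4 * ∫ G₂) (swap-* n (Q ^ 4) (∫ G₁)) ⟩
        Q ^ 4 * (n * ∫ G₁) + Q ^ 4 * ∫ G₂       ≡⟨ *-distribˡ-+ (Q ^ 4) (n * ∫ G₁) (∫ G₂) ⟨
        Q ^ 4 * (n * ∫ G₁ + ∫ G₂)               ≡⟨ cong (Q ^ 4 *_) (trans (∫-+ (λ ω → n * G₁ ω) G₂) (cong (_+ ∫ G₂) (∫-* n G₁))) ⟨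
        Q ^ 4 * ∫ G″                            ∎
        where
        Q≤Q⁴ : Q ≤ Q ^ 4
        Q≤Q⁴ = m≤m*n Q (Q * (Q * (Q * 1))) {{>-nonZero (m^n>0 Q {{>-nonZero Q≥1}} 3)}}
        le₁ : ∫ F₁ ≤ Q ^ 4 * ∫ G₁
        le₁ = ≤-trans (∫-∑₂-≤ Q (λ a b → via-update a b open₂ (step₁ a b))) (*-monoˡ-≤ (∫ G₁) Q≤Q⁴)
        le₂ : ∫ F₂ ≤ Q ^ 4 * ∫ G₂
        le₂ = ∫-∑₂-≤ (Q ^ 4) (λ a b → ∫-∑₂-≤ (Q ^ 4) (λ x y → via-switch a x b y open₂ (step₂ a b x y)))

      -- Classes are single vertices here. Whichever end of a bridge is charged, the smaller degree
      -- is at most the degree of that end.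
      bridges : ∀ ω → ∑₂ (λ a b → ι (bridge? ω a b ×-dec hubs? a b) * cost a b) ≤ 2 * s
      bridges ω = bridges-≤ (O? ω) (O-sym ω) {S = _≡_} hubs? Fin._≟_ cost (λ i → ι (hub? i) * D i)
        (λ (p , q) → q , p) (λ { refl refl _ → ε })
        (λ {a} {b} (_ , h) → b , refl , ≤-trans (m⊓n≤n (D a) (D b)) (≤-reflexive (sym (ι-1 (hub? b) h (D b)))))
        (λ a b → ⊓-comm (D a) (D b))

      G₁≤ : ∀ ω → G₁ ω ≤ ι (Valid? D ω) * (2 * s)
      G₁≤ ω = ≤-trans (≤-reflexive (∑₂-*ˡ (ι (Valid? D ω)) _)) (*-monoʳ-≤ (ι (Valid? D ω)) (bridges ω))

      upper : ∀ ω → G″ ω ≤ (2 * s * (d * n) + n * (2 * s)) * ι (Valid? D ω)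
      upper ω = begin
        n * G₁ ω + G₂ ω
          ≡⟨ cong (n * G₁ ω +_) (trans (∑₂-cong (λ a b → ∑₂-*ˡ (ι (Valid? D ω) * (ι (bridge? ω a b ×-dec hubs? a b) * cost a b)) (λ x y → ι (E? ω x y))))
               (∑₂-*ʳ (count₂ (E? ω)) _)) ⟩
        n * G₁ ω + G₁ ω * count₂ (E? ω)
          ≡⟨ factor ⟩
        G₁ ω * (n + count₂ (E? ω))
          ≤⟨ *-monoˡ-≤ _ (G₁≤ ω) ⟩
        ι (Valid? D ω) * (2 * s) * (n + count₂ (E? ω))
          ≡⟨ *-assoc (ι (Valid? D ω)) (2 * s) _ ⟩
        ι (Valid? D ω) * (2 * s * (n + count₂ (E? ω)))
          ≤⟨ ι-guard (Valid? D ω) (λ v → ≤-trans (*-monoʳ-≤ (2 * s) (+-monoʳ-≤ n (≤-trans (≤-reflexive (∑-cong v)) ∑D≤)))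
               (≤-reflexive (trans (shape s n (d * n)) (sym (trans (cong ((2 * s * (d * n) + n * (2 * s)) *_) (ι-yes (Valid? D ω) v)) (*-identityʳ _)))))) ⟩
        (2 * s * (d * n) + n * (2 * s)) * ι (Valid? D ω) ∎
        where
        factor : n * G₁ ω + G₁ ω * count₂ (E? ω) ≡ G₁ ω * (n + count₂ (E? ω))
        factor = trans (cong (_+ G₁ ω * count₂ (E? ω)) (*-comm n (G₁ ω))) (sym (*-distribˡ-+ (G₁ ω) n _))
        shape : ∀ s n x → 2 * s * (n + x) ≡ 2 * s * x + n * (2 * s)
        shape = solve-∀

      lower : ∀ ω → Valid D ω → Split ω → c * s * s ≤ 2 * G′ * G′ * F ω
      lower ω v (small , many) = begin
        c * s * s                           ≤⟨ *-mono-≤ (*-monoʳ-≤ c (<⇒≤ many)) (<⇒≤ many) ⟩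
        c * (G′ * M ω) * (G′ * M ω)         ≡⟨ shape₃ c G′ (M ω) ⟩
        G′ * G′ * (c * (M ω * M ω))         ≤⟨ *-monoʳ-≤ (G′ * G′) core ⟩
        G′ * G′ * (2 * F ω)                 ≡⟨ shape₄ G′ (F ω) ⟩
        2 * G′ * G′ * F ω                   ∎
        where
        shape₃ : ∀ c g m → c * (g * m) * (g * m) ≡ g * g * (c * (m * m))
        shape₃ = solve-∀
        shape₄ : ∀ g f → g * g * (2 * f) ≡ 2 * g * g * f
        shape₄ = solve-∀
        Blocked : Fin n → Fin n → Fin n → Fin n → Set
        Blocked a b x y = (Star (O ω) a y ⊎ x ≡ y ⊎ E ω x y) × (¬ Hub y × E ω b y)
        blocked? : ∀ a b x y → Dec (Blocked a b x y)
        blocked? a b x y = (conn? ω a y ⊎-dec x Fin.≟ y ⊎-dec E? ω x y) ×-dec ¬? (hub? y) ×-dec E? ω b y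
        m : Fin n → Fin n → ℕ
        m a x = ι (HLO? ω a x)
        pointwise : ∀ a b x y → c * (m a x * m b y) ≤
          ι (before ω a b x y) * cost a b + (c * (m a x * ι (blocked? a b x y)) + ι (toggled? ω a b) * (c * (m a x * m b y)))
        pointwise a b x y = begin
          c * (m a x * m b y)          ≡⟨ cong (c *_) (ι-× (HLO? ω a x) (HLO? ω b y)) ⟨
          c * ι (HLO? ω a x ×-dec HLO? ω b y)  ≤⟨ *-monoʳ-≤ c (ι-cover₃ (HLO? ω a x ×-dec HLO? ω b y) (before ω a b x y)
                                           (HLO? ω a x ×-dec blocked? a b x y) (toggled? ω a b ×-dec (HLO? ω a x ×-dec HLO? ω b y)) cases) ⟩
          c * (ι (before ω a b x y) + (ι (HLO? ω a x ×-dec blocked? a b x y) + ι (toggled? ω a b ×-dec (HLO? ω a x ×-dec HLO? ω b y))))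
            ≡⟨ cong₂ (λ p q → c * (ι (before ω a b x y) + (p + q))) (ι-× (HLO? ω a x) (blocked? a b x y))
                 (ι-×₃ (toggled? ω a b) (HLO? ω a x) (HLO? ω b y)) ⟩
          c * (ι (before ω a b x y) + (m a x * ι (blocked? a b x y) + ι (toggled? ω a b) * (m a x * m b y)))
            ≡⟨ shape c (ι (before ω a b x y)) (m a x * ι (blocked? a b x y)) (ι (toggled? ω a b)) (m a x * m b y) ⟩
          ι (before ω a b x y) * c + (c * (m a x * ι (blocked? a b x y)) + ι (toggled? ω a b) * (c * (m a x * m b y)))
            ≤⟨ +-monoˡ-≤ _ (ι-guard (before ω a b x y) (λ b′@(_ , (((ha , _) , _) , ((hb , _) , _)) , _) →
                 ≤-trans (⊓-glb ha hb) (≤-reflexive (sym (ι-1 (before ω a b x y) b′ (cost a b)))))) ⟩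
          ι (before ω a b x y) * cost a b + (c * (m a x * ι (blocked? a b x y)) + ι (toggled? ω a b) * (c * (m a x * m b y))) ∎
          where
          shape : ∀ c i p t q → c * (i + (p + t * q)) ≡ i * c + (c * p + t * (c * q))
          shape = solve-∀
          cases : ((Hub a × ¬ Hub x) × O ω a x) × ((Hub b × ¬ Hub y) × O ω b y) →
            ((Valid D ω × Split ω) × Good ω a b x y) ⊎ (((Hub a × ¬ Hub x) × O ω a x) × Blocked a b x y) ⊎
            (Toggled ω a b × ((Hub a × ¬ Hub x) × O ω a x) × ((Hub b × ¬ Hub y) × O ω b y))
          cases (p@((ha , lx) , ax) , q@((hb , ly) , by)) with conn? ω a b | x Fin.≟ y | E? ω x y | E? ω a b
          ... | yes ab | _ | _ | _ = inj₂ (inj₁ (p , inj₁ (ab ◅◅ (by ◅ ε)) , ly , O⇒E ω by))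
          ... | no _ | yes x≡y | _ | _ = inj₂ (inj₁ (p , inj₂ (inj₁ x≡y) , ly , O⇒E ω by))
          ... | no _ | no _ | yes xy | _ = inj₂ (inj₁ (p , inj₂ (inj₂ xy) , ly , O⇒E ω by))
          ... | no ¬c | no _ | no _ | yes ab = inj₂ (inj₂ (((v , small , many) , (ha , hb) , ab , ¬c) , p , q))
          ... | no ¬c | no x≢y | no ¬xy | no ¬ab = inj₁ ((v , small , many) , (p , q) , ¬c , ¬ab , x≢y , ¬xy)
        -- As `by` is open, `a` and `b` connected forces `y` into the component of `a`. So the
        -- obstruction depends on `y` alone, and a low `y` has at most `c` neighbours `b`.
        blocked-≤ : ∀ a x → ¬ Hub x → ∑₂ (λ b y → ι (blocked? a b x y)) ≤ c * (L ω + (1 + c))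
        blocked-≤ a x lx = begin
          ∑₂ (λ b y → ι (blocked? a b x y))
            ≡⟨ ∑-swap (λ b y → ι (blocked? a b x y)) ⟩
          ∑₂ (λ y b → ι (blocked? a b x y))
            ≤⟨ ∑-mono (λ y → column y) ⟩
          ∑ (λ y → c * (ι (conn? ω a y) + (ι (x Fin.≟ y) + ι (E? ω x y))))
            ≡⟨ trans (∑-*ˡ c _) (cong (c *_) (trans (∑-+ (λ y → ι (conn? ω a y)) _) (cong (count (conn? ω a) +_) (∑-+ (λ y → ι (x Fin.≟ y)) _)))) ⟩
          c * (count (conn? ω a) + (count (x Fin.≟_) + count (E? ω x)))
            ≤⟨ *-monoʳ-≤ c (+-mono-≤ (component≤L ω (O? ω) id a) (+-mono-≤ (count-≡ x) (≤-trans (≤-reflexive (v x)) (low⇒D≤c lx)))) ⟩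
          c * (L ω + (1 + c)) ∎
          where
          column : ∀ y → ∑ (λ b → ι (blocked? a b x y)) ≤ c * (ι (conn? ω a y) + (ι (x Fin.≟ y) + ι (E? ω x y)))
          column y = begin
            ∑ (λ b → ι (blocked? a b x y))
              ≡⟨ trans (∑-cong (λ b → ι-×₃ (conn? ω a y ⊎-dec x Fin.≟ y ⊎-dec E? ω x y) (¬? (hub? y)) (E? ω b y)))
                   (trans (∑-*ˡ (ι (conn? ω a y ⊎-dec x Fin.≟ y ⊎-dec E? ω x y)) _) (cong (ι (conn? ω a y ⊎-dec x Fin.≟ y ⊎-dec E? ω x y) *_)
                   (trans (∑-*ˡ (ι (¬? (hub? y))) _) (cong (ι (¬? (hub? y)) *_) (degree-count′ v y))))) ⟩
            ι (conn? ω a y ⊎-dec x Fin.≟ y ⊎-dec E? ω x y) * (ι (¬? (hub? y)) * D y)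
              ≤⟨ *-mono-≤ (≤-trans (ι-⊎ (conn? ω a y) (x Fin.≟ y ⊎-dec E? ω x y)) (+-monoʳ-≤ (ι (conn? ω a y)) (ι-⊎ (x Fin.≟ y) (E? ω x y))))
                   (ι-guard (¬? (hub? y)) low⇒D≤c) ⟩
            (ι (conn? ω a y) + (ι (x Fin.≟ y) + ι (E? ω x y))) * c
              ≡⟨ *-comm _ c ⟩
            c * (ι (conn? ω a y) + (ι (x Fin.≟ y) + ι (E? ω x y))) ∎
        -- Of the product `D a * D b` the smaller factor is kept as cost, while `c` times the larger
        -- one is at most `n` by the degree bound.
        adjacent-≤ : ∀ a b → ∑₂ (λ x y → ι (toggled? ω a b) * (c * (m a x * m b y))) ≤ n * (ι (toggled? ω a b) * cost a b)
        adjacent-≤ a b = begin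
          ∑₂ (λ x y → ι (toggled? ω a b) * (c * (m a x * m b y)))
            ≡⟨ trans (∑₂-*ˡ (ι (toggled? ω a b)) _) (cong (ι (toggled? ω a b) *_) (trans (∑₂-*ˡ c _) (cong (c *_) (∑₂-× (m a) (m b))))) ⟩
          ι (toggled? ω a b) * (c * (∑ (m a) * ∑ (m b)))
            ≤⟨ *-monoʳ-≤ (ι (toggled? ω a b)) (*-monoʳ-≤ c (*-mono-≤ (m≤D a) (m≤D b))) ⟩
          ι (toggled? ω a b) * (c * (D a * D b))
            ≤⟨ *-monoʳ-≤ (ι (toggled? ω a b)) product ⟩
          ι (toggled? ω a b) * (n * cost a b)
            ≡⟨ swap-* (ι (toggled? ω a b)) n (cost a b) ⟩
          n * (ι (toggled? ω a b) * cost a b) ∎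
          where
          m≤D : ∀ i → ∑ (m i) ≤ D i
          m≤D i = ≤-trans (∑-mono (λ j → ι-mono (HLO? ω i j) (E? ω i j) (O⇒E ω ∘ proj₂))) (≤-reflexive (v i))
          cD≤n : ∀ i → c * D i ≤ n
          cD≤n i = ≤-trans (*-monoˡ-≤ (D i) (m≤m+n c _)) (maxdeg i)
          product : c * (D a * D b) ≤ n * cost a b
          product with ≤-total (D a) (D b)
          ... | inj₁ le = ≤-trans (≤-reflexive (shape c (D a) (D b))) (≤-trans (*-monoˡ-≤ (D a) (cD≤n b)) (≤-reflexive (cong (n *_) (sym (m≤n⇒m⊓n≡m le)))))
            where
            shape : ∀ c x y → c * (x * y) ≡ c * y * x
            shape = solve-∀
          ... | inj₂ le = ≤-trans (≤-reflexive (sym (*-assoc c (D a) (D b)))) (≤-trans (*-monoˡ-≤ (D b) (cD≤n a)) (≤-reflexive (cong (n *_) (sym (m≥n⇒m⊓n≡n le)))))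
        total : c * (M ω * M ω) ≤ F₂ ω + (M ω * (c * (c * (L ω + (1 + c)))) + n * F₁ ω)
        total = begin
          c * (M ω * M ω)
            ≡⟨ cong (c *_) (∑₂-exchange′) ⟨
          c * ∑₂ (λ a b → ∑₂ (λ x y → m a x * m b y))
            ≡⟨ trans (∑₂-cong (λ a b → ∑₂-*ˡ c (λ x y → m a x * m b y))) (∑₂-*ˡ c _) ⟨
          ∑₂ (λ a b → ∑₂ (λ x y → c * (m a x * m b y)))
            ≤⟨ ∑₂-mono-+ (λ a b → ∑₂-mono-+ (λ x y → pointwise a b x y)) ⟩
          F₂ ω + ∑₂ (λ a b → ∑₂ (λ x y → c * (m a x * ι (blocked? a b x y)) + ι (toggled? ω a b) * (c * (m a x * m b y))))
            ≡⟨ cong (F₂ ω +_) (trans (∑₂-cong (λ a b → ∑₂-+ (λ x y → c * (m a x * ι (blocked? a b x y))) _)) (∑₂-+ (λ a b → ∑₂ (λ x y → c * (m a x * ι (blocked? a b x y)))) _)) ⟩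
          F₂ ω + (∑₂ (λ a b → ∑₂ (λ x y → c * (m a x * ι (blocked? a b x y)))) + ∑₂ (λ a b → ∑₂ (λ x y → ι (toggled? ω a b) * (c * (m a x * m b y)))))
            ≤⟨ +-monoʳ-≤ (F₂ ω) (+-mono-≤ blocked-total (∑₂-mono-*ˡ n adjacent-≤)) ⟩
          F₂ ω + (M ω * (c * (c * (L ω + (1 + c)))) + n * F₁ ω) ∎
          where
          ∑₂-exchange′ : ∑₂ (λ a b → ∑₂ (λ x y → m a x * m b y)) ≡ M ω * M ω
          ∑₂-exchange′ = ∑₂-exchange m m
          blocked-total : ∑₂ (λ a b → ∑₂ (λ x y → c * (m a x * ι (blocked? a b x y)))) ≤ M ω * (c * (c * (L ω + (1 + c))))
          blocked-total = begin
            ∑ (λ a → ∑ (λ b → ∑ (λ x → ∑ (λ y → c * (m a x * ι (blocked? a b x y))))))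
              ≡⟨ ∑-cong (λ a → ∑-swap (λ b x → ∑ (λ y → c * (m a x * ι (blocked? a b x y))))) ⟩
            ∑₂ (λ a x → ∑₂ (λ b y → c * (m a x * ι (blocked? a b x y))))
              ≡⟨ ∑₂-cong (λ a x → trans (∑₂-*ˡ c _) (trans (cong (c *_) (∑₂-*ˡ (m a x) _)) (swap-* c (m a x) _))) ⟩
            ∑₂ (λ a x → m a x * (c * ∑₂ (λ b y → ι (blocked? a b x y))))
              ≤⟨ ∑₂-mono-*ʳ (c * (c * (L ω + (1 + c)))) (λ a x → ι-guard (HLO? ω a x) (λ p → ≤-trans (*-monoʳ-≤ c (blocked-≤ a x (proj₂ (proj₁ p))))
                   (≤-reflexive (sym (ι-1 (HLO? ω a x) p _))))) ⟩
            M ω * (c * (c * (L ω + (1 + c)))) ∎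
        cG′ : ∀ x → x * (c * G′) ≤ n → x ≤ M ω
        cG′ x le = *-cancelʳ-≤ x (M ω) (c * G′) {{>-nonZero (1≤* {c} c≥1 G′≥1)}} (begin
          x * (c * G′)    ≤⟨ ≤-trans le n≤cs ⟩
          c * s           ≤⟨ *-monoʳ-≤ c (<⇒≤ many) ⟩
          c * (G′ * M ω)  ≡⟨ shape c G′ (M ω) ⟩
          M ω * (c * G′)  ∎)
          where
          shape : ∀ c g m → c * (g * m) ≡ m * (c * g)
          shape = solve-∀
        M≥₁ : 8 * c * L ω ≤ M ω
        M≥₁ = cG′ _ (≤-trans (≤-reflexive (shape c (L ω) G′)) (≤-trans (*-monoˡ-≤ (L ω) (m≤n+m (8 * c * c * G′) (R c + 2 * R c * Q * k))) small))
          where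
          shape : ∀ c l g → 8 * c * l * (c * g) ≡ 8 * c * c * g * l
          shape = solve-∀
        M≥₂ : 4 * c * (1 + c) ≤ M ω
        M≥₂ = cG′ _ (≤-trans (m≤m+n _ _) large)
        core : c * (M ω * M ω) ≤ 2 * F ω
        core = by-slack (2 * c * c * L ω * M ω) (+-mono-≤ (*-monoʳ-≤ 2 total) (*-monoʳ-≤ (c * M ω) half))
            (shape c (M ω) (F₁ ω) (F₂ ω) n (L ω))
          where
          half : 4 * c * L ω + 2 * c * (1 + c) ≤ M ω
          half = *-cancelˡ-≤ 2 (≤-trans (≤-reflexive (shape′ c (L ω))) (≤-trans (+-mono-≤ M≥₁ M≥₂) (≤-reflexive (cong (M ω +_) (sym (+-identityʳ (M ω)))))))
            where
            shape′ : ∀ c l → 2 * (4 * c * l + 2 * c * (1 + c)) ≡ 8 * c * l + 4 * c * (1 + c)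
            shape′ = solve-∀
          shape : ∀ c m f₁ f₂ n l → c * (m * m) + 2 * c * c * l * m + (2 * (f₂ + (m * (c * (c * (l + (1 + c)))) + n * f₁)) + c * m * m) ≡
            2 * (n * f₁ + f₂) + (2 * (c * (m * m)) + c * m * (4 * c * l + 2 * c * (1 + c)))
          shape = solve-∀

    few-when-bounded : k * μ (λ ω → r₁ c * L ω ≤? n) ≤ 3 * Z
    few-when-bounded = begin
      k * μ (λ ω → r₁ c * L ω ≤? n)
        ≤⟨ *-monoʳ-≤ k (≤-trans (μ-⊎ (λ ω → r₁ c * L ω ≤? n) E₁? E₂₃? split₁) (+-monoʳ-≤ (μ E₁?) (μ-⊎ E₂₃? E₂? split? split₂))) ⟩
      k * (μ E₁? + (μ E₂? + μ split?))
        ≡⟨ shape k (μ E₁?) (μ E₂?) (μ split?) ⟩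
      k * μ E₁? + (k * μ E₂? + k * μ split?)
        ≤⟨ +-mono-≤ (few-hub-low maxdeg (cn≤s _ (≤-trans (*-monoʳ-≤ c (m≤m+n (8 * G) (2 * G′))) c-large)))
             (+-mono-≤ (few-open hubLow? G k s G≥1 (cn≤s 1 (≤-trans (*-monoʳ-≤ c (≤-trans G≥1 (≤-trans (m≤m+n G _) (m≤m+n (8 * G) (2 * G′))))) c-large))
               (cn≤s _ (≤-trans (*-monoʳ-≤ c (m≤n+m (2 * G′) (8 * G))) c-large))) few-splits) ⟩
      Z + (Z + Z)
        ≡⟨ cong (λ x → Z + (Z + x)) (sym (+-identityʳ Z)) ⟩
      3 * Z ∎
      where
      open ≤-Reasoning
      shape : ∀ k x y z → k * (x + (y + z)) ≡ k * x + (k * y + k * z)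
      shape = solve-∀
      c-large : c * (8 * G + 2 * G′) ≤ n
      c-large = ≤-trans (≤-trans (m≤n+m _ (2 * (R c + 2 * R c * Q * k))) (m≤n+m _ (4 * c * (1 + c) * (c * G′)))) large
      E₁? : ∀ ω → Dec (G * HL ω ≤ s)
      E₁? ω = G * HL ω ≤? s
      E₂₃? : ∀ ω → Dec (r₁ c * L ω ≤ n × s < G * HL ω)
      E₂₃? ω = (r₁ c * L ω ≤? n) ×-dec (s <? G * HL ω)
      E₂? : ∀ ω → Dec (G′ * M ω ≤ s × s < G * HL ω)
      E₂? ω = (G′ * M ω ≤? s) ×-dec (s <? G * HL ω)
      split₁ : ∀ ω → Valid D ω → r₁ c * L ω ≤ n → G * HL ω ≤ s ⊎ (r₁ c * L ω ≤ n × s < G * HL ω)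
      split₁ ω _ small with G * HL ω ≤? s
      ... | yes p = inj₁ p
      ... | no ¬p = inj₂ (small , ≰⇒> ¬p)
      split₂ : ∀ ω → Valid D ω → r₁ c * L ω ≤ n × s < G * HL ω → (G′ * M ω ≤ s × s < G * HL ω) ⊎ Split ω
      split₂ ω _ (small , q) with G′ * M ω ≤? s
      ... | yes p = inj₁ (p , q)
      ... | no ¬p = inj₂ (small , ≰⇒> ¬p)

  -- A vertex of linear degree has, outside a rare event, linearly many open edges, and their ends
  -- all lie in its component.
  few-when-unbounded : n₁ c ≤ n → ∀ i → n < R c * D i → k * μ (λ ω → r₁ c * L ω ≤? n) ≤ Z
  few-when-unbounded large i big = ≤-trans
    (*-monoʳ-≤ k (μ-mono (λ ω → r₁ c * L ω ≤? n) (λ ω → (A * marked P? isOpen ω ≤? n) ×-dec (n <? R c * marked P? isEdge ω)) event))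
    (few-open P? (R c) k n (1≤* {16} (s≤s z≤n) c≥1) n≥1
      (≤-trans (≤-trans (m≤m+n (2 * A) _) (m≤n+m _ (4 * c * (1 + c) * (c * G′)))) large))
    where
    A = R c + 2 * R c * Q * k
    P? : ∀ a b → Dec (i ≡ a)
    P? a b = i Fin.≟ a
    event : ∀ ω → Valid D ω → r₁ c * L ω ≤ n → A * marked P? isOpen ω ≤ n × n < R c * marked P? isEdge ω
    event ω v small = ≤-trans (*-mono-≤ (m≤m+n A (8 * c * c * G′)) open≤L) small ,
        ≤-trans big (*-monoʳ-≤ (R c) (≤-trans (≤-reflexive (sym (v i))) edges))
      where
      open≤L : marked P? isOpen ω ≤ L ω
      open≤L = ≤-trans (≤-reflexive (∑-swap (λ a b → ι (P? a b ×-dec O? ω a b)))) (≤-trans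
        (∑-mono (λ b → ≤-trans (∑-mono (λ a → ≤-trans (ι-mono (P? a b ×-dec O? ω a b) ((i Fin.≟ a) ×-dec conn? ω i b) (λ { (refl , o) → refl , o ◅ ε }))
            (≤-reflexive (trans (ι-× (i Fin.≟ a) (conn? ω i b)) (*-comm (ι (i Fin.≟ a)) _)))))
          (≤-trans (≤-reflexive (∑-*ˡ (ι (conn? ω i b)) (λ a → ι (i Fin.≟ a)))) (≤-trans (*-monoʳ-≤ (ι (conn? ω i b)) (count-≡ i)) (≤-reflexive (*-identityʳ _))))))
        (component≤L ω (O? ω) id i))
      edges : count (E? ω i) ≤ marked P? isEdge ω
      edges = ≤-trans (∑-mono (λ b → ι-mono (E? ω i b) (P? i b ×-dec E? ω i b) (refl ,_))) (∑-lookup (λ a → ∑ (λ b → ι (P? a b ×-dec E? ω a b))) i)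

  few-small-components : K₁ * n < c * s → n₁ c ≤ n → k * μ (λ ω → r₁ c * L ω ≤? n) ≤ 3 * Z
  few-small-components dense large with Fin.any? (λ i → n <? R c * D i)
  ... | yes (i , big) = ≤-trans (few-when-unbounded large i big) (m≤m+n Z (2 * Z))
  ... | no ∄ = few-when-bounded (λ i → ≮⇒≥ (λ big → ∄ (i , big))) dense large

-- Failure of A₂

module Exploration (n : ℕ) (D : Fin n → ℕ) (w : St → ℕ) (w≥1 : ∀ s → 1 ≤ w s)
  (d c c* : ℕ) (∑D≤ : ∑ D ≤ d * n)
  {S₀ : Fin n → Set} (S₀? : ∀ i → Dec (S₀ i)) (S₀⇒mid : ∀ {i} → S₀ i → 2 ≤ D i × D i < c) where
  open Model n D w w≥1

  -- Degree at least two gives an explored vertex an edge besides the one through which it was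
  -- reached. Boundary edges end in light vertices so that each of them blocks only boundedly many
  -- switchings.
  Mid Light : Fin n → Set
  Mid i = 2 ≤ D i × D i < c
  Light i = D i < c*

  mid? : ∀ i → Dec (Mid i)
  mid? i = (2 ≤? D i) ×-dec (D i <? c)

  light? : ∀ i → Dec (Light i)
  light? i = D i <? c*

  heavy N : ℕ
  heavy = ∑ (λ i → ι (¬? (light? i)) * D i)
  N = count S₀?

  H₁ : State → Fin n → Fin n → Set
  H₁ ω i j = st ω i j ≡ open₁ × Mid i × Mid j

  H₁? : ∀ ω i j → Dec (H₁ ω i j)
  H₁? ω i j = (st ω i j ≟ˢ open₁) ×-dec mid? i ×-dec mid? j

  H₁-sym : ∀ ω {i j} → H₁ ω i j → H₁ ω j i
  H₁-sym ω {i} {j} (e , p , q) = trans (st-sym ω j i) e , q , p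

  H₁⇒O : ∀ ω {i j} → H₁ ω i j → O ω i j
  H₁⇒O ω (e , _) = st≡⇒O ω e tt

  conn₁? : ∀ ω i j → Dec (Star (H₁ ω) i j)
  conn₁? ω = star? (H₁? ω)

  C : State → Fin n → Set
  C ω v = ∃[ s ] S₀ s × Star (H₁ ω) s v

  C? : ∀ ω v → Dec (C ω v)
  C? ω v = Fin.any? (λ s → S₀? s ×-dec conn₁? ω s v)

  C-extend : ∀ {ω u v} → C ω u → Star (H₁ ω) u v → C ω v
  C-extend (s , s₀ , p) q = s , s₀ , p ◅◅ q

  S₀⇒C : ∀ ω {v} → S₀ v → C ω v
  S₀⇒C ω {v} s₀ = v , s₀ , ε

  C⇒mid : ∀ ω {v} → C ω v → Mid v
  C⇒mid ω (s , s₀ , p) = go (S₀⇒mid s₀) p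
    where
    go : ∀ {a b} → Mid a → Star (H₁ ω) a b → Mid b
    go m ε = m
    go _ ((_ , _ , m) ◅ q) = go m q

  mid⇒D≤c : ∀ {v} → Mid v → D v ≤ c
  mid⇒D≤c (_ , q) = <⇒≤ q

  -- The end `u` may be explored as well, and the edge may be open in the second round. All that
  -- matters is that removing it destroys no first-round edge, so that the exploration survives.
  Boundary : State → Fin n → Fin n → Set
  Boundary ω v u = C ω v × Light u × E ω v u × st ω v u ≢ open₁

  boundary? : ∀ ω v u → Dec (Boundary ω v u)
  boundary? ω v u = C? ω v ×-dec light? u ×-dec E? ω v u ×-dec ¬? (st ω v u ≟ˢ open₁)

  X : State → ℕ
  X ω = count₂ (boundary? ω)

  -- `e` stays fixed while `b` grows along the iteration. The surplus `e + b` leaves room for the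
  -- components that successive moves attach.
  Small : ℕ → ℕ → State → Set
  Small e b ω = (∀ x → count (conn₁? ω x) ≤ b) × count (C? ω) ≤ e + b

  small? : ∀ e b ω → Dec (Small e b ω)
  small? e b ω = Fin.all? (λ x → count (conn₁? ω x) ≤? b) ×-dec (count (C? ω) ≤? e + b)

  vsmall? : ∀ e b ω → Dec (Valid D ω × Small e b ω)
  vsmall? e b ω = Valid? D ω ×-dec small? e b ω

  Φ : ℕ → ℕ → ℕ
  Φ e b = ∫ (λ ω → ι (vsmall? e b ω) * X ω)

  ∑-C : ∀ ω m → ∑ (λ v → ι (C? ω v) * m) ≡ count (C? ω) * m
  ∑-C ω m = ∑-*ʳ m (λ v → ι (C? ω v))

  X≤c|C| : ∀ {ω} → Valid D ω → X ω ≤ count (C? ω) * c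
  X≤c|C| {ω} v = ≤-trans (∑-mono (λ i → ≤-trans (∑-mono (λ j → ι-mono (boundary? ω i j) (C? ω i ×-dec E? ω i j) (λ (p , _ , e , _) → p , e)))
      (≤-trans (≤-reflexive (trans (∑-cong (λ j → ι-× (C? ω i) (E? ω i j))) (trans (∑-*ˡ (ι (C? ω i)) _) (cong (ι (C? ω i) *_) (v i)))))
        (ι-guard (C? ω i) {n = ι (C? ω i) * c} (λ p → ≤-trans (mid⇒D≤c (C⇒mid ω p)) (≤-reflexive (sym (ι-1 (C? ω i) p c))))))))
    (≤-reflexive (∑-C ω c))

  heavy-ends : ∀ {ω} → Valid D ω → count₂ (λ v u → ¬? (light? u) ×-dec E? ω v u) ≡ heavy
  heavy-ends {ω} v = trans (∑-swap (λ i j → ι (¬? (light? j) ×-dec E? ω i j))) (∑-cong (λ j →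
    trans (∑-cong (λ i → ι-× (¬? (light? j)) (E? ω i j))) (trans (∑-*ˡ (ι (¬? (light? j))) _) (cong (ι (¬? (light? j)) *_) (degree-count′ v j)))))

  -- A walk from a seed first enters `v` through some edge, and no other edge at `v` can separate
  -- `v` from all seeds: this is `unique-entry` for the class consisting of `v`.
  parent-unique : ∀ ω {v} → C ω v → ∀ {u u′} →
    ¬ (∃[ s ] S₀ s × Star (H₁ ω ∖⟨ u , v ⟩) s v) → ¬ (∃[ s ] S₀ s × Star (H₁ ω ∖⟨ u′ , v ⟩) s v) → u ≡ u′
  parent-unique ω {v} (s , s₀ , p) sep sep′ = proj₁ (unique-entry {C = v ≡_} (v Fin.≟_) refl refl p
    (λ { refl refl → ε }) (λ { refl refl → ε }) (λ q → sep (s , s₀ , q)) (λ q → sep′ (s , s₀ , q)))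

  stays? : ∀ ω u v → Dec (∃[ s ] S₀ s × Star (H₁ ω ∖⟨ u , v ⟩) s v)
  stays? ω u v = Fin.any? (λ s → S₀? s ×-dec star? (minus? (H₁? ω) u v) s v)

  module Close {ω : State} {v u : Fin n} (vu : E ω v u) where
    ω′ : State
    ω′ = update ω v u closed

    st′ : ∀ {i j} → Same v u i j → st ω′ i j ≡ closed
    st′ = st-update ω closed (E-irrefl ω vu)

    H₁′⇒H₁ : ∀ {i j} → H₁ ω′ i j → H₁ ω i j
    H₁′⇒H₁ {i} {j} (eq , m) = trans (sym (st-other ω closed ne)) eq , m
      where
      ne : ¬ Same v u i j
      ne s with () ← trans (sym (st′ s)) eq

    C′⇒C : ∀ {x} → C ω′ x → C ω x
    C′⇒C (s , s₀ , p) = s , s₀ , Star.map H₁′⇒H₁ p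

    |C′|≤ : count (C? ω′) ≤ count (C? ω)
    |C′|≤ = ∑-mono (λ x → ι-mono (C? ω′ x) (C? ω x) C′⇒C)

    small′ : ∀ {e b} → Small e b ω → Small e b ω′
    small′ (p , q) = (λ x → ≤-trans (∑-mono (λ y → ι-mono (conn₁? ω′ x y) (conn₁? ω x y) (Star.map H₁′⇒H₁))) (p x)) , ≤-trans |C′|≤ q

    X′≤ : X ω′ ≤ X ω + 2
    X′≤ = ≤-trans (∑₂-mono-+ (λ i j → ι-cover (boundary? ω′ i j) (boundary? ω i j) (Same? v u i j) (cases i j)))
      (+-monoʳ-≤ (X ω) (count₂-Same v u))
      where
      cases : ∀ i j → Boundary ω′ i j → Boundary ω i j ⊎ Same v u i j
      cases i j (p , l , e , ne) with Same? v u i j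
      ... | yes s = inj₂ s
      ... | no ¬s = inj₁ (C′⇒C p , l , subst (T ∘ isEdge) (st-other ω closed ¬s) e , λ q → ne (trans (st-other ω closed ¬s) q))

    boundary′ : C ω′ v → Light u → Boundary ω′ v u
    boundary′ p l = p , l , st≡⇒E ω′ (st′ Same-refl) tt , λ q → closed≢open₁ (trans (sym (st′ Same-refl)) q)
      where
      closed≢open₁ : closed ≢ open₁
      closed≢open₁ ()

  -- Closing an open edge at a seed shows that the seeds keep a boundary.
  seeds-boundary : ∀ e b → 2 * heavy ≤ N → N * μ (small? e b) ≤ 4 * Q * Φ e b
  seeds-boundary e b few-heavy = begin
    N * μ (small? e b)
      ≡⟨ ∫-* N _ ⟨
    ∫ (λ ω → N * ι (vsmall? e b ω))
      ≤⟨ ∫-mono (λ ω → ≤-trans (≤-reflexive (*-comm N _)) (ι-guard (vsmall? e b ω) (λ (v , sm) → lower ω v sm))) ⟩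
    ∫ (λ ω → 2 * (F ω + ι (vsmall? e b ω) * X ω))
      ≡⟨ trans (∫-* 2 _) (cong (2 *_) (∫-+ F _)) ⟩
    2 * (∫ F + Φ e b)
      ≤⟨ *-monoʳ-≤ 2 (+-mono-≤ F≤ (m≤n*m (Φ e b) Q {{>-nonZero Q≥1}})) ⟩
    2 * (Q * Φ e b + Q * Φ e b)
      ≡⟨ shape Q (Φ e b) ⟩
    4 * Q * Φ e b ∎
    where
    open ≤-Reasoning
    shape : ∀ q x → 2 * (q * x + q * x) ≡ 4 * q * x
    shape = solve-∀
    Before : State → (v u : Fin n) → Set
    Before ω v u = (Valid D ω × Small e b ω) × S₀ v × Light u × st ω v u ≡ open₁
    before : ∀ ω v u → Dec (Before ω v u)
    before ω v u = vsmall? e b ω ×-dec S₀? v ×-dec light? u ×-dec (st ω v u ≟ˢ open₁)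
    F : State → ℕ
    F ω = ∑₂ (λ v u → ι (before ω v u))
    step : ∀ v u ω → ι (before ω v u) ≤ ι (vsmall? e b (update ω v u closed)) * ι (boundary? (update ω v u closed) v u)
    step v u ω = ι-guard₁ (before ω v u) λ ((val , sm) , s₀ , l , eq) →
      let vu = st≡⇒E ω eq tt
          open Close {ω} {v} {u} vu
      in ≤-reflexive (sym (trans (ι-1 (vsmall? e b ω′) (Valid-update ω closed vu tt val , small′ sm) _)
           (ι-yes (boundary? ω′ v u) (boundary′ (S₀⇒C ω′ s₀) l))))
    F≤ : ∫ F ≤ Q * Φ e b
    F≤ = ≤-trans (∫-∑₂-≤ Q (λ v u → via-update v u closed (step v u)))
      (*-monoʳ-≤ Q (≤-reflexive (∫-cong (λ ω → ∑₂-*ˡ (ι (vsmall? e b ω)) (λ v u → ι (boundary? ω v u))))))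
    lower : ∀ ω → Valid D ω → Small e b ω → N ≤ 2 * (F ω + ι (vsmall? e b ω) * X ω)
    lower ω v sm = by-slack 0 (+-mono-≤ (*-monoʳ-≤ 2 total) few-heavy) (shape′ N (F ω) (X ω) heavy _ (ι-1 (vsmall? e b ω) (v , sm) (X ω)))
      where
      shape″ : ∀ n f x h → n + 0 + (2 * (f + (x + h)) + n) ≡ 2 * (f + x) + (2 * n + 2 * h)
      shape″ = solve-∀
      shape′ : ∀ n f x h y → y ≡ x → n + 0 + (2 * (f + (x + h)) + n) ≡ 2 * (f + y) + (2 * n + 2 * h)
      shape′ n f x h y refl = shape″ n f x h
      cases : ∀ i j → S₀ i × E ω i j → Before ω i j ⊎ Boundary ω i j ⊎ (¬ Light j × E ω i j)
      cases i j (s₀ , e) with light? j | st ω i j ≟ˢ open₁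
      ... | no ¬l | _ = inj₂ (inj₂ (¬l , e))
      ... | yes l | yes o = inj₁ ((v , sm) , s₀ , l , o)
      ... | yes l | no ¬o = inj₂ (inj₁ (S₀⇒C ω s₀ , l , e , ¬o))
      total : N ≤ F ω + (X ω + heavy)
      total = begin
        N
          ≤⟨ ∑-mono (λ i → ι-guard₁ (S₀? i) {ι (S₀? i) * D i} (λ s₀ → ≤-trans (≤-trans (n≤1+n 1) (proj₁ (S₀⇒mid s₀))) (≤-reflexive (sym (ι-1 (S₀? i) s₀ (D i)))))) ⟩
        ∑ (λ i → ι (S₀? i) * D i)
          ≡⟨ ∑-cong (λ i → trans (cong (ι (S₀? i) *_) (sym (v i))) (trans (sym (∑-*ˡ (ι (S₀? i)) _)) (∑-cong (λ j → sym (ι-× (S₀? i) (E? ω i j)))))) ⟩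
        count₂ (λ i j → S₀? i ×-dec E? ω i j)
          ≤⟨ ∑₂-mono (λ i j → ι-cover₃ (S₀? i ×-dec E? ω i j) (before ω i j) (boundary? ω i j) (¬? (light? j) ×-dec E? ω i j) (cases i j)) ⟩
        ∑₂ (λ i j → ι (before ω i j) + (ι (boundary? ω i j) + ι (¬? (light? j) ×-dec E? ω i j)))
          ≡⟨ trans (∑₂-+ (λ i j → ι (before ω i j)) _) (cong (F ω +_) (trans (∑₂-+ (λ i j → ι (boundary? ω i j)) _) (cong (X ω +_) (heavy-ends v)))) ⟩
        F ω + (X ω + heavy) ∎

  -- Closing an open edge at an explored vertex, other than its parent edge, keeps the vertex explored and
  -- produces a boundary edge.
  thin-boundary : ∀ e k → 1 ≤ k → 4 * heavy ≤ e → 2 * (4 * Q * k) ≤ e →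
    k * μ (λ ω → (e <? count (C? ω)) ×-dec (4 * Q * k * X ω ≤? e)) ≤ Z
  thin-boundary e k k≥1 few-heavy large = *-cancelˡ-≤ (4 * Q * e) {{>-nonZero (1≤* {4 * Q} 4Q≥1 e≥1)}} (begin
    4 * Q * e * (k * μ ev?)       ≡⟨ shape₁ Q e k (μ ev?) ⟩
    g * e * μ ev?                 ≤⟨ double-count ev? (g * e) 2 (2 * e) Q F≤G lower upper ⟩
    2 * (Q * (2 * e * Z))         ≡⟨ shape₂ Q e Z ⟩
    4 * Q * e * Z                 ∎)
    where
    open ≤-Reasoning
    g = 4 * Q * k
    shape₁ : ∀ q e k x → 4 * q * e * (k * x) ≡ 4 * q * k * e * x
    shape₁ = solve-∀
    shape₂ : ∀ q e z → 2 * (q * (2 * e * z)) ≡ 4 * q * e * z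
    shape₂ = solve-∀
    4Q≥1 : 1 ≤ 4 * Q
    4Q≥1 = 1≤* {4} (s≤s z≤n) Q≥1
    g≥4 : 4 ≤ g
    g≥4 = *-mono-≤ {4} {4 * Q} {1} (*-mono-≤ {4} {4} {1} ≤-refl Q≥1) k≥1
    e≥1 : 1 ≤ e
    e≥1 = ≤-trans (1≤* {2} (s≤s z≤n) (≤-trans (s≤s z≤n) g≥4)) large
    Ev : State → Set
    Ev ω = e < count (C? ω) × g * X ω ≤ e
    ev? : ∀ ω → Dec (Ev ω)
    ev? ω = (e <? count (C? ω)) ×-dec (g * X ω ≤? e)
    ev′? : ∀ ω → Dec (Valid D ω × g * X ω ≤ 2 * e)
    ev′? ω = Valid? D ω ×-dec (g * X ω ≤? 2 * e)
    Before : State → (v u : Fin n) → Set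
    Before ω v u = (Valid D ω × Ev ω) × Light u × st ω v u ≡ open₁ × (∃[ s ] S₀ s × Star (H₁ ω ∖⟨ u , v ⟩) s v)
    before : ∀ ω v u → Dec (Before ω v u)
    before ω v u = (Valid? D ω ×-dec ev? ω) ×-dec light? u ×-dec (st ω v u ≟ˢ open₁) ×-dec stays? ω u v
    F G : State → ℕ
    F ω = ∑₂ (λ v u → ι (before ω v u))
    G ω = ∑₂ (λ v u → ι (ev′? ω) * ι (boundary? ω v u))
    step : ∀ v u ω → ι (before ω v u) ≤ ι (ev′? (update ω v u closed)) * ι (boundary? (update ω v u closed) v u)
    step v u ω = ι-guard₁ (before ω v u) λ ((val , (_ , thin)) , l , eq , (s , s₀ , p)) →
      let vu = st≡⇒E ω eq tt
          open Close {ω} {v} {u} vu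
          thin′ : g * X ω′ ≤ 2 * e
          thin′ = begin
            g * X ω′           ≤⟨ *-monoʳ-≤ g X′≤ ⟩
            g * (X ω + 2)      ≡⟨ *-distribˡ-+ g (X ω) 2 ⟩
            g * X ω + g * 2    ≤⟨ +-mono-≤ thin (≤-trans (≤-reflexive (*-comm g 2)) large) ⟩
            e + e              ≡⟨ cong (e +_) (+-identityʳ e) ⟨
            2 * e              ∎
          keep : C ω′ v
          keep = s , s₀ , Star.map (λ ((eq′ , m) , ne) → trans (st-other ω closed (λ q → ne (Same-trans (inj₂ (refl , refl)) q))) eq′ , m) p
      in ≤-reflexive (sym (trans (ι-1 (ev′? ω′) (Valid-update ω closed vu tt val , thin′) _) (ι-yes (boundary? ω′ v u) (boundary′ keep l))))
    F≤G : ∫ (λ ω → g * F ω) ≤ Q * ∫ (λ ω → g * G ω)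
    F≤G = subst₂ (λ x y → x ≤ Q * y) (sym (∫-* g F)) (sym (∫-* g G))
      (≤-trans (*-monoʳ-≤ g (∫-∑₂-≤ Q (λ v u → via-update v u closed (step v u)))) (≤-reflexive (swap-* g Q (∫ G))))
    upper : ∀ ω → g * G ω ≤ 2 * e * ι (Valid? D ω)
    upper ω = ≤-trans (≤-reflexive (trans (cong (g *_) (∑₂-*ˡ (ι (ev′? ω)) _)) (swap-* g (ι (ev′? ω)) (X ω))))
      (ι-guard (ev′? ω) (λ (v , le) → ≤-trans le (≤-reflexive (sym (trans (cong (2 * e *_) (ι-yes (Valid? D ω) v)) (*-identityʳ (2 * e)))))))
    lower : ∀ ω → Valid D ω → Ev ω → g * e ≤ 2 * (g * F ω)
    lower ω v ev@(big , thin) = ≤-trans (*-monoʳ-≤ g core) (≤-reflexive (swap-* g 2 (F ω)))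
      where
      Parent : Fin n → Fin n → Set
      Parent i j = C ω i × ¬ (∃[ s ] S₀ s × Star (H₁ ω ∖⟨ j , i ⟩) s i)
      parent? : ∀ i j → Dec (Parent i j)
      parent? i j = C? ω i ×-dec ¬? (stays? ω j i)
      cases : ∀ i j → C ω i × E ω i j → Before ω i j ⊎ Boundary ω i j ⊎ (¬ Light j × E ω i j) ⊎ Parent i j
      cases i j (p , e) with light? j | st ω i j ≟ˢ open₁ | stays? ω j i
      ... | no ¬l | _ | _ = inj₂ (inj₂ (inj₁ (¬l , e)))
      ... | yes l | no ¬o | _ = inj₂ (inj₁ (p , l , e , ¬o))
      ... | yes l | yes o | yes q = inj₁ ((v , ev) , l , o , q)
      ... | yes l | yes o | no ¬q = inj₂ (inj₂ (inj₂ (p , ¬q)))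
      parents : count₂ parent? ≤ count (C? ω)
      parents = ∑-mono (λ i → ≤-trans (≤-reflexive (trans (∑-cong (λ j → ι-× (C? ω i) (¬? (stays? ω j i)))) (∑-*ˡ (ι (C? ω i)) _)))
        (ι-guard (C? ω i) {n = ι (C? ω i)} (λ p → ≤-trans (ι-unique (λ j → ¬? (stays? ω j i)) (λ j j′ → parent-unique ω p))
          (≤-reflexive (sym (ι-yes (C? ω i) p))))))
      -- Explored vertices have degree at least two, so after discarding one parent edge each there
      -- still remains an edge per explored vertex, which is closable, on the boundary, or ends in a
      -- heavy vertex.
      total : 2 * count (C? ω) ≤ F ω + (X ω + (heavy + count (C? ω)))
      total = begin
        2 * count (C? ω)
          ≡⟨ ∑-*ˡ 2 (λ i → ι (C? ω i)) ⟨
        ∑ (λ i → 2 * ι (C? ω i))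
          ≤⟨ ∑-mono (λ i → ≤-trans (≤-reflexive (*-comm 2 (ι (C? ω i)))) (ι-guard (C? ω i) {n = ι (C? ω i) * D i} (λ p → ≤-trans (proj₁ (C⇒mid ω p)) (≤-reflexive (sym (ι-1 (C? ω i) p (D i))))))) ⟩
        ∑ (λ i → ι (C? ω i) * D i)
          ≡⟨ ∑-cong (λ i → trans (cong (ι (C? ω i) *_) (sym (v i))) (trans (sym (∑-*ˡ (ι (C? ω i)) _)) (∑-cong (λ j → sym (ι-× (C? ω i) (E? ω i j)))))) ⟩
        count₂ (λ i j → C? ω i ×-dec E? ω i j)
          ≤⟨ ∑₂-mono (λ i j → ι-cover₄ (C? ω i ×-dec E? ω i j) (before ω i j) (boundary? ω i j) (¬? (light? j) ×-dec E? ω i j) (parent? i j) (cases i j)) ⟩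
        ∑₂ (λ i j → ι (before ω i j) + (ι (boundary? ω i j) + (ι (¬? (light? j) ×-dec E? ω i j) + ι (parent? i j))))
          ≡⟨ trans (∑₂-+ (λ i j → ι (before ω i j)) _) (cong (F ω +_) (trans (∑₂-+ (λ i j → ι (boundary? ω i j)) _) (cong (X ω +_)
               (trans (∑₂-+ (λ i j → ι (¬? (light? j) ×-dec E? ω i j)) _) (cong (_+ count₂ parent?) (heavy-ends v)))))) ⟩
        F ω + (X ω + (heavy + count₂ parent?))
          ≤⟨ +-monoʳ-≤ (F ω) (+-monoʳ-≤ (X ω) (+-monoʳ-≤ heavy parents)) ⟩
        F ω + (X ω + (heavy + count (C? ω))) ∎
      core : e ≤ 2 * F ω
      core = *-cancelˡ-≤ 2 (by-slack 0 (+-mono-≤ (*-monoʳ-≤ 4 total) (+-mono-≤ (*-monoʳ-≤ 4 (<⇒≤ big)) (+-mono-≤ (≤-trans (*-monoˡ-≤ (X ω) g≥4) thin) few-heavy)))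
        (shape e (F ω) (X ω) heavy (count (C? ω))))
        where
        shape : ∀ e f x h m → 2 * e + 0 + (4 * (f + (x + (h + m))) + (4 * m + (e + e))) ≡ 2 * (2 * f) + (4 * (2 * m) + (4 * e + (4 * x + 4 * h)))
        shape = solve-∀

  -- Joining two boundary half-edges in different components by a second-round edge makes a bridge,
  -- and there are at most 2N bridges of that kind.
  separate-boundary : ∀ e k g b → 1 ≤ g → 2 * g * (c * b + (c * c + (c* + c* * c*))) ≤ e → 1 ≤ e →
    k * (4 * g * g * Q ^ 4 * N * (d * n)) ≤ e * e →
    k * μ (λ ω → (L ω ≤? b) ×-dec (e <? g * X ω)) ≤ Z
  separate-boundary e k g b g≥1 bad-small e≥1 few-seeds = *-cancelˡ-≤ (e * e) {{>-nonZero (1≤* {e} e≥1 e≥1)}} (begin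
    e * e * (k * μ ev?)                                 ≡⟨ swap-* (e * e) k (μ ev?) ⟩
    k * (e * e * μ ev?)                                 ≤⟨ *-monoʳ-≤ k (double-count ev? (e * e) (2 * g * g) (2 * N * (d * n)) (Q ^ 4) F≤G lower upper) ⟩
    k * (2 * g * g * (Q ^ 4 * (2 * N * (d * n) * Z)))   ≡⟨ shape₁ k g (Q ^ 4) N (d * n) Z ⟩
    k * (4 * g * g * Q ^ 4 * N * (d * n)) * Z           ≤⟨ *-monoˡ-≤ Z few-seeds ⟩
    e * e * Z                                           ∎)
    where
    open ≤-Reasoning
    shape₁ : ∀ k g q n x z → k * (2 * g * g * (q * (2 * n * x * z))) ≡ k * (4 * g * g * q * n * x) * z
    shape₁ = solve-∀
    Ev : State → Set
    Ev ω = L ω ≤ b × e < g * X ω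
    ev? : ∀ ω → Dec (Ev ω)
    ev? ω = (L ω ≤? b) ×-dec (e <? g * X ω)
    Linked : State → Fin n → Fin n → Set
    Linked ω v v′ = C ω v × C ω v′ × st ω v v′ ≡ open₂
    linked? : ∀ ω v v′ → Dec (Linked ω v v′)
    linked? ω v v′ = C? ω v ×-dec C? ω v′ ×-dec (st ω v v′ ≟ˢ open₂)
    Good : State → (v v′ u u′ : Fin n) → Set
    Good ω v v′ u u′ = (Boundary ω v u × Boundary ω v′ u′) × ¬ Star (O ω) v v′ × ¬ E ω v v′ × u ≢ u′ × ¬ E ω u u′
    good? : ∀ ω v v′ u u′ → Dec (Good ω v v′ u u′)
    good? ω v v′ u u′ = (boundary? ω v u ×-dec boundary? ω v′ u′) ×-dec ¬? (conn? ω v v′) ×-dec ¬? (E? ω v v′) ×-dec ¬? (u Fin.≟ u′) ×-dec ¬? (E? ω u u′)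
    before : ∀ ω v v′ u u′ → Dec ((Valid D ω × Ev ω) × Good ω v v′ u u′)
    before ω v v′ u u′ = (Valid? D ω ×-dec ev? ω) ×-dec good? ω v v′ u u′
    F G : State → ℕ
    F ω = ∑₂ (λ v v′ → ∑₂ (λ u u′ → ι (before ω v v′ u u′)))
    G ω = ∑₂ (λ v v′ → ∑₂ (λ u u′ → ι (Valid? D ω) * (ι (bridge? ω v v′ ×-dec linked? ω v v′) * ι (E? ω u u′))))
    step : ∀ v v′ u u′ ω → ι (before ω v v′ u u′) ≤
      ι (Valid? D (switch ω v u v′ u′ open₂)) * (ι (bridge? (switch ω v u v′ u′ open₂) v v′ ×-dec linked? (switch ω v u v′ u′ open₂) v v′) * ι (E? (switch ω v u v′ u′ open₂) u u′))
    step v v′ u u′ ω = ι-guard₁ (before ω v v′ u u′) λ ((val , _) , ((cv , _ , vu , vu≢) , (cv′ , _ , vu′ , vu′≢)) , ¬conn , ¬vv′ , u≢u′ , ¬uu′) →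
      let sw : Switchable ω v u v′ u′
          sw = record { ab = vu ; cd = vu′ ; ¬ac = ¬vv′ ; ¬bd = ¬uu′ ; a≢c = λ { refl → ¬conn ε } ; b≢d = u≢u′ }
          ω′ = switch ω v u v′ u′ open₂
          vv′ = Switch.st-ac sw open₂ Same-refl
          -- The two edges removed are not `open₁`, and the two pairs overwritten were not edges, so
          -- no first-round edge is lost.
          keep : ∀ {x} → C ω x → C ω′ x
          keep (s , s₀ , p) = s , s₀ , Star.map (λ {i} {j} → same sw vu≢ vu′≢ ¬vv′ ¬uu′ i j) p
      in ≤-reflexive (sym (trans (ι-1 (Valid? D ω′) (Switch.valid sw open₂ tt val) _)
           (trans (ι-1 (bridge? ω′ v v′ ×-dec linked? ω′ v v′)
             ((st≡⇒O ω′ vv′ tt , λ p → ¬conn (Star.map (λ {i} {j} → old sw i j) p)) , keep cv , keep cv′ , vv′) _)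
             (ι-yes (E? ω′ u u′) (st≡⇒E ω′ (Switch.st-bd sw open₂ Same-refl) tt)))))
      where
      old : (sw : Switchable ω v u v′ u′) → ∀ i j → (O (switch ω v u v′ u′ open₂) ∖⟨ v , v′ ⟩) i j → O ω i j
      old sw i j (o , ne) with Switch.st-cases sw open₂ i j
      ... | inj₁ (s , _) = contradiction s ne
      ... | inj₂ (inj₁ (_ , eq)) with () ← subst (T ∘ isOpen) eq o
      ... | inj₂ (inj₂ (inj₁ (_ , eq))) with () ← subst (T ∘ isOpen) eq o
      ... | inj₂ (inj₂ (inj₂ eq)) = subst (T ∘ isOpen) eq o
      same : (sw : Switchable ω v u v′ u′) → st ω v u ≢ open₁ → st ω v′ u′ ≢ open₁ → ¬ E ω v v′ → ¬ E ω u u′ →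
        ∀ i j → H₁ ω i j → H₁ (switch ω v u v′ u′ open₂) i j
      same sw vu≢ vu′≢ ¬vv′ ¬uu′ i j (eq , m) with Switch.st-cases sw open₂ i j
      ... | inj₁ (s , _) = contradiction (st≡⇒E ω (trans (sym (st-Same ω s)) eq) tt) ¬vv′
      ... | inj₂ (inj₁ (s , _)) = contradiction (st≡⇒E ω (trans (sym (st-Same ω s)) eq) tt) ¬uu′
      ... | inj₂ (inj₂ (inj₁ (inj₁ s , _))) = contradiction (trans (sym (st-Same ω s)) eq) vu≢
      ... | inj₂ (inj₂ (inj₁ (inj₂ s , _))) = contradiction (trans (sym (st-Same ω s)) eq) vu′≢
      ... | inj₂ (inj₂ (inj₂ e′)) = trans e′ eq , m
    F≤G : ∫ F ≤ Q ^ 4 * ∫ G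
    F≤G = ∫-∑₂-≤ (Q ^ 4) (λ v v′ → ∫-∑₂-≤ (Q ^ 4) (λ u u′ → via-switch v u v′ u′ open₂ (step v v′ u u′)))
    -- The classes are the first-round components of the seeds. A linking edge is `open₂`, so they
    -- remain connected when it is deleted, and each seed is charged once.
    bridges : ∀ ω → count₂ (λ v v′ → bridge? ω v v′ ×-dec linked? ω v v′) ≤ 2 * N
    bridges ω = ≤-trans (≤-reflexive (∑₂-cong (λ v v′ → sym (*-identityʳ _))))
      (bridges-≤ (O? ω) (O-sym ω) {S = λ s x → S₀ s × Star (H₁ ω) s x} (linked? ω) (λ s x → S₀? s ×-dec conn₁? ω s x)
        (λ _ _ → 1) (λ s → ι (S₀? s))
        (λ {a} {b} (p , q , e) → q , p , trans (st-sym ω b a) e)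
        (λ {s} {x} {y} {a} {b′} (_ , p) (_ , q) (_ , _ , e) → Star.map (λ h → H₁⇒O ω h , λ sm → open₂≢open₁ (trans (sym e) (trans (sym (st-Same ω sm)) (proj₁ h))))
          (Star-sym (H₁-sym ω) p ◅◅ q))
        (λ (_ , (s , s₀ , p) , _) → s , (s₀ , p) , ≤-reflexive (sym (ι-yes (S₀? s) s₀)))
        (λ _ _ → refl))
      where
      open₂≢open₁ : open₂ ≢ open₁
      open₂≢open₁ ()
    upper : ∀ ω → G ω ≤ 2 * N * (d * n) * ι (Valid? D ω)
    upper ω = begin
      G ω
        ≡⟨ trans (∑₂-cong (λ v v′ → trans (∑₂-*ˡ (ι (Valid? D ω)) _) (cong (ι (Valid? D ω) *_) (∑₂-*ˡ (ι (bridge? ω v v′ ×-dec linked? ω v v′)) _))))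
             (trans (∑₂-*ˡ (ι (Valid? D ω)) _) (cong (ι (Valid? D ω) *_) (∑₂-*ʳ (count₂ (E? ω)) _))) ⟩
      ι (Valid? D ω) * (count₂ (λ v v′ → bridge? ω v v′ ×-dec linked? ω v v′) * count₂ (E? ω))
        ≤⟨ ι-guard (Valid? D ω) (λ v → ≤-trans (*-mono-≤ (bridges ω) (≤-trans (≤-reflexive (∑-cong v)) ∑D≤))
             (≤-reflexive (sym (trans (cong (2 * N * (d * n) *_) (ι-yes (Valid? D ω) v)) (*-identityʳ _))))) ⟩
      2 * N * (d * n) * ι (Valid? D ω) ∎
    lower : ∀ ω → Valid D ω → Ev ω → e * e ≤ 2 * g * g * F ω
    lower ω v ev@(small , big) = begin
      e * e                          ≤⟨ *-mono-≤ (<⇒≤ big) (<⇒≤ big) ⟩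
      g * X ω * (g * X ω)            ≡⟨ shape₂ g (X ω) ⟩
      g * g * (X ω * X ω)            ≤⟨ *-monoʳ-≤ (g * g) core ⟩
      g * g * (2 * F ω)              ≡⟨ shape₃ g (F ω) ⟩
      2 * g * g * F ω                ∎
      where
      shape₂ : ∀ g x → g * x * (g * x) ≡ g * g * (x * x)
      shape₂ = solve-∀
      shape₃ : ∀ g f → g * g * (2 * f) ≡ 2 * g * g * f
      shape₃ = solve-∀
      B = c * b + (c * c + (c* + c* * c*))
      -- Each obstruction is recorded together with an end of `v′u′` of bounded degree: the mid
      -- vertex `v′` if it concerns `v′`, the light vertex `u′` if it concerns `u′`.
      Blocked : (v u v′ u′ : Fin n) → Set
      Blocked v u v′ u′ = ((Star (O ω) v v′ ⊎ E ω v v′) × Mid v′ × E ω v′ u′) ⊎ ((u ≡ u′ ⊎ E ω u u′) × Light u′ × E ω v′ u′)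
      blockedˡ? : ∀ v v′ u′ → Dec _
      blockedˡ? v v′ u′ = (conn? ω v v′ ⊎-dec E? ω v v′) ×-dec mid? v′ ×-dec E? ω v′ u′
      blockedʳ? : ∀ u v′ u′ → Dec _
      blockedʳ? u v′ u′ = (u Fin.≟ u′ ⊎-dec E? ω u u′) ×-dec light? u′ ×-dec E? ω v′ u′
      blocked? : ∀ v u v′ u′ → Dec (Blocked v u v′ u′)
      blocked? v u v′ u′ = blockedˡ? v v′ u′ ⊎-dec blockedʳ? u v′ u′
      blocked-≤ : ∀ v u → Mid v → Light u → ∑₂ (λ v′ u′ → ι (blocked? v u v′ u′)) ≤ B
      blocked-≤ v₁ u mv lu = begin
        ∑₂ (λ v′ u′ → ι (blocked? v₁ u v′ u′))
          ≤⟨ ∑₂-mono-+ (λ v′ u′ → ι-⊎ (blockedˡ? v₁ v′ u′) (blockedʳ? u v′ u′)) ⟩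
        ∑₂ (λ v′ u′ → ι (blockedˡ? v₁ v′ u′)) + ∑₂ (λ v′ u′ → ι (blockedʳ? u v′ u′))
          ≤⟨ +-mono-≤ left right ⟩
        (b + c) * c + (1 + c*) * c*
          ≡⟨ shape b c c* ⟩
        B ∎
        where
        shape : ∀ b c x → (b + c) * c + (1 + x) * x ≡ c * b + (c * c + (x + x * x))
        shape = solve-∀
        left : ∑₂ (λ v′ u′ → ι (blockedˡ? v₁ v′ u′)) ≤ (b + c) * c
        left = begin
          ∑₂ (λ v′ u′ → ι (blockedˡ? v₁ v′ u′))
            ≡⟨ ∑-cong (λ v′ → trans (∑-cong (λ u′ → ι-×₃ (conn? ω v₁ v′ ⊎-dec E? ω v₁ v′) (mid? v′) (E? ω v′ u′)))
                 (trans (∑-*ˡ (ι (conn? ω v₁ v′ ⊎-dec E? ω v₁ v′)) _) (cong (ι (conn? ω v₁ v′ ⊎-dec E? ω v₁ v′) *_) (trans (∑-*ˡ (ι (mid? v′)) _) (cong (ι (mid? v′) *_) (v v′)))))) ⟩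
          ∑ (λ v′ → ι (conn? ω v₁ v′ ⊎-dec E? ω v₁ v′) * (ι (mid? v′) * D v′))
            ≤⟨ ∑-mono-*ʳ c (λ v′ → *-mono-≤ (ι-⊎ (conn? ω v₁ v′) (E? ω v₁ v′)) (ι-guard (mid? v′) mid⇒D≤c)) ⟩
          ∑ (λ v′ → ι (conn? ω v₁ v′) + ι (E? ω v₁ v′)) * c
            ≡⟨ cong (_* c) (∑-+ (λ v′ → ι (conn? ω v₁ v′)) _) ⟩
          (count (conn? ω v₁) + count (E? ω v₁)) * c
            ≤⟨ *-monoˡ-≤ c (+-mono-≤ (≤-trans (component≤L ω (O? ω) id v₁) small) (≤-trans (≤-reflexive (v v₁)) (mid⇒D≤c mv))) ⟩
          (b + c) * c ∎
        right : ∑₂ (λ v′ u′ → ι (blockedʳ? u v′ u′)) ≤ (1 + c*) * c*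
        right = begin
          ∑₂ (λ v′ u′ → ι (blockedʳ? u v′ u′))
            ≡⟨ ∑-swap (λ v′ u′ → ι (blockedʳ? u v′ u′)) ⟩
          ∑₂ (λ u′ v′ → ι (blockedʳ? u v′ u′))
            ≡⟨ ∑-cong (λ u′ → trans (∑-cong (λ v′ → ι-×₃ (u Fin.≟ u′ ⊎-dec E? ω u u′) (light? u′) (E? ω v′ u′)))
                 (trans (∑-*ˡ (ι (u Fin.≟ u′ ⊎-dec E? ω u u′)) _) (cong (ι (u Fin.≟ u′ ⊎-dec E? ω u u′) *_) (trans (∑-*ˡ (ι (light? u′)) _) (cong (ι (light? u′) *_) (degree-count′ v u′)))))) ⟩
          ∑ (λ u′ → ι (u Fin.≟ u′ ⊎-dec E? ω u u′) * (ι (light? u′) * D u′))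
            ≤⟨ ∑-mono-*ʳ c* (λ u′ → *-mono-≤ (ι-⊎ (u Fin.≟ u′) (E? ω u u′)) (ι-guard (light? u′) <⇒≤)) ⟩
          ∑ (λ u′ → ι (u Fin.≟ u′) + ι (E? ω u u′)) * c*
            ≡⟨ cong (_* c*) (∑-+ (λ u′ → ι (u Fin.≟ u′)) _) ⟩
          (count (u Fin.≟_) + count (E? ω u)) * c*
            ≤⟨ *-monoˡ-≤ c* (+-mono-≤ (count-≡ u) (≤-trans (≤-reflexive (v u)) (<⇒≤ lu))) ⟩
          (1 + c*) * c* ∎
      total : X ω * X ω ≤ F ω + X ω * B
      total = begin
        X ω * X ω
          ≡⟨ ∑₂-exchange (λ v u → ι (boundary? ω v u)) (λ v u → ι (boundary? ω v u)) ⟨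
        ∑₂ (λ v v′ → ∑₂ (λ u u′ → ι (boundary? ω v u) * ι (boundary? ω v′ u′)))
          ≤⟨ ∑₂-mono-+ (λ v v′ → ∑₂-mono-+ (λ u u′ → pointwise v u v′ u′)) ⟩
        F ω + ∑₂ (λ v v′ → ∑₂ (λ u u′ → ι (boundary? ω v u) * ι (blocked? v u v′ u′)))
          ≡⟨ cong (F ω +_) (∑-cong (λ v → ∑-swap (λ v′ u → ∑ (λ u′ → ι (boundary? ω v u) * ι (blocked? v u v′ u′))))) ⟩
        F ω + ∑₂ (λ v u → ∑₂ (λ v′ u′ → ι (boundary? ω v u) * ι (blocked? v u v′ u′)))
          ≤⟨ +-monoʳ-≤ (F ω) (∑₂-mono-*ʳ B (λ v u → ≤-trans (≤-reflexive (∑₂-*ˡ (ι (boundary? ω v u)) _))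
               (ι-guard (boundary? ω v u) {n = ι (boundary? ω v u) * B} (λ p → ≤-trans (blocked-≤ v u (C⇒mid ω (proj₁ p)) (proj₁ (proj₂ p))) (≤-reflexive (sym (ι-1 (boundary? ω v u) p B))))))) ⟩
        F ω + X ω * B ∎
        where
        pointwise : ∀ v u v′ u′ → ι (boundary? ω v u) * ι (boundary? ω v′ u′) ≤ ι (before ω v v′ u u′) + ι (boundary? ω v u) * ι (blocked? v u v′ u′)
        pointwise v₁ u v′ u′ = subst₂ _≤_ (ι-× (boundary? ω v₁ u) (boundary? ω v′ u′))
          (cong (ι (before ω v₁ v′ u u′) +_) (ι-× (boundary? ω v₁ u) (blocked? v₁ u v′ u′)))
          (ι-cover (boundary? ω v₁ u ×-dec boundary? ω v′ u′) (before ω v₁ v′ u u′) (boundary? ω v₁ u ×-dec blocked? v₁ u v′ u′) cases)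
          where
          cases : Boundary ω v₁ u × Boundary ω v′ u′ → ((Valid D ω × Ev ω) × Good ω v₁ v′ u u′) ⊎ (Boundary ω v₁ u × Blocked v₁ u v′ u′)
          cases (p , q@(cv′ , lu′ , e′ , _)) with conn? ω v₁ v′ | E? ω v₁ v′ | u Fin.≟ u′ | E? ω u u′
          ... | yes r | _ | _ | _ = inj₂ (p , inj₁ (inj₁ r , C⇒mid ω cv′ , e′))
          ... | no _ | yes r | _ | _ = inj₂ (p , inj₁ (inj₂ r , C⇒mid ω cv′ , e′))
          ... | no _ | no _ | yes r | _ = inj₂ (p , inj₂ (inj₁ r , lu′ , e′))
          ... | no _ | no _ | no _ | yes r = inj₂ (p , inj₂ (inj₂ r , lu′ , e′))
          ... | no r₁ | no r₂ | no r₃ | no r₄ = inj₁ ((v , ev) , (p , q) , r₁ , r₂ , r₃ , r₄)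
      2B≤X : 2 * B ≤ X ω
      2B≤X = *-cancelˡ-≤ g {{>-nonZero g≥1}} (≤-trans (≤-reflexive (shape g B)) (≤-trans bad-small (<⇒≤ big)))
        where
        shape : ∀ g b → g * (2 * b) ≡ 2 * g * b
        shape = solve-∀
      core : X ω * X ω ≤ 2 * F ω
      core = by-slack 0 (+-mono-≤ (*-monoʳ-≤ 2 total) (*-monoʳ-≤ (X ω) 2B≤X)) (shape (X ω) (F ω) B)
        where
        shape : ∀ x f b → x * x + 0 + (2 * (f + x * b) + x * x) ≡ 2 * f + (2 * (x * x) + x * (2 * b))
        shape = solve-∀

  Q⁵ T₂ : ℕ
  Q⁵ = Q ^ 4 * Q
  T₂ = ∑ (λ x → ι (mid? x) * (D x * D x))

  Q⁵≥1 : 1 ≤ Q⁵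
  Q⁵≥1 = 1≤* {Q ^ 4} (m^n>0 Q {{>-nonZero Q≥1}} 4) Q≥1

  -- At an unexplored vertex `x`, the half-edge to `y` is spent on joining `x` to `v`, and the
  -- half-edge to `z` becomes the new boundary. Pairs of half-edges at mid vertices number `T₂`, so
  -- this is where the sum of squares in A₂ enters.
  Sprout : State → (x z v u y : Fin n) → Set
  Sprout ω x z v u y = Boundary ω v u × (Mid x × E ω x y × E ω x z) × ¬ C ω x × Light z × y ≢ z × ¬ E ω v x × u ≢ y × ¬ E ω u y

  sprout? : ∀ ω x z v u y → Dec (Sprout ω x z v u y)
  sprout? ω x z v u y = boundary? ω v u ×-dec (mid? x ×-dec E? ω x y ×-dec E? ω x z) ×-dec ¬? (C? ω x) ×-dec light? z ×-dec
    ¬? (y Fin.≟ z) ×-dec ¬? (E? ω v x) ×-dec ¬? (u Fin.≟ y) ×-dec ¬? (E? ω u y)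

  parent? : ∀ ω v x → Dec (¬ (∃[ s ] S₀ s × Star (H₁ ω ∖⟨ v , x ⟩) s x))
  parent? ω v x = ¬? (stays? ω v x)

  -- The switch attaches x to v, and closing xz gives x a boundary half-edge of its own.
  attach : State → (x z v u y : Fin n) → State
  attach ω x z v u y = update (switch ω v u x y open₁) x z closed

  module Attach {ω : State} {x z v u y : Fin n} (sp : Sprout ω x z v u y) where
    bd = proj₁ sp
    cv = proj₁ bd
    vu = proj₁ (proj₂ (proj₂ bd))
    vu≢ = proj₂ (proj₂ (proj₂ bd))
    mx = proj₁ (proj₁ (proj₂ sp))
    xy = proj₁ (proj₂ (proj₁ (proj₂ sp)))
    xz = proj₂ (proj₂ (proj₁ (proj₂ sp)))
    ¬cx = proj₁ (proj₂ (proj₂ sp))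
    lz = proj₁ (proj₂ (proj₂ (proj₂ sp)))
    y≢z = proj₁ (proj₂ (proj₂ (proj₂ (proj₂ sp))))
    ¬vx = proj₁ (proj₂ (proj₂ (proj₂ (proj₂ (proj₂ sp)))))
    u≢y = proj₁ (proj₂ (proj₂ (proj₂ (proj₂ (proj₂ (proj₂ sp))))))
    ¬uy = proj₂ (proj₂ (proj₂ (proj₂ (proj₂ (proj₂ (proj₂ sp))))))

    v≢x : v ≢ x
    v≢x refl = ¬cx cv

    z≢v : z ≢ v
    z≢v refl = ¬vx (E-sym ω xz)

    x≢z : x ≢ z
    x≢z = E-irrefl ω xz

    sw : Switchable ω v u x y
    sw = record { ab = vu ; cd = xy ; ¬ac = ¬vx ; ¬bd = ¬uy ; a≢c = v≢x ; b≢d = u≢y }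

    ω₁ ω′ : State
    ω₁ = switch ω v u x y open₁
    ω′ = attach ω x z v u y

    st-xz₁ : st ω₁ x z ≡ st ω x z
    st-xz₁ = Switch.st-rest sw open₁
      (λ { (inj₁ (p , _)) → v≢x p ; (inj₂ (p , _)) → z≢v (sym p) })
      (λ { (inj₁ (_ , p)) → y≢z p ; (inj₂ (p , _)) → x≢z p })
      (λ { (inj₁ (p , _)) → v≢x p ; (inj₂ (p , _)) → z≢v (sym p) })
      (λ s → ¬uy (Switch.E-Same sw xz (Same-sym s)))

    valid′ : Valid D ω → Valid D ω′
    valid′ val = Valid-update ω₁ closed (subst (T ∘ isEdge) (sym st-xz₁) xz) tt (Switch.valid sw open₁ tt val)

    st-xz : ∀ {i j} → Same x z i j → st ω′ i j ≡ closed
    st-xz = st-update ω₁ closed x≢z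

    xz≠vx : ¬ Same x z v x
    xz≠vx (inj₁ (p , _)) = v≢x (sym p)
    xz≠vx (inj₂ (_ , p)) = z≢v p

    st-vx : st ω′ v x ≡ open₁
    st-vx = trans (st-other ω₁ closed xz≠vx) (Switch.st-ac sw open₁ Same-refl)

    uy′ : E ω′ u y
    uy′ with Same? x z u y
    ... | yes s = st≡⇒E ω′ (st-xz s) tt
    ... | no ¬s = st≡⇒E ω′ (trans (st-other ω₁ closed ¬s) (Switch.st-bd sw open₁ Same-refl)) tt

    H₁′⇒ : ∀ {i j} → H₁ ω′ i j → H₁ ω i j ⊎ Same v x i j
    H₁′⇒ {i} {j} (eq , m) with Same? x z i j
    ... | yes s with () ← trans (sym (st-xz s)) eq
    ... | no ¬s with Switch.st-cases sw open₁ i j | trans (sym (st-other ω₁ closed ¬s)) eq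
    ...   | inj₁ (s , _) | _ = inj₂ s
    ...   | inj₂ (inj₁ (_ , e)) | eq′ with () ← trans (sym e) eq′
    ...   | inj₂ (inj₂ (inj₁ (_ , e))) | eq′ with () ← trans (sym e) eq′
    ...   | inj₂ (inj₂ (inj₂ e)) | eq′ = inj₁ (trans (sym e) eq′ , m)

    -- Of the slots that the move resets, all contain `x` except `vu`, which is not first-round, and
    -- `uy`, which is not an edge.
    H₁⇒′ : ∀ {i j} → i ≢ x → j ≢ x → H₁ ω i j → H₁ ω′ i j
    H₁⇒′ {i} {j} i≢x j≢x (eq , m) = trans (st-other ω₁ closed (avoid z)) (trans (Switch.st-rest sw open₁
        (λ s → vu≢ (trans (sym (st-Same ω s)) eq)) (avoid y)
        (λ { (inj₁ (_ , p)) → j≢x (sym p) ; (inj₂ (_ , p)) → i≢x (sym p) })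
        (λ s → ¬uy (st≡⇒E ω (trans (sym (st-Same ω s)) eq) tt))) eq) , m
      where
      avoid : ∀ t → ¬ Same x t i j
      avoid t (inj₁ (p , _)) = i≢x (sym p)
      avoid t (inj₂ (p , _)) = j≢x (sym p)

    C⇒≢x : ∀ {i} → C ω i → i ≢ x
    C⇒≢x ci refl = ¬cx ci

    C⇒′ : ∀ {i j} → C ω i → Star (H₁ ω) i j → Star (H₁ ω′) i j
    C⇒′ ci ε = ε
    C⇒′ ci (h ◅ p) = let cj = C-extend ci (h ◅ ε) in H₁⇒′ (C⇒≢x ci) (C⇒≢x cj) h ◅ C⇒′ cj p

    cx′ : C ω′ x
    cx′ with cv
    ... | s , s₀ , p = s , s₀ , C⇒′ (S₀⇒C ω s₀) p ◅◅ ((st-vx , C⇒mid ω cv , mx) ◅ ε)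

    boundary′ : Boundary ω′ x z
    boundary′ = cx′ , lz , st≡⇒E ω′ (st-xz Same-refl) tt , λ q → closed≢open₁ (trans (sym (st-xz Same-refl)) q)
      where
      closed≢open₁ : closed ≢ open₁
      closed≢open₁ ()

    -- Without `vx` the new first-round graph lies inside the old one, where `x` is unexplored. So
    -- `v` can be read off afterwards as the parent of `x`.
    separated : ¬ (∃[ s ] S₀ s × Star (H₁ ω′ ∖⟨ v , x ⟩) s x)
    separated (s , s₀ , p) = ¬cx (s , s₀ , Star.map (λ (h , ne) → [ id , (λ q → contradiction q ne) ]′ (H₁′⇒ h)) p)

    conn′⇒ : ∀ {i j} → Star (H₁ ω′) i j → Star (H₁ ω) i j ⊎ Star (H₁ ω) v j ⊎ Star (H₁ ω) x j
    conn′⇒ = add-edge H₁′⇒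

    -- The one new first-round edge `vx` lets a component absorb those of `v` and `x`, hence the
    -- factor 3; the explored set gains at most the component of `x`.
    small′ : ∀ {e b} → Small e b ω → Small e (3 * b) ω′
    small′ {e} {b} (comps , total) = comps′ , total′
      where
      comps′ : ∀ i → count (conn₁? ω′ i) ≤ 3 * b
      comps′ i = ≤-trans (∑-mono (λ j → ι-cover₃ (conn₁? ω′ i j) (conn₁? ω i j) (conn₁? ω v j) (conn₁? ω x j) conn′⇒))
        (≤-trans (≤-reflexive (trans (∑-+ (λ j → ι (conn₁? ω i j)) _) (cong (count (conn₁? ω i) +_) (∑-+ (λ j → ι (conn₁? ω v j)) _))))
        (≤-trans (+-mono-≤ (comps i) (+-mono-≤ (comps v) (comps x))) (≤-reflexive (cong (λ t → b + (b + t)) (sym (+-identityʳ b))))))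
      total′ : count (C? ω′) ≤ e + 3 * b
      total′ = ≤-trans (∑-mono-+ (λ j → ι-cover (C? ω′ j) (C? ω j) (conn₁? ω x j) cases))
        (by-slack b (+-mono-≤ total (comps x)) (shape (count (C? ω)) (count (conn₁? ω x)) e b))
        where
        cases : ∀ {j} → C ω′ j → C ω j ⊎ Star (H₁ ω) x j
        cases (s , s₀ , p) with conn′⇒ p
        ... | inj₁ q = inj₁ (s , s₀ , q)
        ... | inj₂ (inj₁ q) = inj₁ (C-extend cv q)
        ... | inj₂ (inj₂ q) = inj₂ q
        shape : ∀ m l e b → m + l + b + (e + b + b) ≡ e + 3 * b + (m + l)
        shape = solve-∀

  -- A boundary edge sprouts in at least `2 * Q⁵ * d * n` ways. Conversely, given the new boundary
  -- edge `xz`, the vertex `v` is the parent of `x` and only the edge `uy` is free, which leaves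
  -- `d * n` ways, at cost `Q⁵` for five resets. The quotient is the factor 2.
  growth : ∀ e b → 1 ≤ d * n → c * (c * (e + b)) ≤ n → c * heavy ≤ n → c * (c * c + (c* + c* * c*)) ≤ n →
    (2 * Q⁵ * d + d + 4) * n ≤ T₂ → 2 * Φ e b ≤ Φ e (3 * b)
  growth e b dn≥1 small few-heavy const dense = *-cancelˡ-≤ (Q⁵ * (d * n)) {{>-nonZero (1≤* {Q⁵} Q⁵≥1 dn≥1)}} (begin
    Q⁵ * (d * n) * (2 * Φ e b)                      ≡⟨ shape₁ Q⁵ d n (Φ e b) ⟩
    2 * Q⁵ * d * n * Φ e b                          ≡⟨ ∫-* (2 * Q⁵ * d * n) _ ⟨
    ∫ (λ ω → 2 * Q⁵ * d * n * (ι (vsmall? e b ω) * X ω))  ≤⟨ ∫-mono (λ ω → ≤-trans (≤-reflexive (swap-* (2 * Q⁵ * d * n) (ι (vsmall? e b ω)) (X ω)))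
                                                         (ι-guard (vsmall? e b ω) (λ (v , sm) → lower ω v sm))) ⟩
    ∫ F                                             ≤⟨ F≤G ⟩
    Q⁵ * ∫ G                                        ≤⟨ *-monoʳ-≤ Q⁵ (∫-mono upper) ⟩
    Q⁵ * ∫ (λ ω → d * n * (ι (vsmall? e (3 * b) ω) * X ω))  ≡⟨ cong (Q⁵ *_) (∫-* (d * n) _) ⟩
    Q⁵ * (d * n * Φ e (3 * b))                      ≡⟨ *-assoc Q⁵ (d * n) _ ⟨
    Q⁵ * (d * n) * Φ e (3 * b)                      ∎)
    where
    open ≤-Reasoning
    shape₁ : ∀ q d n x → q * (d * n) * (2 * x) ≡ 2 * q * d * n * x
    shape₁ = solve-∀
    before : ∀ ω x z v u y → Dec ((Valid D ω × Small e b ω) × Sprout ω x z v u y)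
    before ω x z v u y = vsmall? e b ω ×-dec sprout? ω x z v u y
    F G : State → ℕ
    F ω = ∑₂ (λ x z → ∑ (λ v → ∑₂ (λ u y → ι (before ω x z v u y))))
    G ω = ∑₂ (λ x z → ∑ (λ v → ∑₂ (λ u y → ι (vsmall? e (3 * b) ω) * (ι (boundary? ω x z) * (ι (parent? ω v x) * ι (E? ω u y))))))
    step : ∀ x z v u y ω → ι (before ω x z v u y) ≤
      ι (vsmall? e (3 * b) (attach ω x z v u y)) * (ι (boundary? (attach ω x z v u y) x z) * (ι (parent? (attach ω x z v u y) v x) * ι (E? (attach ω x z v u y) u y)))
    step x z v u y ω = ι-guard₁ (before ω x z v u y) λ ((val , sm) , sp) →
      let open Attach {ω} {x} {z} {v} {u} {y} sp
      in ≤-reflexive (sym (trans (ι-1 (vsmall? e (3 * b) ω′) (valid′ val , small′ sm) _) (trans (ι-1 (boundary? ω′ x z) boundary′ _)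
           (trans (ι-1 (parent? ω′ v x) separated _) (ι-yes (E? ω′ u y) uy′)))))
    F≤G : ∫ F ≤ Q⁵ * ∫ G
    F≤G = ∫-∑₂-≤ Q⁵ (λ x z → ∫-∑-≤ Q⁵ (λ v → ∫-∑₂-≤ Q⁵ (λ u y → leaf x z v u y)))
      where
      leaf : ∀ x z v u y → ∫ (λ ω → ι (before ω x z v u y)) ≤ Q⁵ * ∫ (λ ω → ι (vsmall? e (3 * b) ω) * (ι (boundary? ω x z) * (ι (parent? ω v x) * ι (E? ω u y))))
      leaf x z v u y = begin
        ∫ (λ ω → ι (before ω x z v u y))                  ≤⟨ ∫-mono (step x z v u y) ⟩
        ∫ (λ ω → g (attach ω x z v u y))                  ≤⟨ ∫-switch (λ ω → g (update ω x z closed)) v u x y open₁ ⟩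
        Q ^ 4 * ∫ (λ ω → g (update ω x z closed))         ≤⟨ *-monoʳ-≤ (Q ^ 4) (∫-update g x z closed) ⟩
        Q ^ 4 * (Q * ∫ g)                                 ≡⟨ *-assoc (Q ^ 4) Q (∫ g) ⟨
        Q⁵ * ∫ g                                          ∎
        where
        g : State → ℕ
        g ω = ι (vsmall? e (3 * b) ω) * (ι (boundary? ω x z) * (ι (parent? ω v x) * ι (E? ω u y)))
    upper : ∀ ω → G ω ≤ d * n * (ι (vsmall? e (3 * b) ω) * X ω)
    upper ω = begin
      G ω
        ≡⟨ trans (∑₂-cong (λ x z → trans (∑-cong (λ v → trans (∑₂-*ˡ i₀ _) (cong (i₀ *_) (trans (∑₂-*ˡ (ι (boundary? ω x z)) _) (cong (ι (boundary? ω x z) *_) (∑₂-*ˡ (ι (parent? ω v x)) _))))))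
             (trans (∑-*ˡ i₀ _) (cong (i₀ *_) (trans (∑-*ˡ (ι (boundary? ω x z)) _) (cong (ι (boundary? ω x z) *_) (∑-*ʳ (count₂ (E? ω)) _)))))))
             (∑₂-*ˡ i₀ _) ⟩
      i₀ * ∑₂ (λ x z → ι (boundary? ω x z) * (∑ (λ v → ι (parent? ω v x)) * count₂ (E? ω)))
        ≤⟨ ι-guard (vsmall? e (3 * b) ω) {n = i₀ * (X ω * (d * n))} (λ p@(v , _) → ≤-trans (∑₂-mono-*ʳ (d * n) (λ x z →
             ι-guard (boundary? ω x z) {n = ι (boundary? ω x z) * (d * n)} (λ q → ≤-trans
               (*-mono-≤ (ι-unique (λ v → parent? ω v x) (λ v v′ → parent-unique ω (proj₁ q))) (≤-trans (≤-reflexive (∑-cong v)) ∑D≤))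
               (≤-reflexive (trans (*-identityˡ (d * n)) (sym (ι-1 (boundary? ω x z) q (d * n))))))))
             (≤-reflexive (sym (ι-1 (vsmall? e (3 * b) ω) p _)))) ⟩
      i₀ * (X ω * (d * n))
        ≡⟨ shape i₀ (X ω) (d * n) ⟩
      d * n * (i₀ * X ω) ∎
      where
      i₀ = ι (vsmall? e (3 * b) ω)
      shape : ∀ i x m → i * (x * m) ≡ m * (i * x)
      shape = solve-∀
    lower : ∀ ω → Valid D ω → Small e b ω → 2 * Q⁵ * d * n * X ω ≤ F ω
    lower ω v sm = begin
      2 * Q⁵ * d * n * X ω
        ≡⟨ *-comm (2 * Q⁵ * d * n) (X ω) ⟩
      X ω * (2 * Q⁵ * d * n)
        ≡⟨ ∑₂-*ʳ (2 * Q⁵ * d * n) (λ i j → ι (boundary? ω i j)) ⟨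
      ∑₂ (λ i j → ι (boundary? ω i j) * (2 * Q⁵ * d * n))
        ≤⟨ ∑₂-mono (λ i j → ι-guard (boundary? ω i j) (enough i j)) ⟩
      ∑₂ (λ i j → ∑ (λ x → ∑₂ (λ y z → ι (before ω x z i j y))))
        ≡⟨ ∑-reorder (λ x z i j y → ι (before ω x z i j y)) ⟨
      F ω ∎
      where
      -- In `dense`, `d * n` pays for `y ≡ z`. The other `4 * n` pays for heavy `y`, heavy `z`,
      -- explored `x`, and the bounded neighbourhoods of `i` and `j`, with at most `n` for each.
      enough : ∀ i j → Boundary ω i j → 2 * Q⁵ * d * n ≤ ∑ (λ x → ∑₂ (λ y z → ι (before ω x z i j y)))
      enough i j bd@(ci , lj , ij , _) = by-slack 0 (+-mono-≤ dense (+-mono-≤ total (+-mono-≤ few-heavy (+-mono-≤ few-heavy (+-mono-≤ (≤-trans (*-monoʳ-≤ c (*-monoʳ-≤ c (proj₂ sm))) small) const)))))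
          (shape (2 * Q⁵ * d) d n T₂ Y (count (C? ω)) c heavy (c * c + (c* + c* * c*)))
        where
        Y = ∑ (λ x → ∑₂ (λ y z → ι (before ω x z i j y)))
        shape : ∀ q d n t f m c h k → q * n + 0 + (t + (f + (d * n + (c * (c * m + (h + k)) + c * h)) + (n + (n + (n + n))))) ≡
          f + ((q + d + 4) * n + (t + (c * h + (c * h + (c * (c * m) + c * k)))))
        shape = solve-∀
        Near : (x y : Fin n) → Set
        Near x y = C ω x ⊎ ¬ Light y ⊎ E ω i x ⊎ j ≡ y ⊎ (E ω j y × Light y)
        near? : ∀ x y → Dec (Near x y)
        near? x y = C? ω x ⊎-dec ¬? (light? y) ⊎-dec E? ω i x ⊎-dec (j Fin.≟ y) ⊎-dec (E? ω j y ×-dec light? y)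
        cherry? diag? : ∀ x y z → Dec _
        cherry? x y z = mid? x ×-dec (E? ω x y ×-dec E? ω x z)
        diag? x y z = E? ω x y ×-dec (y Fin.≟ z)
        bad? : ∀ x y → Dec (Mid x × E ω x y × Near x y)
        bad? x y = mid? x ×-dec E? ω x y ×-dec near? x y
        heavyEnd? : ∀ x y z → Dec ((¬ Light z × E ω x z) × (Mid x × E ω x y))
        heavyEnd? x y z = (¬? (light? z) ×-dec E? ω x z) ×-dec (mid? x ×-dec E? ω x y)
        cases : ∀ x y z → Mid x × E ω x y × E ω x z → ((Valid D ω × Small e b ω) × Sprout ω x z i j y) ⊎
          (E ω x y × y ≡ z) ⊎ ((Mid x × E ω x y × Near x y) × E ω x z) ⊎ ((¬ Light z × E ω x z) × (Mid x × E ω x y))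
        cases x y z p@(mx , xy , xz) with y Fin.≟ z | light? z | near? x y
        ... | yes q | _ | _ = inj₂ (inj₁ (xy , q))
        ... | no _ | no ¬l | _ = inj₂ (inj₂ (inj₂ ((¬l , xz) , mx , xy)))
        ... | no _ | yes _ | yes q = inj₂ (inj₂ (inj₁ ((mx , xy , q) , xz)))
        ... | no ne | yes l | no ¬q = inj₁ ((v , sm) , bd , p , ¬q ∘ inj₁ , l , ne , ¬q ∘ inj₂ ∘ inj₂ ∘ inj₁ , ¬q ∘ inj₂ ∘ inj₂ ∘ inj₂ ∘ inj₁ ,
          λ jy → ¬q (inj₂ (inj₂ (inj₂ (inj₂ (jy , decidable-stable (light? y) (λ ¬ly → ¬q (inj₂ (inj₁ ¬ly)))))))))
        T₂≡ : T₂ ≡ ∑ (λ x → ∑₂ (λ y z → ι (cherry? x y z)))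
        T₂≡ = ∑-cong (λ x → sym (trans (∑₂-cong (λ y z → ι-×₃ (mid? x) (E? ω x y) (E? ω x z)))
          (trans (∑₂-*ˡ (ι (mid? x)) _) (cong (ι (mid? x) *_) (trans (∑₂-× (λ y → ι (E? ω x y)) (λ z → ι (E? ω x z))) (cong₂ _*_ (v x) (v x)))))))
        mid-bound : ∀ x {P : Set} (P? : Dec (Mid x × P)) → ι P? * D x ≤ c * ι P?
        mid-bound x P? = ι-guard P? (λ p → ≤-trans (mid⇒D≤c (proj₁ p)) (≤-reflexive (sym (trans (cong (c *_) (ι-yes P? p)) (*-identityʳ c)))))
        eq-≤ : ∑ (λ x → ∑₂ (λ y z → ι (diag? x y z))) ≤ d * n
        eq-≤ = ≤-trans (∑-mono (λ x → ≤-trans (∑-mono (λ y → ≤-trans (≤-reflexive (trans (∑-cong (λ z → ι-× (E? ω x y) (y Fin.≟ z))) (∑-*ˡ (ι (E? ω x y)) _)))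
            (≤-trans (*-monoʳ-≤ (ι (E? ω x y)) (count-≡ y)) (≤-reflexive (*-identityʳ _))))) (≤-reflexive (v x)))) ∑D≤
        near-≤ : ∑ (λ x → ∑₂ (λ y z → ι (bad? x y ×-dec E? ω x z))) ≤ c * count₂ bad?
        near-≤ = ≤-trans (∑₂-mono (λ x y → ≤-trans (≤-reflexive (trans (∑-cong (λ z → ι-× (bad? x y) (E? ω x z))) (trans (∑-*ˡ (ι (bad? x y)) _) (cong (ι (bad? x y) *_) (v x)))))
          (mid-bound x (bad? x y)))) (≤-reflexive (∑₂-*ˡ c (λ x y → ι (bad? x y))))
        heavyEnd-≤ : ∑ (λ x → ∑₂ (λ y z → ι (heavyEnd? x y z))) ≤ c * heavy
        heavyEnd-≤ = ≤-trans (∑-mono (λ x → ≤-trans (≤-reflexive (∑-swap (λ y z → ι (heavyEnd? x y z)))) (∑-mono (λ z →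
            ≤-trans (≤-reflexive (trans (∑-cong (λ y → ι-×₃ (¬? (light? z) ×-dec E? ω x z) (mid? x) (E? ω x y)))
              (trans (∑-*ˡ (ι (¬? (light? z) ×-dec E? ω x z)) _) (cong (ι (¬? (light? z) ×-dec E? ω x z) *_) (trans (∑-*ˡ (ι (mid? x)) _) (cong (ι (mid? x) *_) (v x)))))))
              (≤-trans (*-monoʳ-≤ (ι (¬? (light? z) ×-dec E? ω x z)) (ι-guard (mid? x) mid⇒D≤c)) (≤-reflexive (*-comm _ c)))))))
          (≤-reflexive (trans (∑₂-*ˡ c (λ x z → ι (¬? (light? z) ×-dec E? ω x z))) (cong (c *_) (heavy-ends v))))
        bad-≤ : count₂ bad? ≤ c * count (C? ω) + (heavy + (c * c + (c* + c* * c*)))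
        bad-≤ = begin
          count₂ bad?
            ≤⟨ ∑₂-mono (λ x y → ≤-trans (ι-mono (bad? x y) (union? x y) (λ { (m , e′ , inj₁ p) → inj₁ (p , e′) ; (m , e′ , inj₂ (inj₁ p)) → inj₂ (inj₁ (p , e′))
                 ; (m , e′ , inj₂ (inj₂ (inj₁ p))) → inj₂ (inj₂ (inj₁ ((m , p) , e′))) ; (m , e′ , inj₂ (inj₂ (inj₂ (inj₁ p)))) → inj₂ (inj₂ (inj₂ (inj₁ (p , e′))))
                 ; (m , e′ , inj₂ (inj₂ (inj₂ (inj₂ (p , q))))) → inj₂ (inj₂ (inj₂ (inj₂ ((p , q) , e′)))) }))
                 (≤-trans (ι-⊎ (e₁? x y) _) (+-monoʳ-≤ _ (≤-trans (ι-⊎ (e₂? x y) _) (+-monoʳ-≤ _ (≤-trans (ι-⊎ (e₃? x y) _) (+-monoʳ-≤ _ (ι-⊎ (e₄? x y) (e₅? x y))))))))) ⟩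
          ∑₂ (λ x y → ι (e₁? x y) + (ι (e₂? x y) + (ι (e₃? x y) + (ι (e₄? x y) + ι (e₅? x y)))))
            ≡⟨ trans (∑₂-+ (λ x y → ι (e₁? x y)) _) (cong (count₂ e₁? +_) (trans (∑₂-+ (λ x y → ι (e₂? x y)) _) (cong (count₂ e₂? +_)
                 (trans (∑₂-+ (λ x y → ι (e₃? x y)) _) (cong (count₂ e₃? +_) (∑₂-+ (λ x y → ι (e₄? x y)) _)))))) ⟩
          count₂ e₁? + (count₂ e₂? + (count₂ e₃? + (count₂ e₄? + count₂ e₅?)))
            ≤⟨ +-mono-≤ b₁ (+-mono-≤ (≤-reflexive (heavy-ends v)) (+-mono-≤ b₃ (+-mono-≤ b₄ b₅))) ⟩
          c * count (C? ω) + (heavy + (c * c + (c* + c* * c*))) ∎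
          where
          e₁? : ∀ x y → Dec (C ω x × E ω x y)
          e₁? x y = C? ω x ×-dec E? ω x y
          e₂? : ∀ x y → Dec (¬ Light y × E ω x y)
          e₂? x y = ¬? (light? y) ×-dec E? ω x y
          e₃? : ∀ x y → Dec ((Mid x × E ω i x) × E ω x y)
          e₃? x y = (mid? x ×-dec E? ω i x) ×-dec E? ω x y
          e₄? : ∀ x y → Dec (j ≡ y × E ω x y)
          e₄? x y = (j Fin.≟ y) ×-dec E? ω x y
          e₅? : ∀ x y → Dec ((E ω j y × Light y) × E ω x y)
          e₅? x y = (E? ω j y ×-dec light? y) ×-dec E? ω x y
          union? : ∀ x y → Dec _
          union? x y = e₁? x y ⊎-dec e₂? x y ⊎-dec e₃? x y ⊎-dec e₄? x y ⊎-dec e₅? x y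
          rows : ∀ {P : Fin n → Set} (P? : ∀ x → Dec (P x)) m → (∀ {x} → P x → D x ≤ m) → count₂ (λ x y → P? x ×-dec E? ω x y) ≤ count P? * m
          rows P? m h = ∑-mono-*ʳ m (λ x → ≤-trans (≤-reflexive (trans (∑-cong (λ y → ι-× (P? x) (E? ω x y))) (trans (∑-*ˡ (ι (P? x)) _) (cong (ι (P? x) *_) (v x)))))
            (ι-guard (P? x) {n = ι (P? x) * m} (λ p → ≤-trans (h p) (≤-reflexive (sym (ι-1 (P? x) p m))))))
          columns : ∀ {P : Fin n → Set} (P? : ∀ y → Dec (P y)) m → (∀ {y} → P y → D y ≤ m) → count₂ (λ x y → P? y ×-dec E? ω x y) ≤ count P? * m
          columns P? m h = ≤-trans (≤-reflexive (trans (∑-swap (λ x y → ι (P? y ×-dec E? ω x y))) (∑₂-cong (λ y x → ι-cong (P? y ×-dec E? ω x y) (P? y ×-dec E? ω y x)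
            (λ (p , q) → p , E-sym ω q) (λ (p , q) → p , E-sym ω q))))) (rows P? m h)
          b₁ : count₂ e₁? ≤ c * count (C? ω)
          b₁ = ≤-trans (rows (C? ω) c (mid⇒D≤c ∘ C⇒mid ω)) (≤-reflexive (*-comm (count (C? ω)) c))
          b₃ : count₂ e₃? ≤ c * c
          b₃ = ≤-trans (rows (λ x → mid? x ×-dec E? ω i x) c (mid⇒D≤c ∘ proj₁)) (*-monoˡ-≤ c (≤-trans (∑-mono (λ x → ι-mono (mid? x ×-dec E? ω i x) (E? ω i x) proj₂))
            (≤-trans (≤-reflexive (v i)) (mid⇒D≤c (C⇒mid ω ci)))))
          b₄ : count₂ e₄? ≤ c*
          b₄ = ≤-trans (columns (j Fin.≟_) c* (λ { refl → <⇒≤ lj })) (≤-trans (*-monoˡ-≤ c* (count-≡ j)) (≤-reflexive (*-identityˡ c*)))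
          b₅ : count₂ e₅? ≤ c* * c*
          b₅ = ≤-trans (columns (λ y → E? ω j y ×-dec light? y) c* (<⇒≤ ∘ proj₂)) (*-monoˡ-≤ c* (≤-trans (∑-mono (λ y → ι-mono (E? ω j y ×-dec light? y) (E? ω j y) proj₁))
            (≤-trans (≤-reflexive (v j)) (<⇒≤ lj))))
        total : T₂ ≤ Y + (d * n + (c * (c * count (C? ω) + (heavy + (c * c + (c* + c* * c*)))) + c * heavy))
        total = begin
          T₂
            ≡⟨ T₂≡ ⟩
          ∑ (λ x → ∑₂ (λ y z → ι (cherry? x y z)))
            ≤⟨ ∑-mono (λ x → ∑₂-mono (λ y z → ι-cover₄ (cherry? x y z) (before ω x z i j y) (diag? x y z) (bad? x y ×-dec E? ω x z) (heavyEnd? x y z) (cases x y z))) ⟩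
          ∑ (λ x → ∑₂ (λ y z → ι (before ω x z i j y) + (ι (diag? x y z) + (ι (bad? x y ×-dec E? ω x z) + ι (heavyEnd? x y z)))))
            ≡⟨ trans (∑-cong (λ x → trans (∑₂-+ (λ y z → ι (before ω x z i j y)) _) (cong (∑₂ (λ y z → ι (before ω x z i j y)) +_)
                 (trans (∑₂-+ (λ y z → ι (diag? x y z)) _) (cong (∑₂ (λ y z → ι (diag? x y z)) +_) (∑₂-+ (λ y z → ι (bad? x y ×-dec E? ω x z)) _))))))
                 (trans (∑-+ (λ x → ∑₂ (λ y z → ι (before ω x z i j y))) _) (cong (Y +_) (trans (∑-+ (λ x → ∑₂ (λ y z → ι (diag? x y z))) _)
                 (cong (∑ (λ x → ∑₂ (λ y z → ι (diag? x y z))) +_) (∑-+ (λ x → ∑₂ (λ y z → ι (bad? x y ×-dec E? ω x z))) _))))) ⟩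
          Y + (∑ (λ x → ∑₂ (λ y z → ι (diag? x y z))) + (∑ (λ x → ∑₂ (λ y z → ι (bad? x y ×-dec E? ω x z))) + ∑ (λ x → ∑₂ (λ y z → ι (heavyEnd? x y z)))))
            ≤⟨ +-monoʳ-≤ Y (+-mono-≤ eq-≤ (+-mono-≤ (≤-trans near-≤ (*-monoʳ-≤ c bad-≤)) heavyEnd-≤)) ⟩
          Y + (d * n + (c * (c * count (C? ω) + (heavy + (c * c + (c* + c* * c*)))) + c * heavy)) ∎

  module _ (e : ℕ) (dn≥1 : 1 ≤ d * n) (few-heavy : c * heavy ≤ n) (const : c * (c * c + (c* + c* * c*)) ≤ n)
    (dense : (2 * Q⁵ * d + d + 4) * n ≤ T₂) where

    -- The component bound grows faster than `Φ`. This is harmless: `ℓ` is fixed before `n`, and the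
    -- initial bound `b` can be taken smaller by the factor 3^ℓ.
    growth^ : ∀ ℓ b → c * (c * (e + 3 ^ ℓ * b)) ≤ n → 2 ^ ℓ * Φ e b ≤ Φ e (3 ^ ℓ * b)
    growth^ zero b _ = ≤-reflexive (trans (*-identityˡ (Φ e b)) (cong (Φ e) (sym (*-identityˡ b))))
    growth^ (suc ℓ) b small = begin
      2 ^ suc ℓ * Φ e b           ≡⟨ shape₁ (2 ^ ℓ) (Φ e b) ⟩
      2 ^ ℓ * (2 * Φ e b)         ≤⟨ *-monoʳ-≤ (2 ^ ℓ) (growth e b dn≥1 (≤-trans (*-monoʳ-≤ c (*-monoʳ-≤ c (+-monoʳ-≤ e (m≤n*m b (3 ^ suc ℓ) {{>-nonZero (m^n>0 3 (suc ℓ))}})))) small) few-heavy const dense) ⟩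
      2 ^ ℓ * Φ e (3 * b)         ≤⟨ growth^ ℓ (3 * b) (subst (λ x → c * (c * (e + x)) ≤ n) (sym eq) small) ⟩
      Φ e (3 ^ ℓ * (3 * b))       ≡⟨ cong (Φ e) eq ⟩
      Φ e (3 ^ suc ℓ * b)         ∎
      where
      open ≤-Reasoning
      shape₁ : ∀ x y → 2 * x * y ≡ x * (2 * y)
      shape₁ = solve-∀
      shape₂ : ∀ x y → x * (3 * y) ≡ 3 * x * y
      shape₂ = solve-∀
      eq : 3 ^ ℓ * (3 * b) ≡ 3 ^ suc ℓ * b
      eq = shape₂ (3 ^ ℓ) b

    Φ≤ : ∀ b → Φ e b ≤ (e + b) * c * Z
    Φ≤ b = ≤-trans (∫-mono (λ ω → ι-guard (vsmall? e b ω) {n = (e + b) * c * ι (Valid? D ω)} (λ (v , _ , sm) → ≤-trans (X≤c|C| v)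
      (≤-trans (*-monoˡ-≤ c sm) (≤-reflexive (sym (trans (cong ((e + b) * c *_) (ι-yes (Valid? D ω) v)) (*-identityʳ _)))))))) (≤-reflexive (∫-* ((e + b) * c) _))

    -- If the explored set were often small, the seeds would give `Φ e b` order `N` times that
    -- measure, and `ℓ` doublings would exceed the trivial bound `Φ≤`.
    explored-large : ∀ k ℓ b → c * (c * (e + 3 ^ ℓ * b)) ≤ n → 2 * heavy ≤ N → 1 ≤ N →
      k * (4 * Q * ((e + 3 ^ ℓ * b) * c)) ≤ N * 2 ^ ℓ → k * μ (small? e b) ≤ Z
    explored-large k ℓ b small heavy≤N N≥1 enough = *-cancelˡ-≤ (N * 2 ^ ℓ) {{>-nonZero (1≤* {N} N≥1 (≤-trans (s≤s z≤n) (n<2^n ℓ)))}} (begin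
      N * 2 ^ ℓ * (k * μ (small? e b))                      ≡⟨ shape₁ N (2 ^ ℓ) k (μ (small? e b)) ⟩
      k * (2 ^ ℓ * (N * μ (small? e b)))                    ≤⟨ *-monoʳ-≤ k (*-monoʳ-≤ (2 ^ ℓ) (seeds-boundary e b heavy≤N)) ⟩
      k * (2 ^ ℓ * (4 * Q * Φ e b))                         ≡⟨ cong (k *_) (swap-* (2 ^ ℓ) (4 * Q) (Φ e b)) ⟩
      k * (4 * Q * (2 ^ ℓ * Φ e b))                         ≤⟨ *-monoʳ-≤ k (*-monoʳ-≤ (4 * Q) (≤-trans (growth^ ℓ b small) (Φ≤ (3 ^ ℓ * b)))) ⟩
      k * (4 * Q * ((e + 3 ^ ℓ * b) * c * Z))               ≡⟨ shape₂ k (4 * Q) ((e + 3 ^ ℓ * b) * c) Z ⟩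
      k * (4 * Q * ((e + 3 ^ ℓ * b) * c)) * Z               ≤⟨ *-monoˡ-≤ Z enough ⟩
      N * 2 ^ ℓ * Z                                         ∎)
      where
      open ≤-Reasoning
      shape₁ : ∀ n t k m → n * t * (k * m) ≡ k * (t * (n * m))
      shape₁ = solve-∀
      shape₂ : ∀ k q x z → k * (q * (x * z)) ≡ k * (q * x) * z
      shape₂ = solve-∀

    few-small : ∀ k ℓ b → 1 ≤ k → 1 ≤ N → c * (c * (e + 3 ^ ℓ * b)) ≤ n → 2 * heavy ≤ N → 4 * heavy ≤ e →
      k * (4 * Q * ((e + 3 ^ ℓ * b) * c)) ≤ N * 2 ^ ℓ → 2 * (4 * Q * k) ≤ e →
      2 * (4 * Q * k) * (c * b + (c * c + (c* + c* * c*))) ≤ e →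
      k * (4 * (4 * Q * k) * (4 * Q * k) * Q ^ 4 * N * (d * n)) ≤ e * e →
      k * μ (λ ω → L ω ≤? b) ≤ 3 * Z
    few-small k ℓ b k≥1 N≥1 small heavy≤N heavy≤e enough large blocked few-seeds = begin
      k * μ (λ ω → L ω ≤? b)
        ≤⟨ *-monoʳ-≤ k (≤-trans (μ-⊎ (λ ω → L ω ≤? b) (small? e b) E₂₃? split₁) (+-monoʳ-≤ (μ (small? e b)) (μ-⊎ E₂₃? E₂? E₃? split₂))) ⟩
      k * (μ (small? e b) + (μ E₂? + μ E₃?))
        ≡⟨ shape k (μ (small? e b)) (μ E₂?) (μ E₃?) ⟩
      k * μ (small? e b) + (k * μ E₂? + k * μ E₃?)
        ≤⟨ +-mono-≤ (explored-large k ℓ b small heavy≤N N≥1 enough) (+-mono-≤ (thin-boundary e k k≥1 heavy≤e large)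
             (separate-boundary e k g b g≥1 blocked (≤-trans (≤-trans g≥1 (m≤m+n g _)) large) few-seeds)) ⟩
      Z + (Z + Z)
        ≡⟨ cong (λ x → Z + (Z + x)) (sym (+-identityʳ Z)) ⟩
      3 * Z ∎
      where
      open ≤-Reasoning
      g = 4 * Q * k
      g≥1 : 1 ≤ g
      g≥1 = 1≤* {4 * Q} (1≤* {4} (s≤s z≤n) Q≥1) k≥1
      shape : ∀ k x y z → k * (x + (y + z)) ≡ k * x + (k * y + k * z)
      shape = solve-∀
      E₂₃? : ∀ ω → Dec (L ω ≤ b × e < count (C? ω))
      E₂₃? ω = (L ω ≤? b) ×-dec (e <? count (C? ω))
      E₂? : ∀ ω → Dec (e < count (C? ω) × g * X ω ≤ e)
      E₂? ω = (e <? count (C? ω)) ×-dec (g * X ω ≤? e)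
      E₃? : ∀ ω → Dec (L ω ≤ b × e < g * X ω)
      E₃? ω = (L ω ≤? b) ×-dec (e <? g * X ω)
      split₁ : ∀ ω → Valid D ω → L ω ≤ b → Small e b ω ⊎ (L ω ≤ b × e < count (C? ω))
      split₁ ω _ le with e <? count (C? ω)
      ... | yes p = inj₂ (le , p)
      ... | no ¬p = inj₁ ((λ x → ≤-trans (component≤L ω (H₁? ω) (H₁⇒O ω) x) le) , ≤-trans (≮⇒≥ ¬p) (m≤m+n e b))
      split₂ : ∀ ω → Valid D ω → L ω ≤ b × e < count (C? ω) → (e < count (C? ω) × g * X ω ≤ e) ⊎ (L ω ≤ b × e < g * X ω)
      split₂ ω _ (le , p) with g * X ω ≤? e
      ... | yes q = inj₁ (p , q)
      ... | no ¬q = inj₂ (le , ≰⇒> ¬q)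

-- Choice of constants for the failure of A₂

module LowDegrees (w : St → ℕ) (w≥1 : ∀ s → 1 ≤ w s) (d k c K₁ c′ : ℕ)
  (d≥1 : 1 ≤ d) (k≥1 : 1 ≤ k) (c≥1 : 1 ≤ c) (K₁≥1 : 1 ≤ K₁) where
  open Integral w w≥1 using (Q; Q≥1)
  open Constants w w≥1 d k using (K₂)

  -- With e = n/h, explored vertices use up at most `n` pairs of half-edges. The first summand of
  -- `B` makes N = n/B small against e²/n, the second guarantees enough mid vertices to choose from.
  -- `ℓ` makes 2^ℓ exceed a multiple of n/N. Three summands of `c*` bound the heavy degrees against
  -- n/c, `N` and `e`; the last makes the hub argument available at scale `c*`. `r` keeps even 3^ℓ b
  -- small against `e`.
  g h B ℓ c* r m₀ n₀ : ℕ
  g = 4 * Q * k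
  h = 2 * c * c
  B = 16 * k * g * g * Q ^ 4 * d * h * h + c * c
  ℓ = 16 * k * Q * c * B
  c* = c * K₁ + 4 * B * K₁ + 8 * h * K₁ + c′
  r = 3 ^ ℓ * (8 * g * c * h)
  m₀ = c * c + (c* + c* * c*)
  n₀ = h + B + (c * m₀ + 2 * h * (2 * g + 4 * g * m₀))

  c′≤c* : c′ ≤ c*
  c′≤c* = m≤n+m c′ (c * K₁ + 4 * B * K₁ + 8 * h * K₁)

  g≥1 : 1 ≤ g
  g≥1 = 1≤* {4 * Q} (1≤* {4} (s≤s z≤n) Q≥1) k≥1

  h≥1 : 1 ≤ h
  h≥1 = 1≤* {2 * c} (1≤* {2} (s≤s z≤n) c≥1) c≥1

  B≥1 : 1 ≤ B
  B≥1 = ≤-trans (1≤* {c} c≥1 c≥1) (m≤n+m (c * c) _)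

  gch≥1 : 1 ≤ 8 * g * c * h
  gch≥1 = 1≤* {8 * g * c} (1≤* {8 * g} (1≤* {8} (s≤s z≤n) g≥1) c≥1) h≥1

  3^ℓ≥1 : 1 ≤ 3 ^ ℓ
  3^ℓ≥1 = m^n>0 3 ℓ

  r≥1 : 1 ≤ r
  r≥1 = 1≤* {3 ^ ℓ} 3^ℓ≥1 gch≥1

  module _ (n : ℕ) (D : Fin n → ℕ) (D≥1 : ∀ i → 1 ≤ D i) (∑D≤ : ∑ D ≤ d * n) (large : n₀ ≤ n)
    (light : c* * ∑ (λ i → ι (c* ≤? D i) * D i) ≤ K₁ * n)
    (dense : K₂ * n < 4 * ∑ (λ i → ι (D i <? c) * (D i * D i))) where
    open Model n D w w≥1 using (μ; μ-mono; Z; L)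

    private
      instance
        _ = >-nonZero h≥1
        _ = >-nonZero B≥1
        _ = >-nonZero r≥1

    few-small-components : k * μ (λ ω → r * L ω ≤? n) ≤ 3 * Z
    few-small-components = ≤-trans
      (*-monoʳ-≤ k (μ-mono (λ ω → r * L ω ≤? n) (λ ω → L ω ≤? b) (λ ω _ le → L≤b le)))
      (A.few-small e dn≥1 c-heavy const dense′ k ℓ b k≥1 N≥1′ explored 2heavy 4heavy enough 2g≤e blocked few-seeds)
      where
      open ≤-Reasoning
      e N b : ℕ
      e = n / h
      N = n / B
      b = n / r

      h≤n : h ≤ n
      h≤n = ≤-trans (≤-trans (m≤m+n h B) (m≤m+n (h + B) _)) large
      B≤n : B ≤ n
      B≤n = ≤-trans (≤-trans (m≤n+m B h) (m≤m+n (h + B) _)) large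
      n≥1 : 1 ≤ n
      n≥1 = ≤-trans h≥1 h≤n
      dn≥1 : 1 ≤ d * n
      dn≥1 = 1≤* {d} d≥1 n≥1
      n≤2he : n ≤ 2 * h * e
      n≤2he = quotient-≥ n h h≤n
      n≤2BN : n ≤ 2 * B * N
      n≤2BN = quotient-≥ n B B≤n
      he≤n : h * e ≤ n
      he≤n = ≤-trans (≤-reflexive (*-comm h e)) (m/n*n≤m n h)
      e≤n : e ≤ n
      e≤n = ≤-trans (m≤n*m e h) he≤n
      BN≤n : B * N ≤ n
      BN≤n = ≤-trans (≤-reflexive (*-comm B N)) (m/n*n≤m n B)
      rb≤n : r * b ≤ n
      rb≤n = ≤-trans (≤-reflexive (*-comm r b)) (m/n*n≤m n r)
      N≥1 : 1 ≤ N
      N≥1 = m≥n⇒m/n>0 B≤n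

      L≤b : ∀ {l} → r * l ≤ n → l ≤ b
      L≤b {l} le = subst (_≤ b) (m*n/n≡m l r) (/-monoˡ-≤ r (subst (_≤ n) (*-comm r l) le))

      e≥ : ∀ x → 2 * h * x ≤ n → x ≤ e
      e≥ x le = *-cancelˡ-≤ (2 * h) {{>-nonZero (1≤* {2} (s≤s z≤n) h≥1)}} (≤-trans le n≤2he)

      T₀ : ℕ
      T₀ = ∑ (λ i → ι ((2 ≤? D i) ×-dec (D i <? c)) * (D i * D i))
      -- Discarding degrees below two loses at most the degree sum, hence at most `d * n`.
      dense′ : (2 * (Q ^ 4 * Q) * d + d + 4) * n ≤ T₀
      dense′ = *-cancelˡ-≤ 4 (by-slack 0 (+-mono-≤ (<⇒≤ dense) (*-monoʳ-≤ 4 (≤-trans squares (+-monoʳ-≤ T₀ ∑D≤))))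
          (shape (2 * (Q ^ 4 * Q) * d + d + 4) d n T₀ (∑ (λ i → ι (D i <? c) * (D i * D i)))))
        where
        shape : ∀ q d n t s → 4 * (q * n) + 0 + (4 * s + 4 * (t + d * n)) ≡ 4 * t + ((4 * q + 4 * d) * n + 4 * s)
        shape = solve-∀
        squares : ∑ (λ i → ι (D i <? c) * (D i * D i)) ≤ T₀ + ∑ D
        squares = ∑-mono-+ (λ i → ι-guard (D i <? c) (λ lt → square (D i) lt))
          where
          square : ∀ x → x < c → x * x ≤ ι ((2 ≤? x) ×-dec (x <? c)) * (x * x) + x
          square zero lt = z≤n
          square (suc zero) lt = m≤n+m 1 _
          square x@(suc (suc _)) lt = ≤-trans (≤-reflexive (sym (ι-1 ((2 ≤? x) ×-dec (x <? c)) (s≤s (s≤s z≤n) , lt) (x * x)))) (m≤m+n _ x)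

      -- The squares over mid vertices sum to at least `n`, and each is at most `c * c`.
      mids : N ≤ count (λ i → (2 ≤? D i) ×-dec (D i <? c))
      mids = *-cancelˡ-≤ (c * c) {{>-nonZero (1≤* {c} c≥1 c≥1)}} (begin
        c * c * N          ≤⟨ *-monoˡ-≤ N (m≤n+m (c * c) (16 * k * g * g * Q ^ 4 * d * h * h)) ⟩
        B * N              ≤⟨ BN≤n ⟩
        n                  ≤⟨ m≤n*m n (2 * (Q ^ 4 * Q) * d + d + 4) {{>-nonZero (≤-trans (s≤s z≤n) (m≤n+m 4 (2 * (Q ^ 4 * Q) * d + d)))}} ⟩
        (2 * (Q ^ 4 * Q) * d + d + 4) * n  ≤⟨ dense′ ⟩
        T₀                  ≤⟨ ∑-mono-*ˡ (c * c) (λ i → ≤-trans (ι-guard ((2 ≤? D i) ×-dec (D i <? c)) {n = ι ((2 ≤? D i) ×-dec (D i <? c)) * (c * c)}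
                                (λ p → ≤-trans (*-mono-≤ (<⇒≤ (proj₂ p)) (<⇒≤ (proj₂ p))) (≤-reflexive (sym (ι-1 ((2 ≤? D i) ×-dec (D i <? c)) p (c * c))))))
                                (≤-reflexive (*-comm _ (c * c)))) ⟩
        c * c * count (λ i → (2 ≤? D i) ×-dec (D i <? c)) ∎)

      chosen = choose (λ i → (2 ≤? D i) ×-dec (D i <? c)) N mids
      module A = Exploration n D w w≥1 d c c* ∑D≤ (λ i → T? (proj₁ chosen i)) (λ {i} → proj₁ (proj₂ chosen) i)

      N≡ : A.N ≡ N
      N≡ = proj₂ (proj₂ chosen)
      N≥1′ : 1 ≤ A.N
      N≥1′ = subst (1 ≤_) (sym N≡) N≥1

      heavy≡ : A.heavy ≡ ∑ (λ i → ι (c* ≤? D i) * D i)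
      heavy≡ = ∑-cong (λ i → cong (_* D i) (ι-cong (¬? (D i <? c*)) (c* ≤? D i) ≮⇒≥ ≤⇒≯))
      c*heavy : c* * A.heavy ≤ K₁ * n
      c*heavy = subst (λ x → c* * x ≤ K₁ * n) (sym heavy≡) light
      -- A summand `x * K₁` of `c*` turns `c* * heavy ≤ K₁ * n` into `x * heavy ≤ n`.
      heavy-≤ : ∀ x → x * K₁ ≤ c* → x * A.heavy ≤ n
      heavy-≤ x le = *-cancelˡ-≤ K₁ {{>-nonZero K₁≥1}} (≤-trans (≤-reflexive (shape K₁ x A.heavy)) (≤-trans (*-monoˡ-≤ A.heavy le) c*heavy))
        where
        shape : ∀ k x y → k * (x * y) ≡ x * k * y
        shape = solve-∀
      c-heavy : c * A.heavy ≤ n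
      c-heavy = heavy-≤ c (≤-trans (m≤m+n (c * K₁) (4 * B * K₁)) (≤-trans (m≤m+n _ (8 * h * K₁)) (m≤m+n _ c′)))
      2heavy : 2 * A.heavy ≤ A.N
      2heavy = subst (2 * A.heavy ≤_) (sym N≡) (*-cancelˡ-≤ (2 * B) {{>-nonZero (1≤* {2} (s≤s z≤n) B≥1)}} (begin
        2 * B * (2 * A.heavy)   ≡⟨ shape B A.heavy ⟩
        4 * B * A.heavy         ≤⟨ heavy-≤ (4 * B) (≤-trans (m≤n+m (4 * B * K₁) (c * K₁)) (≤-trans (m≤m+n _ (8 * h * K₁)) (m≤m+n _ c′))) ⟩
        n                       ≤⟨ n≤2BN ⟩
        2 * B * N               ∎))
        where
        shape : ∀ b x → 2 * b * (2 * x) ≡ 4 * b * x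
        shape = solve-∀
      4heavy : 4 * A.heavy ≤ e
      4heavy = e≥ (4 * A.heavy) (≤-trans (≤-reflexive (shape h A.heavy)) (heavy-≤ (8 * h) (≤-trans (m≤n+m (8 * h * K₁) (c * K₁ + 4 * B * K₁)) (m≤m+n _ c′))))
        where
        shape : ∀ b x → 2 * b * (4 * x) ≡ 8 * b * x
        shape = solve-∀

      n-large : c * m₀ + 2 * h * (2 * g + 4 * g * m₀) ≤ n
      n-large = ≤-trans (m≤n+m _ (h + B)) large
      const : c * m₀ ≤ n
      const = ≤-trans (m≤m+n (c * m₀) _) n-large
      g-large : 2 * g + 4 * g * m₀ ≤ e
      g-large = e≥ _ (≤-trans (m≤n+m _ (c * m₀)) n-large)
      2g≤e : 2 * g ≤ e
      2g≤e = ≤-trans (m≤m+n (2 * g) _) g-large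

      4gc3^ℓb : 4 * g * c * (3 ^ ℓ * b) ≤ e
      4gc3^ℓb = e≥ _ (≤-trans (≤-reflexive (shape (3 ^ ℓ) g c h b)) rb≤n)
        where
        shape : ∀ t g c h b → 2 * h * (4 * g * c * (t * b)) ≡ t * (8 * g * c * h) * b
        shape = solve-∀
      3^ℓb : 3 ^ ℓ * b ≤ e
      3^ℓb = ≤-trans (m≤n*m (3 ^ ℓ * b) (4 * g * c) {{>-nonZero (1≤* {4 * g} (1≤* {4} (s≤s z≤n) g≥1) c≥1)}}) 4gc3^ℓb
      4gcb : 4 * g * c * b ≤ e
      4gcb = ≤-trans (*-monoʳ-≤ (4 * g * c) (m≤n*m b (3 ^ ℓ) {{>-nonZero 3^ℓ≥1}})) 4gc3^ℓb

      explored : c * (c * (e + 3 ^ ℓ * b)) ≤ n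
      explored = ≤-trans (*-monoʳ-≤ c (*-monoʳ-≤ c (+-monoʳ-≤ e 3^ℓb))) (≤-trans (≤-reflexive (shape c e)) he≤n)
        where
        shape : ∀ c e → c * (c * (e + e)) ≡ 2 * c * c * e
        shape = solve-∀
      enough : k * (4 * Q * ((e + 3 ^ ℓ * b) * c)) ≤ A.N * 2 ^ ℓ
      enough = begin
        k * (4 * Q * ((e + 3 ^ ℓ * b) * c))    ≤⟨ *-monoʳ-≤ k (*-monoʳ-≤ (4 * Q) (*-monoˡ-≤ c (+-mono-≤ e≤n (≤-trans 3^ℓb e≤n)))) ⟩
        k * (4 * Q * ((n + n) * c))            ≤⟨ *-monoʳ-≤ k (*-monoʳ-≤ (4 * Q) (*-monoˡ-≤ c (+-mono-≤ n≤2BN n≤2BN))) ⟩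
        k * (4 * Q * ((2 * B * N + 2 * B * N) * c))  ≡⟨ shape k Q B N c ⟩
        N * ℓ                                  ≤⟨ *-monoʳ-≤ N (<⇒≤ (n<2^n ℓ)) ⟩
        N * 2 ^ ℓ                              ≡⟨ cong (_* 2 ^ ℓ) N≡ ⟨
        A.N * 2 ^ ℓ                            ∎
        where
        shape : ∀ k q b n c → k * (4 * q * ((2 * b * n + 2 * b * n) * c)) ≡ n * (16 * k * q * c * b)
        shape = solve-∀
      blocked : 2 * g * (c * b + m₀) ≤ e
      blocked = *-cancelˡ-≤ 2 (by-slack (2 * g) (+-mono-≤ 4gcb g-large) (shape g c b m₀ e))
        where
        shape : ∀ g c b m e → 2 * (2 * g * (c * b + m)) + 2 * g + (e + e) ≡ 2 * e + (4 * g * c * b + (2 * g + 4 * g * m))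
        shape = solve-∀
      few-seeds : k * (4 * g * g * Q ^ 4 * A.N * (d * n)) ≤ e * e
      few-seeds = subst (λ x → k * (4 * g * g * Q ^ 4 * x * (d * n)) ≤ e * e) (sym N≡)
        (*-cancelˡ-≤ (4 * h * h) {{>-nonZero (1≤* {4 * h} (1≤* {4} (s≤s z≤n) h≥1) h≥1)}} (begin
          4 * h * h * (k * (4 * g * g * Q ^ 4 * N * (d * n)))      ≡⟨ shape k g (Q ^ 4) d h N n ⟩
          16 * k * g * g * Q ^ 4 * d * h * h * N * n               ≤⟨ *-monoˡ-≤ n (*-monoˡ-≤ N (m≤m+n (16 * k * g * g * Q ^ 4 * d * h * h) (c * c))) ⟩
          B * N * n                                                ≤⟨ *-monoˡ-≤ n BN≤n ⟩
          n * n                                                    ≤⟨ *-mono-≤ n≤2he n≤2he ⟩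
          2 * h * e * (2 * h * e)                                  ≡⟨ shape′ h e ⟩
          4 * h * h * (e * e)                                      ∎))
        where
        shape : ∀ k g q d h N n → 4 * h * h * (k * (4 * g * g * q * N * (d * n))) ≡ 16 * k * g * g * q * d * h * h * N * n
        shape = solve-∀
        shape′ : ∀ h e → 2 * h * e * (2 * h * e) ≡ 4 * h * h * (e * e)
        shape′ = solve-∀

-- Combination of the two failures

module Combine (w : St → ℕ) (w≥1 : ∀ s → 1 ≤ w s) (d k : ℕ) (d≥1 : 1 ≤ d) (k≥1 : 1 ≤ k) where
  open Integral w w≥1 using (Q; Q≥1)
  open Constants w w≥1 d k public

  -- The sum dominates both thresholds and, like them, does not involve `c`.
  K : ℕ
  K = K₁ + K₂

  K₁≥1 : 1 ≤ K₁
  K₁≥1 = 1≤* {4 * G′ * G′ * Q ^ 4 * (d + 1)} (1≤* {4 * G′ * G′ * Q ^ 4} (1≤* {4 * G′ * G′}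
      (1≤* {4 * G′} (1≤* {4} (s≤s z≤n) G′≥1) G′≥1) (m^n>0 Q {{>-nonZero Q≥1}} 4)) (≤-trans d≥1 (m≤m+n d 1))) k≥1
    where
    G′≥1 : 1 ≤ G′
    G′≥1 = ≤-trans (1≤* {16 * Q ^ 4 * d} (1≤* {16 * Q ^ 4} (1≤* {16} (s≤s z≤n) (m^n>0 Q {{>-nonZero Q≥1}} 4)) d≥1) k≥1) (m≤m+n G _)

  module _ (c : ℕ) (8d≤c : 8 * d ≤ c) where

    c≥1 : 1 ≤ c
    c≥1 = ≤-trans d≥1 (≤-trans (m≤m+n d _) 8d≤c)

    module Low = LowDegrees w w≥1 d k c K₁ (8 * d) d≥1 k≥1 c≥1 K₁≥1

    c* r n₀ : ℕ
    c* = Low.c*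
    r = r₁ c + r₁ c* + Low.r
    n₀ = n₁ c + n₁ c* + (Low.n₀ + 1)

    r≥1 : 1 ≤ r
    r≥1 = ≤-trans Low.r≥1 (m≤n+m Low.r (r₁ c + r₁ c*))

    module _ (n : ℕ) (D : Fin n → ℕ) (large : n₀ ≤ n) (D≥1 : ∀ i → 1 ≤ D i) (∑D≤ : ∑ D ≤ d * n) where
      open Model n D w w≥1 using (μ; μ-mono; Z; L)

      n≥1 : 1 ≤ n
      n≥1 = ≤-trans (≤-trans (m≤n+m 1 Low.n₀) (m≤n+m (Low.n₀ + 1) (n₁ c + n₁ c*))) large

      weaken : ∀ r′ → r′ ≤ r → k * μ (λ ω → r′ * L ω ≤? n) ≤ 3 * Z → k * μ (λ ω → r * L ω ≤? n) ≤ 3 * Z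
      weaken r′ le = ≤-trans (*-monoʳ-≤ k (μ-mono (λ ω → r * L ω ≤? n) (λ ω → r′ * L ω ≤? n)
        (λ ω _ small → ≤-trans (*-monoˡ-≤ (L ω) le) small)))

      V₁ : ℕ → ℕ
      V₁ c = ∑ (λ i → ι (c ≤? D i) * D i)

      hubs : ∀ c → 8 * d ≤ c → n₁ c ≤ n → K₁ * n < c * V₁ c → k * μ (λ ω → r₁ c * L ω ≤? n) ≤ 3 * Z
      hubs c 8d≤c le dense = HighDegrees.few-small-components n D w w≥1 d k c D≥1 ∑D≤ d≥1 k≥1 8d≤c n≥1 dense le

      A₁-sum : ∀ c → ΣV n (λ i → if c ≤ᵇ D i then D i else 0) ≡ V₁ c
      A₁-sum c = trans (ΣV≡∑ n _) (∑-cong (λ i → ι-if (c ≤? D i) (D i)))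

      A₂-sum : ΣV n (λ i → if (0 ≤ᵇ D i) ∧ not (c ≤ᵇ D i) then D i * D i else 0) ≡ ∑ (λ i → ι (D i <? c) * (D i * D i))
      A₂-sum = trans (ΣV≡∑ n _) (∑-cong (λ i → trans (ι-if (¬? (c ≤? D i)) (D i * D i))
        (cong (_* (D i * D i)) (ι-cong (¬? (c ≤? D i)) (D i <? c) ≰⇒> <⇒≱))))

      -- When A₂ fails at `c`, the sums are also tested at the scale `c*`: either hubs of degree
      -- `c*` are dense and the hub argument applies to them, or the degrees from `c*` on are
      -- negligible and the exploration applies.
      few-small-components : ¬ A₁ n K c D ⊎ ¬ A₂ n K 0 c D → k * μ (λ ω → r * L ω ≤? n) ≤ 3 * Z
      few-small-components (inj₁ ¬a₁) = weaken (r₁ c) (≤-trans (m≤m+n (r₁ c) (r₁ c*)) (m≤m+n (r₁ c + r₁ c*) Low.r))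
        (hubs c 8d≤c (≤-trans (≤-trans (m≤m+n (n₁ c) (n₁ c*)) (m≤m+n (n₁ c + n₁ c*) (Low.n₀ + 1))) large)
          (≤-<-trans (*-monoˡ-≤ n (m≤m+n K₁ K₂)) (subst (λ x → K * n < c * x) (A₁-sum c) (≰⇒> ¬a₁))))
      few-small-components (inj₂ ¬a₂) = [ hubby , hubless ]′ (toSum (K₁ * n <? c* * V₁ c*))
        where
        hubby : K₁ * n < c* * V₁ c* → k * μ (λ ω → r * L ω ≤? n) ≤ 3 * Z
        hubby dense = weaken (r₁ c*) (≤-trans (m≤n+m (r₁ c*) (r₁ c)) (m≤m+n (r₁ c + r₁ c*) Low.r))
          (hubs c* Low.c′≤c* (≤-trans (≤-trans (m≤n+m (n₁ c*) (n₁ c)) (m≤m+n (n₁ c + n₁ c*) (Low.n₀ + 1))) large) dense)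
        hubless : ¬ (K₁ * n < c* * V₁ c*) → k * μ (λ ω → r * L ω ≤? n) ≤ 3 * Z
        hubless ¬dense = weaken Low.r (m≤n+m Low.r (r₁ c + r₁ c*))
          (Low.few-small-components n D D≥1 ∑D≤ (≤-trans (≤-trans (m≤m+n Low.n₀ 1) (m≤n+m (Low.n₀ + 1) (n₁ c + n₁ c*))) large) (≮⇒≥ ¬dense)
            (≤-<-trans (*-monoˡ-≤ n (m≤n+m K₂ K₁)) (subst (λ x → K * n < 4 * x) A₂-sum (≰⇒> ¬a₂))))

-- Rational probabilities

ℕ→ℚᵘ : ∀ k → ℚ.toℚᵘ (ℕ→ℚ k) ℚᵘ.≃ mkℚᵘ (int k) 0
ℕ→ℚᵘ k = ℚ.toℚᵘ-fromℚᵘ (mkℚᵘ (int k) 0)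

ℕ→ℚ-+ : ∀ a b → ℕ→ℚ (a + b) ≡ ℕ→ℚ a ℚ.+ ℕ→ℚ b
ℕ→ℚ-+ a b = ℚ.toℚᵘ-injective (ℚᵘ.≃-trans (ℕ→ℚᵘ (a + b)) (ℚᵘ.≃-trans
  (*≡* (cong (ℤ._* int 1) (trans (ℤ.pos-+ a b) (sym (cong₂ ℤ._+_ (ℤ.*-identityʳ (int a)) (ℤ.*-identityʳ (int b)))))))
  (ℚᵘ.≃-sym (ℚᵘ.≃-trans (ℚ.toℚᵘ-homo-+ (ℕ→ℚ a) (ℕ→ℚ b)) (ℚᵘ.+-cong (ℕ→ℚᵘ a) (ℕ→ℚᵘ b))))))

ℕ→ℚ-* : ∀ a b → ℕ→ℚ (a * b) ≡ ℕ→ℚ a ℚ.* ℕ→ℚ b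
ℕ→ℚ-* a b = ℚ.toℚᵘ-injective (ℚᵘ.≃-trans (ℕ→ℚᵘ (a * b)) (ℚᵘ.≃-trans
  (*≡* (cong (ℤ._* int 1) (ℤ.pos-* a b)))
  (ℚᵘ.≃-sym (ℚᵘ.≃-trans (ℚ.toℚᵘ-homo-* (ℕ→ℚ a) (ℕ→ℚ b)) (ℚᵘ.*-cong (ℕ→ℚᵘ a) (ℕ→ℚᵘ b))))))

ℕ→ℚ-mono : ∀ {a b} → a ≤ b → ℕ→ℚ a ℚ.≤ ℕ→ℚ b
ℕ→ℚ-mono {a} {b} le = ℚ.toℚᵘ-cancel-≤ (ℚᵘ.≤-respˡ-≃ (ℚᵘ.≃-sym (ℕ→ℚᵘ a)) (ℚᵘ.≤-respʳ-≃ (ℚᵘ.≃-sym (ℕ→ℚᵘ b))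
  (*≤* (ℤ.*-monoʳ-≤-nonNeg (int 1) (ℤ.+≤+ le)))))

ℕ→ℚ-mono-< : ∀ {a b} → a < b → ℕ→ℚ a ℚ.< ℕ→ℚ b
ℕ→ℚ-mono-< {a} {b} lt = ℚ.toℚᵘ-cancel-< (ℚᵘ.<-respˡ-≃ (ℚᵘ.≃-sym (ℕ→ℚᵘ a)) (ℚᵘ.<-respʳ-≃ (ℚᵘ.≃-sym (ℕ→ℚᵘ b))
  (*<* (ℤ.*-monoʳ-<-pos (int 1) (ℤ.+<+ lt)))))

ℕ→ℚ-cancel-≤ : ∀ {a b} → ℕ→ℚ a ℚ.≤ ℕ→ℚ b → a ≤ b
ℕ→ℚ-cancel-≤ {a} {b} le = ≮⇒≥ (λ lt → ℚ.<-irrefl refl (ℚ.<-≤-trans (ℕ→ℚ-mono-< lt) le))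

ℕ→ℚ-cancel-< : ∀ {a b} → ℕ→ℚ a ℚ.< ℕ→ℚ b → a < b
ℕ→ℚ-cancel-< {a} {b} lt = ≰⇒> (λ le → ℚ.<-irrefl refl (ℚ.<-≤-trans lt (ℕ→ℚ-mono le)))

positive-fraction : ∀ q → 0ℚ ℚ.< q → ∃[ a ] ∃[ b ] 1 ≤ a × 1 ≤ b × ℕ→ℚ b ℚ.* q ≡ ℕ→ℚ a
positive-fraction (mkℚ (int zero) b _) (ℚ.*<* lt) = contradiction lt (ℤ.<-irrefl refl)
positive-fraction (mkℚ -[1+ a ] b _) (ℚ.*<* ())
-- `mkℚ` stores the denominator minus one.
positive-fraction q@(mkℚ (int (suc a)) b _) _ = suc a , suc b , s≤s z≤n , s≤s z≤n ,
  ℚ.toℚᵘ-injective (ℚᵘ.≃-trans (ℚ.toℚᵘ-homo-* (ℕ→ℚ (suc b)) q) (ℚᵘ.≃-trans (ℚᵘ.*-congʳ {mkℚᵘ (int (suc a)) b} (ℕ→ℚᵘ (suc b)))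
    (ℚᵘ.≃-trans (*≡* (trans (ℤ.*-identityʳ _) (trans (ℤ.*-comm (int (suc b)) (int (suc a))) (cong (λ x → int (suc a) ℤ.* int (suc x)) (sym (+-identityʳ b)))))) (ℚᵘ.≃-sym (ℕ→ℚᵘ (suc a))))))

ceiling : ∀ q → ∃[ d ] 1 ≤ d × q ℚ.≤ ℕ→ℚ d
ceiling q = suc ℤ.∣ ℚ.numerator q ∣ , s≤s z≤n , ℚ.toℚᵘ-cancel-≤ (ℚᵘ.≤-respʳ-≃ (ℚᵘ.≃-sym (ℕ→ℚᵘ _)) (bound q))
  where
  bound : ∀ q → ℚ.toℚᵘ q ℚᵘ.≤ mkℚᵘ (int (suc ℤ.∣ ℚ.numerator q ∣)) 0
  bound (mkℚ (int a) b _) = *≤* (ℤ.≤-trans (ℤ.≤-reflexive (ℤ.*-identityʳ (int a)))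
    (subst (int a ℤ.≤_) (ℤ.pos-* (suc a) (suc b)) (ℤ.+≤+ (≤-trans (n≤1+n a) (m≤m*n (suc a) (suc b))))))
  bound (mkℚ -[1+ a ] b _) = *≤* (ℤ.≤-trans (ℤ.≤-reflexive (ℤ.*-identityʳ -[1+ a ])) ℤ.-≤+)

sumOver : {A : Set} → (A → ℚ) → List A → ℚ
sumOver f l = sumℚ (List.map f l)

module _ {A : Set} where

  sumOver-cong : ∀ {f g : A → ℚ} → (∀ x → f x ≡ g x) → ∀ l → sumOver f l ≡ sumOver g l
  sumOver-cong h [] = refl
  sumOver-cong h (x ∷ l) = cong₂ ℚ._+_ (h x) (sumOver-cong h l)

  sumOver-+ : ∀ (f g : A → ℚ) l → sumOver (λ x → f x ℚ.+ g x) l ≡ sumOver f l ℚ.+ sumOver g l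
  sumOver-+ f g [] = refl
  sumOver-+ f g (x ∷ l) = trans (cong ((f x ℚ.+ g x) ℚ.+_) (sumOver-+ f g l))
    (solve 4 (λ a b c d → (a :+ b) :+ (c :+ d) := (a :+ c) :+ (b :+ d)) refl (f x) (g x) (sumOver f l) (sumOver g l))
    where open +-*-Solver

  sumOver-* : ∀ c (f : A → ℚ) l → sumOver (λ x → c ℚ.* f x) l ≡ c ℚ.* sumOver f l
  sumOver-* c f [] = sym (ℚ.*-zeroʳ c)
  sumOver-* c f (x ∷ l) = trans (cong (c ℚ.* f x ℚ.+_) (sumOver-* c f l)) (sym (ℚ.*-distribˡ-+ c (f x) (sumOver f l)))

  sumOver-pairs : ∀ {B : Set} (f : B → ℚ) (g h : A → B) l →
    sumOver f (concatMap (λ v → g v ∷ h v ∷ []) l) ≡ sumOver (λ v → f (g v) ℚ.+ f (h v)) l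
  sumOver-pairs f g h [] = refl
  sumOver-pairs f g h (v ∷ l) = trans (cong (λ x → f (g v) ℚ.+ (f (h v) ℚ.+ x)) (sumOver-pairs f g h l)) (sym (ℚ.+-assoc (f (g v)) (f (h v)) _))

  sumOver-filter : ∀ (f : A → ℚ) (b : A → Bool) l →
    sumOver f (List.filter (λ x → T? (b x)) l) ≡ sumOver (λ x → indicator (b x) ℚ.* f x) l
  sumOver-filter f b [] = refl
  sumOver-filter f b (x ∷ l) with b x
  ... | true = cong₂ ℚ._+_ (sym (ℚ.*-identityˡ (f x))) (sumOver-filter f b l)
  ... | false = trans (sumOver-filter f b l) (sym (trans (cong (ℚ._+ _) (ℚ.*-zeroˡ (f x))) (ℚ.+-identityˡ _)))

  sumOver-1 : ∀ (l : List A) → sumOver (λ _ → 1ℚ) l ≡ ℕ→ℚ (length l)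
  sumOver-1 [] = refl
  sumOver-1 (x ∷ l) = trans (cong (1ℚ ℚ.+_) (sumOver-1 l)) (sym (ℕ→ℚ-+ 1 (length l)))

bit : Bool → ℕ
bit b = if b then 1 else 0

ℕ→ℚ-bit : ∀ b → ℕ→ℚ (bit b) ≡ indicator b
ℕ→ℚ-bit true = refl
ℕ→ℚ-bit false = refl

indicator-∧ : ∀ a b → indicator (a ∧ b) ≡ indicator a ℚ.* indicator b
indicator-∧ true b = sym (ℚ.*-identityˡ (indicator b))
indicator-∧ false b = sym (ℚ.*-zeroˡ (indicator b))

percWeight-total : ∀ p m (G : Vec Bool m) → sumOver (percWeight p G) (allVecs m) ≡ 1ℚ
percWeight-total p zero [] = refl
percWeight-total p (suc m) (e ∷ G) = trans (sumOver-pairs (percWeight p (e ∷ G)) (false ∷_) (true ∷_) (allVecs m))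
  (trans (sumOver-cong (pointwise e) (allVecs m)) (percWeight-total p m G))
  where
  open +-*-Solver
  pointwise : ∀ e H → percWeight p (e ∷ G) (false ∷ H) ℚ.+ percWeight p (e ∷ G) (true ∷ H) ≡ percWeight p G H
  pointwise true H = solve 2 (λ p x → (con 1ℚ :- p) :* x :+ p :* x := x) refl p (percWeight p G H)
  pointwise false H = ℚ.+-identityʳ (percWeight p G H)

percSum : ℚ → ∀ m → (Vec Bool m → Vec Bool m → ℕ) → ℚ
percSum p m F = sumOver (λ G → sumOver (λ H → percWeight p G H ℚ.* ℕ→ℚ (F G H)) (allVecs m)) (allVecs m)

-- Integer weights proportional to the percolation weights, p being a / b; the factor 2 makes room
-- for splitting the open edges evenly into two rounds.
weights : ℕ → ℕ → St → ℕ
weights a b none = 2 * b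
weights a b closed = 2 * (b ∸ a)
weights a b open₁ = a
weights a b open₂ = a

weights≥1 : ∀ {a b} → 1 ≤ a → a < b → ∀ s → 1 ≤ weights a b s
weights≥1 a≥1 a<b none = 1≤* {2} (s≤s z≤n) (≤-trans a≥1 (<⇒≤ a<b))
weights≥1 a≥1 a<b closed = 1≤* {2} (s≤s z≤n) (m<n⇒0<n∸m a<b)
weights≥1 a≥1 a<b open₁ = a≥1
weights≥1 a≥1 a<b open₂ = a≥1

module Transfer (p : ℚ) (a b : ℕ) (a≥1 : 1 ≤ a) (a<b : a < b) (bp≡a : ℕ→ℚ b ℚ.* p ≡ ℕ→ℚ a) where
  open Integral (weights a b) (weights≥1 a≥1 a<b)

  opaque
    unfolding ∫

    -- The status `none` weighs `2 * b`, exactly as much as the three edge statuses together. Hence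
    -- every graph has the same total weight, which factors out slot by slot, and within an edge the
    -- open share is a/b, that is `p`.
    ∫≡percSum : ∀ m (F : Vec Bool m → Vec Bool m → ℕ) →
      ℕ→ℚ (∫ (λ ω → F (Vec.map isEdge ω) (Vec.map isOpen ω))) ≡ ℕ→ℚ ((2 * b) ^ m) ℚ.* percSum p m F
    ∫≡percSum zero F = sym (trans (ℚ.*-identityˡ _) (trans (ℚ.+-identityʳ _) (trans (ℚ.+-identityʳ _) (ℚ.*-identityˡ _))))
    ∫≡percSum (suc m) F = begin
      ℕ→ℚ (∫ {m} (λ v → F′ (Vec.map isEdge v) (Vec.map isOpen v)))
        ≡⟨ ∫≡percSum m F′ ⟩
      ℕ→ℚ ((2 * b) ^ m) ℚ.* percSum p m F′
        ≡⟨ cong (ℕ→ℚ ((2 * b) ^ m) ℚ.*_) (trans (sumOver-cong (λ G → trans (sumOver-cong (pointwise G) (allVecs m)) (sumOver-* β _ (allVecs m))) (allVecs m)) (sumOver-* β _ (allVecs m))) ⟩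
      ℕ→ℚ ((2 * b) ^ m) ℚ.* (β ℚ.* sumOver (λ G → sumOver (inner G) (allVecs m)) (allVecs m))
        ≡⟨ trans (sym (ℚ.*-assoc (ℕ→ℚ ((2 * b) ^ m)) β _)) (cong₂ ℚ._*_ (trans (ℚ.*-comm (ℕ→ℚ ((2 * b) ^ m)) β) (sym (ℕ→ℚ-* (2 * b) ((2 * b) ^ m)))) (sym unfold)) ⟩
      ℕ→ℚ ((2 * b) ^ suc m) ℚ.* percSum p (suc m) F ∎
      where
      open ≡-Reasoning
      open +-*-Solver
      β A : ℚ
      β = ℕ→ℚ (2 * b)
      A = ℕ→ℚ a
      F′ : Vec Bool m → Vec Bool m → ℕ
      F′ G H = 2 * b * F (false ∷ G) (false ∷ H) + 2 * (b ∸ a) * F (true ∷ G) (false ∷ H) + (a * F (true ∷ G) (true ∷ H) + a * F (true ∷ G) (true ∷ H))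
      f : Bool → Bool → Vec Bool m → Vec Bool m → ℚ
      f x y G H = ℕ→ℚ (F (x ∷ G) (y ∷ H))
      -- The summand with `0ℚ` is the open pair without an edge, which no status represents.
      inner : Vec Bool m → Vec Bool m → ℚ
      inner G H = (percWeight p G H ℚ.* f false false G H ℚ.+ 0ℚ ℚ.* f false true G H) ℚ.+
        ((1ℚ ℚ.- p) ℚ.* percWeight p G H ℚ.* f true false G H ℚ.+ p ℚ.* percWeight p G H ℚ.* f true true G H)
      unfold : percSum p (suc m) F ≡ sumOver (λ G → sumOver (inner G) (allVecs m)) (allVecs m)
      unfold = trans (sumOver-pairs (λ G → sumOver (λ H → percWeight p G H ℚ.* ℕ→ℚ (F G H)) (allVecs (suc m))) (false ∷_) (true ∷_) (allVecs m))
        (sumOver-cong (λ G → trans (cong₂ ℚ._+_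
          (sumOver-pairs (λ H → percWeight p (false ∷ G) H ℚ.* ℕ→ℚ (F (false ∷ G) H)) (false ∷_) (true ∷_) (allVecs m))
          (sumOver-pairs (λ H → percWeight p (true ∷ G) H ℚ.* ℕ→ℚ (F (true ∷ G) H)) (false ∷_) (true ∷_) (allVecs m)))
          (sym (sumOver-+ (λ H → percWeight p G H ℚ.* f false false G H ℚ.+ 0ℚ ℚ.* f false true G H) _ (allVecs m)))) (allVecs m))
      βp : β ℚ.* p ≡ A ℚ.+ A
      βp = trans (cong (ℚ._* p) (ℕ→ℚ-* 2 b)) (trans (ℚ.*-assoc (ℕ→ℚ 2) (ℕ→ℚ b) p) (trans (cong (ℕ→ℚ 2 ℚ.*_) bp≡a)
        (trans (cong (ℚ._* A) (ℕ→ℚ-+ 1 1)) (solve 1 (λ x → (con 1ℚ :+ con 1ℚ) :* x := x :+ x) refl A))))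
      κ : ℕ→ℚ (2 * (b ∸ a)) ≡ β ℚ.- β ℚ.* p
      κ = begin
        ℕ→ℚ (2 * (b ∸ a))                              ≡⟨ solve 2 (λ x y → x := (x :+ (y :+ y)) :- (y :+ y)) refl (ℕ→ℚ (2 * (b ∸ a))) A ⟩
        (ℕ→ℚ (2 * (b ∸ a)) ℚ.+ (A ℚ.+ A)) ℚ.- (A ℚ.+ A) ≡⟨ cong₂ ℚ._-_ (sym (trans (ℕ→ℚ-+ (2 * (b ∸ a)) (a + a)) (cong (ℕ→ℚ (2 * (b ∸ a)) ℚ.+_) (ℕ→ℚ-+ a a)))) (sym βp) ⟩
        ℕ→ℚ (2 * (b ∸ a) + (a + a)) ℚ.- β ℚ.* p         ≡⟨ cong (λ x → ℕ→ℚ x ℚ.- β ℚ.* p) (trans (cong (λ x → 2 * (b ∸ a) + x) (cong (a +_) (sym (+-identityʳ a)))) (trans (sym (*-distribˡ-+ 2 (b ∸ a) a)) (cong (2 *_) (m∸n+n≡m (<⇒≤ a<b))))) ⟩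
        β ℚ.- β ℚ.* p                                   ∎
      pointwise : ∀ G H → percWeight p G H ℚ.* ℕ→ℚ (F′ G H) ≡ β ℚ.* inner G H
      pointwise G H = begin
        pw ℚ.* ℕ→ℚ (F′ G H)
          ≡⟨ cong (pw ℚ.*_) (trans (ℕ→ℚ-+ (2 * b * F (false ∷ G) (false ∷ H) + 2 * (b ∸ a) * F (true ∷ G) (false ∷ H)) _) (cong₂ ℚ._+_
               (trans (ℕ→ℚ-+ (2 * b * F (false ∷ G) (false ∷ H)) _) (cong₂ ℚ._+_ (ℕ→ℚ-* (2 * b) _) (ℕ→ℚ-* (2 * (b ∸ a)) _)))
               (trans (ℕ→ℚ-+ (a * F (true ∷ G) (true ∷ H)) _) (cong₂ ℚ._+_ (ℕ→ℚ-* a _) (ℕ→ℚ-* a _))))) ⟩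
        pw ℚ.* ((β ℚ.* f false false G H ℚ.+ ℕ→ℚ (2 * (b ∸ a)) ℚ.* f true false G H) ℚ.+ (A ℚ.* f true true G H ℚ.+ A ℚ.* f true true G H))
          ≡⟨ cong₂ (λ x y → pw ℚ.* ((β ℚ.* f false false G H ℚ.+ x ℚ.* f true false G H) ℚ.+ y)) κ
               (trans (sym (ℚ.*-distribʳ-+ (f true true G H) A A)) (cong (ℚ._* f true true G H) (sym βp))) ⟩
        pw ℚ.* ((β ℚ.* f false false G H ℚ.+ (β ℚ.- β ℚ.* p) ℚ.* f true false G H) ℚ.+ β ℚ.* p ℚ.* f true true G H)
          ≡⟨ solve 7 (λ w β p x u y z → w :* ((β :* x :+ (β :- β :* p) :* y) :+ β :* p :* z) :=
               β :* ((w :* x :+ con 0ℚ :* u) :+ ((con 1ℚ :- p) :* w :* y :+ p :* w :* z))) refl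
               pw β p (f false false G H) (f false true G H) (f true false G H) (f true true G H) ⟩
        β ℚ.* inner G H ∎
        where
        pw : ℚ
        pw = percWeight p G H

uniformAvg-suc : ∀ {A : Set} (S : List A) f m → length S ≡ suc m → uniformAvg S f ≡ sumOver f S ℚ.* (int 1 ℚ./ suc m)
uniformAvg-suc S f m eq with length S | eq
... | .(suc m) | refl = refl

unit-fraction : ∀ m → ℕ→ℚ (suc m) ℚ.* (int 1 ℚ./ suc m) ≡ 1ℚ
unit-fraction m = ℚ.toℚᵘ-injective (ℚᵘ.≃-trans (ℚ.toℚᵘ-homo-* (ℕ→ℚ (suc m)) (int 1 ℚ./ suc m))
  (ℚᵘ.≃-trans (ℚᵘ.*-cong (ℕ→ℚᵘ (suc m)) (ℚ.toℚᵘ-fromℚᵘ (mkℚᵘ (int 1) m)))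
    (*≡* (trans (ℤ.*-identityʳ _) (trans (ℤ.*-identityʳ (int (suc m))) (sym (trans (ℤ.*-identityˡ _) (cong (λ x → int (suc x)) (+-identityʳ m)))))))))

∈-allVecs : ∀ {m} (v : Vec Bool m) → v ∈ allVecs m
∈-allVecs [] = here refl
∈-allVecs (false ∷ v) = ∈-concatMap⁺ _ (Any.map (λ { refl → here refl }) (∈-allVecs v))
∈-allVecs (true ∷ v) = ∈-concatMap⁺ _ (Any.map (λ { refl → there (here refl) }) (∈-allVecs v))

module Probability (p δ : ℚ) (a b k₀ : ℕ) (a≥1 : 1 ≤ a) (a<b : a < b) (bp≡a : ℕ→ℚ b ℚ.* p ≡ ℕ→ℚ a)
  (dn : ℕ) (dn≥1 : 1 ≤ dn) (k₀≥1 : 1 ≤ k₀) (kδ≡dn : ℕ→ℚ k₀ ℚ.* δ ≡ ℕ→ℚ dn)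
  (n : ℕ) (D : Fin n → ℕ) where
  open Transfer p a b a≥1 a<b bp≡a
  open Model n D (weights a b) (weights≥1 a≥1 a<b)

  edgeGraph : State → Graph n
  edgeGraph = Vec.map isEdge

  deg≡degree : ∀ ω i → deg {n} (edgeGraph ω) i ≡ degree ω i
  deg≡degree ω i = trans (ΣV≡∑ n _) (∑-cong (λ j → trans (ι-if (T? (adj {n} (edgeGraph ω) i j)) 1)
    (trans (*-identityʳ _) (cong (λ x → ι (T? x)) (adj-status isEdge refl ω i j)))))

  hasDegrees-complete : ∀ G → (∀ i → deg {n} G i ≡ D i) → T (hasDegrees D G)
  hasDegrees-complete G h = All.all⁻ (λ i → deg {n} G i ≡ᵇ D i) (All.universal (λ i → ≡⇒≡ᵇ _ _ (h i)) (allFin n))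

  hasDegrees-sound : ∀ G → T (hasDegrees D G) → ∀ i → deg {n} G i ≡ D i
  hasDegrees-sound G t i = ≡ᵇ⇒≡ _ _ (All.lookup (All.all⁺ (λ i → deg {n} G i ≡ᵇ D i) (allFin n) t) (∈-allFin i))

  bit-ι : ∀ {P : Set} (d : Dec P) b → (P → T b) → (T b → P) → bit b ≡ ι d
  bit-ι d b f g = trans (ι-if (T? b) 1) (trans (*-identityʳ _) (ι-cong (T? b) d g f))

  module _ (E : Graph n → Bool) (rare : k₀ * μ (λ ω → ¬? (T? (E (openGraph ω)))) ≤ Z)
    (feasible : ∃[ G ] (∀ i → deg {n} G i ≡ D i)) where

    M : ℕ
    M = (2 * b) ^ nSlots n

    S : List (Graph n)
    S = List.filter (λ G → T? (hasDegrees D G)) (allGraphs n)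

    f : Graph n → ℚ
    f G = percProb {n} p G E

    Z≡ : ℕ→ℚ Z ≡ ℕ→ℚ M ℚ.* ℕ→ℚ (length S)
    Z≡ = trans (cong ℕ→ℚ (∫-cong (λ ω → sym (bit-ι (Valid? D ω) (hasDegrees D (edgeGraph ω))
          (λ v → hasDegrees-complete (edgeGraph ω) (λ i → trans (deg≡degree ω i) (v i)))
          (λ t i → trans (sym (deg≡degree ω i)) (hasDegrees-sound (edgeGraph ω) t i))))))
      (trans (∫≡percSum (nSlots n) (λ G H → bit (hasDegrees D G))) (cong (ℕ→ℚ M ℚ.*_) (begin
        percSum p (nSlots n) (λ G H → bit (hasDegrees D G))
          ≡⟨ sumOver-cong (λ G → trans (sumOver-cong (λ H → trans (ℚ.*-comm (percWeight p G H) _) (cong (ℚ._* percWeight p G H) (ℕ→ℚ-bit (hasDegrees D G)))) (allGraphs n))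
               (trans (sumOver-* (indicator (hasDegrees D G)) (percWeight p G) (allGraphs n)) (cong (indicator (hasDegrees D G) ℚ.*_) (percWeight-total p (nSlots n) G)))) (allGraphs n) ⟩
        sumOver (λ G → indicator (hasDegrees D G) ℚ.* 1ℚ) (allGraphs n)
          ≡⟨ sumOver-filter (λ _ → 1ℚ) (hasDegrees D) (allGraphs n) ⟨
        sumOver (λ _ → 1ℚ) S
          ≡⟨ sumOver-1 S ⟩
        ℕ→ℚ (length S) ∎)))
      where open ≡-Reasoning

    good : ℕ
    good = μ (λ ω → T? (E (openGraph ω)))

    good≡ : ℕ→ℚ good ≡ ℕ→ℚ M ℚ.* sumOver f S
    good≡ = trans (cong ℕ→ℚ (∫-cong (λ ω → sym (bit-ι (Valid? D ω ×-dec T? (E (openGraph ω))) (hasDegrees D (edgeGraph ω) ∧ E (openGraph ω))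
          (λ (v , t) → Equivalence.from T-∧ (hasDegrees-complete (edgeGraph ω) (λ i → trans (deg≡degree ω i) (v i)) , t))
          (λ t → (λ i → trans (sym (deg≡degree ω i)) (hasDegrees-sound (edgeGraph ω) (proj₁ (Equivalence.to T-∧ t)) i)) , proj₂ (Equivalence.to (T-∧ {hasDegrees D (edgeGraph ω)}) t))))))
      (trans (∫≡percSum (nSlots n) (λ G H → bit (hasDegrees D G ∧ E H))) (cong (ℕ→ℚ M ℚ.*_) (begin
        percSum p (nSlots n) (λ G H → bit (hasDegrees D G ∧ E H))
          ≡⟨ sumOver-cong (λ G → trans (sumOver-cong (λ H → trans (cong (percWeight p G H ℚ.*_) (trans (ℕ→ℚ-bit (hasDegrees D G ∧ E H)) (indicator-∧ (hasDegrees D G) (E H))))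
                 (solve 3 (λ x y z → x :* (y :* z) := y :* (x :* z)) refl (percWeight p G H) (indicator (hasDegrees D G)) (indicator (E H)))) (allGraphs n))
               (sumOver-* (indicator (hasDegrees D G)) _ (allGraphs n))) (allGraphs n) ⟩
        sumOver (λ G → indicator (hasDegrees D G) ℚ.* f G) (allGraphs n)
          ≡⟨ sumOver-filter f (hasDegrees D) (allGraphs n) ⟨
        sumOver f S ∎)))
      where
      open ≡-Reasoning
      open +-*-Solver

    Z≤ : k₀ * Z ≤ k₀ * good + Z
    Z≤ = ≤-trans (*-monoʳ-≤ k₀ (≤-trans (∫-mono (λ ω → ι-cover (Valid? D ω) (Valid? D ω ×-dec T? (E (openGraph ω))) (Valid? D ω ×-dec ¬? (T? (E (openGraph ω)))) (cases ω)))
        (≤-reflexive (∫-+ (λ ω → ι (Valid? D ω ×-dec T? (E (openGraph ω)))) _))))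
      (≤-trans (≤-reflexive (*-distribˡ-+ k₀ good _)) (+-monoʳ-≤ (k₀ * good) rare))
      where
      cases : ∀ ω → Valid D ω → (Valid D ω × T (E (openGraph ω))) ⊎ (Valid D ω × ¬ T (E (openGraph ω)))
      cases ω v with T? (E (openGraph ω))
      ... | yes t = inj₁ (v , t)
      ... | no ¬t = inj₂ (v , ¬t)

    fromℕ-positive : ∀ {m} → 1 ≤ m → ℚ.Positive (ℕ→ℚ m)
    fromℕ-positive m≥1 = ℚ.positive (ℕ→ℚ-mono-< {0} m≥1)

    good-≥ : (1ℚ ℚ.- δ) ℚ.* ℕ→ℚ Z ℚ.≤ ℕ→ℚ good
    good-≥ = ℚ.*-cancelˡ-≤-pos (ℕ→ℚ k₀) {{fromℕ-positive k₀≥1}} (begin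
      κ ℚ.* ((1ℚ ℚ.- δ) ℚ.* z)               ≡⟨ solve 3 (λ κ δ z → κ :* ((con 1ℚ :- δ) :* z) := κ :* z :+ :- (κ :* δ :* z)) refl κ δ z ⟩
      κ ℚ.* z ℚ.+ ℚ.- (κ ℚ.* δ ℚ.* z)        ≤⟨ ℚ.+-monoˡ-≤ (ℚ.- (κ ℚ.* δ ℚ.* z)) first ⟩
      κ ℚ.* g ℚ.+ z ℚ.+ ℚ.- (κ ℚ.* δ ℚ.* z)  ≤⟨ ℚ.+-monoˡ-≤ (ℚ.- (κ ℚ.* δ ℚ.* z)) (ℚ.+-monoʳ-≤ (κ ℚ.* g) second) ⟩
      κ ℚ.* g ℚ.+ κ ℚ.* δ ℚ.* z ℚ.+ ℚ.- (κ ℚ.* δ ℚ.* z)  ≡⟨ solve 2 (λ x y → x :+ y :+ :- y := x) refl (κ ℚ.* g) (κ ℚ.* δ ℚ.* z) ⟩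
      κ ℚ.* g                                ∎)
      where
      open ℚ.≤-Reasoning
      open +-*-Solver
      κ z g : ℚ
      κ = ℕ→ℚ k₀
      z = ℕ→ℚ Z
      g = ℕ→ℚ good
      first : κ ℚ.* z ℚ.≤ κ ℚ.* g ℚ.+ z
      first = subst₂ ℚ._≤_ (ℕ→ℚ-* k₀ Z) (trans (ℕ→ℚ-+ (k₀ * good) Z) (cong (ℚ._+ z) (ℕ→ℚ-* k₀ good))) (ℕ→ℚ-mono Z≤)
      -- This is 1/k₀ ≤ δ, because `k₀` times `δ` is the positive integer `dn`.
      second : z ℚ.≤ κ ℚ.* δ ℚ.* z
      second = subst (z ℚ.≤_) (trans (ℕ→ℚ-* dn Z) (cong (ℚ._* z) (sym kδ≡dn))) (ℕ→ℚ-mono (m≤n*m Z dn {{>-nonZero dn≥1}}))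

    prob-≥ : 1ℚ ℚ.- δ ℚ.≤ probGDp n D p E
    prob-≥ = split (length S) refl
      where
      empty : ∀ (l : List (Graph n)) → length l ≡ 0 → ∀ {x} → ¬ (x ∈ l)
      empty [] _ ()
      split : ∀ m → length S ≡ m → 1ℚ ℚ.- δ ℚ.≤ probGDp n D p E
      -- Feasibility excludes an empty list, on which the average would take its default value 0.
      split zero eq = contradiction (∈-filter⁺ (λ G → T? (hasDegrees D G)) (∈-allVecs (proj₁ feasible)) (hasDegrees-complete (proj₁ feasible) (proj₂ feasible))) (empty S eq)
      split (suc m) eq = subst (1ℚ ℚ.- δ ℚ.≤_) (sym (uniformAvg-suc S f m eq)) (begin
        1ℚ ℚ.- δ                                          ≡⟨ ℚ.*-identityʳ (1ℚ ℚ.- δ) ⟨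
        (1ℚ ℚ.- δ) ℚ.* 1ℚ                                 ≡⟨ cong ((1ℚ ℚ.- δ) ℚ.*_) (unit-fraction m) ⟨
        (1ℚ ℚ.- δ) ℚ.* (ℕ→ℚ (suc m) ℚ.* (int 1 ℚ./ suc m))  ≡⟨ ℚ.*-assoc (1ℚ ℚ.- δ) (ℕ→ℚ (suc m)) (int 1 ℚ./ suc m) ⟨
        (1ℚ ℚ.- δ) ℚ.* ℕ→ℚ (suc m) ℚ.* (int 1 ℚ./ suc m)    ≤⟨ ℚ.*-monoʳ-≤-nonNeg (int 1 ℚ./ suc m) {{ℚ.pos⇒nonNeg (int 1 ℚ./ suc m) {{ℚ.normalize-pos 1 (suc m)}}}} total ⟩
        sumOver f S ℚ.* (int 1 ℚ./ suc m)                   ∎)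
        where
        open ℚ.≤-Reasoning
        open +-*-Solver
        M≥1 : 1 ≤ M
        M≥1 = m^n>0 (2 * b) {{>-nonZero (1≤* {2} (s≤s z≤n) (≤-trans a≥1 (<⇒≤ a<b)))}} (nSlots n)
        total : (1ℚ ℚ.- δ) ℚ.* ℕ→ℚ (suc m) ℚ.≤ sumOver f S
        total = ℚ.*-cancelˡ-≤-pos (ℕ→ℚ M) {{fromℕ-positive M≥1}} (subst₂ ℚ._≤_
          (trans (cong ((1ℚ ℚ.- δ) ℚ.*_) (trans Z≡ (cong (λ x → ℕ→ℚ M ℚ.* ℕ→ℚ x) eq)))
            (solve 3 (λ x y z → x :* (y :* z) := y :* (x :* z)) refl (1ℚ ℚ.- δ) (ℕ→ℚ M) (ℕ→ℚ (suc m)))) good≡ good-≥)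

  bigComponent-complete : ∀ r-1 H → n < suc r-1 * L₁ {n} H → T (bigComponent n (int 1 ℚ./ suc r-1) H)
  bigComponent-complete r-1 H lt = subst T (sym (dec-true (ρ ℚ.* ℕ→ℚ n ℚ.<? ℕ→ℚ (L₁ {n} H)) below)) tt
    where
    ρ = int 1 ℚ./ suc r-1
    below : ρ ℚ.* ℕ→ℚ n ℚ.< ℕ→ℚ (L₁ {n} H)
    below = ℚ.*-cancelˡ-<-nonNeg (ℕ→ℚ (suc r-1)) {{ℚ.nonNegative (ℕ→ℚ-mono {0} {suc r-1} z≤n)}} (subst₂ ℚ._<_
      (sym (trans (sym (ℚ.*-assoc (ℕ→ℚ (suc r-1)) ρ (ℕ→ℚ n))) (trans (cong (ℚ._* ℕ→ℚ n) (unit-fraction r-1)) (ℚ.*-identityˡ (ℕ→ℚ n)))))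
      (ℕ→ℚ-* (suc r-1) (L₁ {n} H)) (ℕ→ℚ-mono-< lt))

module Conclusion (p δ d̄ : ℚ) (a b dn k₀ d : ℕ) (a≥1 : 1 ≤ a) (a<b : a < b) (bp≡a : ℕ→ℚ b ℚ.* p ≡ ℕ→ℚ a)
  (dn≥1 : 1 ≤ dn) (k₀≥1 : 1 ≤ k₀) (kδ≡dn : ℕ→ℚ k₀ ℚ.* δ ≡ ℕ→ℚ dn) (d≥1 : 1 ≤ d) (d̄≤d : d̄ ℚ.≤ ℕ→ℚ d) where

  -- Up to three bad events of probability at most 1/k each are allowed, so `k = 3 * k₀` brings
  -- their sum down to 1/k₀.
  module C = Combine (weights a b) (weights≥1 a≥1 a<b) d (3 * k₀) d≥1 (1≤* {3} (s≤s z≤n) k₀≥1)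

  ∑D≤ : ∀ n D → AvgDegAtMost n D d̄ → ∑ D ≤ d * n
  ∑D≤ n D average = subst (_≤ d * n) (ΣV≡∑ n D) (ℕ→ℚ-cancel-≤ (ℚ.≤-trans average (subst (d̄ ℚ.* ℕ→ℚ n ℚ.≤_) (sym (ℕ→ℚ-* d n))
    (ℚ.*-monoʳ-≤-nonNeg (ℕ→ℚ n) {{ℚ.nonNegative (ℕ→ℚ-mono {0} {n} z≤n)}} d̄≤d))))

  -- `suc (pred r)` equals `r`; the form shows the division that the denominator is nonzero.
  likely : ∀ r → 1 ≤ r → ∀ n D → IsDegSeq n D →
    3 * k₀ * Model.μ n D (weights a b) (weights≥1 a≥1 a<b) (λ ω → r * Model.L n D (weights a b) (weights≥1 a≥1 a<b) ω ≤? n) ≤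
      3 * Model.Z n D (weights a b) (weights≥1 a≥1 a<b) →
    1ℚ ℚ.- δ ℚ.≤ probGDp n D p (bigComponent n (int 1 ℚ./ suc (pred r)))
  likely r r≥1 n D (_ , _ , feasible) few = prob-≥ big (*-cancelˡ-≤ 3 (≤-trans (≤-reflexive (sym (*-assoc 3 k₀ _)))
      (≤-trans (*-monoʳ-≤ (3 * k₀) (μ-mono (λ ω → ¬? (T? (big (openGraph ω)))) (λ ω → r * L ω ≤? n) (λ ω _ → small ω))) few))) feasible
    where
    open Model n D (weights a b) (weights≥1 a≥1 a<b)
    open Probability p δ a b k₀ a≥1 a<b bp≡a dn dn≥1 k₀≥1 kδ≡dn n D using (bigComponent-complete; prob-≥)
    big : Graph n → Bool
    big = bigComponent n (int 1 ℚ./ suc (pred r))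
    small : ∀ ω → ¬ T (big (openGraph ω)) → r * L ω ≤ n
    small ω ¬big = ≮⇒≥ (λ lt → ¬big (bigComponent-complete (pred r) (openGraph ω)
      (subst (λ x → n < x * L ω) (sym (suc-pred r {{>-nonZero r≥1}})) lt)))

  conclusion : ∃[ K ] ∃[ c₀ ] ((c : ℕ) → c₀ ≤ c →
    ∃[ ρ ] (0ℚ ℚ.< ρ × ∃[ n₀ ] ((n : ℕ) → n₀ ≤ n →
    (D : Fin n → ℕ) → IsDegSeq n D → AvgDegAtMost n D d̄ →
    (¬ A₁ n K c D ⊎ ¬ A₂ n K 0 c D) →
    1ℚ ℚ.- δ ℚ.≤ probGDp n D p (bigComponent n ρ))))
  conclusion = C.K , 8 * d , λ c 8d≤c →
    int 1 ℚ./ suc (pred (C.r c 8d≤c)) ,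
    ℚ.positive⁻¹ (int 1 ℚ./ suc (pred (C.r c 8d≤c))) {{ℚ.normalize-pos 1 (suc (pred (C.r c 8d≤c)))}} ,
    C.n₀ c 8d≤c , λ n large D degSeq average unsparse →
      likely (C.r c 8d≤c) (C.r≥1 c 8d≤c) n D degSeq
        (C.few-small-components c 8d≤c n D large (proj₁ degSeq) (∑D≤ n D average) unsparse)

theorem1p2 : (p δ d̄ : ℚ) → 0ℚ <ℚ p → p <ℚ 1ℚ → 0ℚ <ℚ δ → δ <ℚ 1ℚ → 1ℚ ≤ℚ d̄ →
    ∃[ K ] ∃[ c₀ ] ((c : ℕ) → c₀ ≤ c →
    ∃[ ρ ] (0ℚ <ℚ ρ × ∃[ n₀ ] ((n : ℕ) → n₀ ≤ n →
    (D : Fin n → ℕ) → IsDegSeq n D → AvgDegAtMost n D d̄ →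
    (¬ A₁ n K c D ⊎ ¬ A₂ n K 0 c D) →
    1ℚ - δ ≤ℚ probGDp n D p (bigComponent n ρ))))
theorem1p2 p δ d̄ 0<p p<1 0<δ δ<1 1≤d̄ =
  let (a , b , a≥1 , b≥1 , bp≡a) = positive-fraction p 0<p
      (dn , k₀ , dn≥1 , k₀≥1 , kδ≡dn) = positive-fraction δ 0<δ
      (d , d≥1 , d̄≤d) = ceiling d̄
      -- From `p < 1`. It makes the weight of `closed` positive, as resetting an edge to that status
      -- requires.
      a<b = ℕ→ℚ-cancel-< (subst₂ ℚ._<_ bp≡a (ℚ.*-identityʳ (ℕ→ℚ b))
        (ℚ.*-monoʳ-<-pos (ℕ→ℚ b) {{ℚ.positive (ℕ→ℚ-mono-< {0} {b} b≥1)}} p<1))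
  in Conclusion.conclusion p δ d̄ a b dn k₀ d a≥1 a<b bp≡a dn≥1 k₀≥1 kδ≡dn d≥1 d̄≤d
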